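{- There is an absolute constant $c>0$ such that for every sufficiently small $\varepsilon>0$ there is an algorithm running in time $\mathrm{poly}(n,1/\varepsilon)$ that, given a Correlation Clustering instance $(V,E^+\uplus E^-)$ with $n=|V|$ and optimum value $\mathrm{opt}$ (not given to the algorithm), outputs a preclustered instance $(\mathcal K,E_{\mathrm{adm}})$ such that (i) there exists a clustering that is good with respect to $(\mathcal K,E_{\mathrm{adm}})$ and has cost at most $(1+\varepsilon)\,\mathrm{opt}$, and (ii) $|E_{\mathrm{adm}}|\le \frac{c}{\varepsilon^2}\,\mathrm{opt}$.
   Context: A Correlation Clustering instance consists of a finite vertex set $V$ and a partition $E^+\uplus E^-=\binom V2$ of the unordered pairs of distinct vertices into $+$edges and $-$edges. A clustering is a partition of $V$; its cost is the number of $+$edges whose endpoints lie in different parts plus the number of $-$edges whose endpoints lie in the same part; $\mathrm{opt}$ is the minimum cost. A preclustered instance is a pair $(\mathcal K,E_{\mathrm{adm}})$ where $\mathcal K$ is a partition of $V$ (its parts are called atoms) and $E_{\mathrm{adm}}\subseteq\binom V2$ is a set of pairs (admissible edges) such that for every $uv\in E_{\mathrm{adm}}$, $u$ and $v$ lie in different atoms. A pair $uv$ with both endpoints in the same atom is atomic; a pair that is neither atomic nor admissible is non-admissible. A clustering $\mathcal C$ of $V$ is good with respect to $(\mathcal K,E_{\mathrm{adm}})$ if the endpoints of every atomic pair lie in the same cluster of $\mathcal C$ and the endpoints of every non-admissible pair lie in different clusters of $\mathcal C$. -}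

module Defs where

open import Algebra.Definitions.RawSemiring using ()
open import Data.Bool.Base using (Bool; true; false)
open import Data.Fin.Base using (Fin)
open import Data.Fin.Properties using () renaming (_<?_ to _<ᶠ?_; _≟_ to _≟ᶠ_)
open import Data.Integer.Base using (+_)
open import Data.List.Base
  using (List; []; _∷_; allFin; cartesianProduct; filter; foldr; length; map; tabulate)
open import Data.Nat.Base as ℕ using (ℕ; suc)
open import Data.Nat.Properties as ℕ using ()
open import Data.Product.Base using (Σ-syntax; ∃-syntax; _×_; _,_)
open import Data.Rational.Base as ℚ
  using (ℚ; 0ℚ; 1/_; Positive; +-*-rawSemiring)
open import Data.Rational.Properties using (pos⇒nonZero)
open import Level using (0ℓ)
open import Relation.Binary.Core using (Rel)
open import Relation.Binary.Definitions using (Decidable; Irreflexive; Symmetric)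
open import Relation.Binary.PropositionalEquality.Core using (_≡_; _≢_)
open import Relation.Binary.Structures using (IsDecEquivalence)
open import Relation.Nullary.Decidable using (does; yes; no; ¬?; _×-dec_)
open import Relation.Nullary.Negation using (¬_)

open Algebra.Definitions.RawSemiring +-*-rawSemiring public using (_^_)

-- A subset of the unordered pairs of distinct elements of Fin n.
record PairSet (n : ℕ) : Set₁ where
  field
    Edge   : Rel (Fin n) 0ℓ
    edge?  : Decidable Edge
    sym    : Symmetric Edge
    irrefl : Irreflexive _≡_ Edge

-- A partition of Fin n, as the relation "in the same part".
record Partition (n : ℕ) : Set₁ where
  field
    Same             : Rel (Fin n) 0ℓ
    isDecEquivalence : IsDecEquivalence Same

  open IsDecEquivalence isDecEquivalence public using () renaming (_≟_ to same?)

-- Each unordered pair of distinct elements is listed once, as (u , v) with u < v.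
pairs : ∀ n → List (Fin n × Fin n)
pairs n = filter (λ (u , v) → u <ᶠ? v) (cartesianProduct (allFin n) (allFin n))

countPairs : ∀ {n} {R : Rel (Fin n) 0ℓ} → Decidable R → ℕ
countPairs {n} R? = length (filter (λ (u , v) → R? u v) (pairs n))

size : ∀ {n} → PairSet n → ℕ
size E = countPairs (PairSet.edge? E)

record Instance (n : ℕ) : Set₁ where
  field
    E⁺ : PairSet n

  open PairSet E⁺ public using () renaming (Edge to Plus; edge? to plus?)

  Minus : Rel (Fin n) 0ℓ
  Minus u v = u ≢ v × ¬ Plus u v

  minus? : Decidable Minus
  minus? u v = ¬? (u ≟ᶠ v) ×-dec ¬? (plus? u v)

Clustering : ℕ → Set₁
Clustering = Partition

cost : ∀ {n} → Instance n → Clustering n → ℕ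
cost I C = countPairs (λ u v → plus? u v ×-dec ¬? (same? u v))
     ℕ.+ countPairs (λ u v → minus? u v ×-dec same? u v)
  where
  open Instance I
  open Partition C

IsOpt : ∀ {n} → Instance n → ℕ → Set₁
IsOpt {n} I opt = (∃[ C ] cost I C ≡ opt) × (∀ (C : Clustering n) → opt ℕ.≤ cost I C)

record Preclustered (n : ℕ) : Set₁ where
  field
    K    : Partition n
    Eadm : PairSet n

  open Partition K public using () renaming (Same to SameAtom)
  open PairSet Eadm public using () renaming (Edge to Admissible)

  field
    admissible⇒different : ∀ {u v} → Admissible u v → ¬ SameAtom u v

  Atomic : Rel (Fin n) 0ℓ
  Atomic u v = u ≢ v × SameAtom u v

  NonAdmissible : Rel (Fin n) 0ℓ
  NonAdmissible u v = u ≢ v × ¬ Atomic u v × ¬ Admissible u v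

Good : ∀ {n} → Preclustered n → Clustering n → Set
Good P C = (∀ {u v} → Atomic u v → Same u v)
         × (∀ {u v} → NonAdmissible u v → ¬ Same u v)
  where
  open Preclustered P
  open Partition C

-- Algorithms are programs of Jones's language WHILE (Computability and
-- Complexity from a Programming Perspective, 1997): imperative programs over
-- binary trees, charged one unit per elementary operation.  His whole-tree
-- equality test is omitted and cons can share its arguments, so each unit is a
-- constant number of steps on a pointer machine; polynomial time here is
-- polynomial time on Turing machines.

infixr 5 _∙_

data Tree : Set where
  nil : Tree
  _∙_ : Tree → Tree → Tree

left right : Tree → Tree
left  nil     = nil
left  (a ∙ _) = a
right nil     = nil
right (_ ∙ b) = b

Var : Set
Var = ℕ

Store : Set
Store = Var → Tree

_[_↦_] : Store → Var → Tree → Store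
(σ [ x ↦ d ]) y with y ℕ.≟ x
... | yes _ = d
... | no  _ = σ y

data Exp : Set where
  var   : Var → Exp
  nil   : Exp
  cons  : Exp → Exp → Exp
  hd tl : Exp → Exp

eval : Exp → Store → Tree
eval (var x)    σ = σ x
eval nil        σ = nil
eval (cons e f) σ = eval e σ ∙ eval f σ
eval (hd e)     σ = left (eval e σ)
eval (tl e)     σ = right (eval e σ)

expTime : Exp → ℕ
expTime (var x)    = 1
expTime nil        = 1
expTime (cons e f) = 1 ℕ.+ expTime e ℕ.+ expTime f
expTime (hd e)     = 1 ℕ.+ expTime e
expTime (tl e)     = 1 ℕ.+ expTime e

infix  6 _:=_
infixr 5 _⨾_

data Cmd : Set where
  _:=_     : Var → Exp → Cmd
  _⨾_      : Cmd → Cmd → Cmd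
  while_loop_ : Exp → Cmd → Cmd

-- ⟨ c , σ ⟩⇓[ t ] τ : command c started in store σ halts in store τ after time t.
data ⟨_,_⟩⇓[_]_ : Cmd → Store → ℕ → Store → Set where
  assign : ∀ {x e σ} →
           ⟨ x := e , σ ⟩⇓[ 1 ℕ.+ expTime e ] (σ [ x ↦ eval e σ ])
  seq    : ∀ {c₁ c₂ σ σ′ τ t₁ t₂} →
           ⟨ c₁ , σ ⟩⇓[ t₁ ] σ′ → ⟨ c₂ , σ′ ⟩⇓[ t₂ ] τ →
           ⟨ c₁ ⨾ c₂ , σ ⟩⇓[ 1 ℕ.+ t₁ ℕ.+ t₂ ] τ
  stop   : ∀ {e c σ} → eval e σ ≡ nil →
           ⟨ while e loop c , σ ⟩⇓[ 1 ℕ.+ expTime e ] σ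
  again  : ∀ {e c σ σ′ τ t₁ t₂} → eval e σ ≢ nil →
           ⟨ c , σ ⟩⇓[ t₁ ] σ′ → ⟨ while e loop c , σ′ ⟩⇓[ t₂ ] τ →
           ⟨ while e loop c , σ ⟩⇓[ 1 ℕ.+ expTime e ℕ.+ t₁ ℕ.+ t₂ ] τ

-- Input and output are both held by variable 0; all other variables start as nil.
initial : Tree → Store
initial d = (λ _ → nil) [ 0 ↦ d ]

Computes : Cmd → Tree → ℕ → Tree → Set
Computes c input t output =
  ∃[ τ ] ⟨ c , initial input ⟩⇓[ t ] τ × τ 0 ≡ output

encodeBool : Bool → Tree
encodeBool false = nil
encodeBool true  = nil ∙ nil

encodeList : List Tree → Tree
encodeList = foldr _∙_ nil

-- The n × n Boolean matrix of a relation, as a list of rows.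
encodeMatrix : ∀ {n} {R : Rel (Fin n) 0ℓ} → Decidable R → Tree
encodeMatrix R? =
  encodeList (tabulate λ u → encodeList (tabulate λ v → encodeBool (does (R? u v))))

encodeInstance : ∀ {n} → Instance n → Tree
encodeInstance I = encodeMatrix (Instance.plus? I)

encodePreclustered : ∀ {n} → Preclustered n → Tree
encodePreclustered P =
  encodeMatrix (Partition.same? K) ∙ encodeMatrix (PairSet.edge? Eadm)
  where open Preclustered P

fromℕ : ℕ → ℚ
fromℕ n = + n ℚ./ 1

_⁻¹ : (q : ℚ) .{{_ : Positive q}} → ℚ
q ⁻¹ = (1/ q) {{pos⇒nonZero q}}

-- A bivariate polynomial as a list of monomials: (a , i , j) stands for a xⁱ yʲ.
-- For upper bounds at nonnegative arguments, coefficients in ℕ suffice.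
Polynomial : Set
Polynomial = List (ℕ × ℕ × ℕ)

⟦_⟧ : Polynomial → ℚ → ℚ → ℚ
⟦ p ⟧ x y = foldr ℚ._+_ 0ℚ (map (λ (a , i , j) → fromℕ a ℚ.* x ^ i ℚ.* y ^ j) p)

{-# OPTIONS --safe #-}
module Submission where

-- Call v clean if almost all of its neighbours u have N[u] ≈ N[v] (closed neighbourhoods). Two
-- vertices share an atom if both are clean and their neighbourhoods overlap substantially; a pair
-- that is not clean–clean is admissible if u and v are joined by many walks u – w – v, each
-- weighted by 1 / deg w.
--
-- For (i), increase the price of disagreements by factors at most 1 + 1/m, with m ≈ 1/ε, and take a
-- clustering s that no extraction of a vertex set as a new cluster improves. Starting the local
-- search at an optimal clustering, s costs at most (1 + ε) opt. Extracting single vertices shows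
-- that two vertices of one cluster C have Ω(ε |C|) common neighbours in C, all of degree O(|C| / ε),
-- so their walks weigh Ω(ε²); extracting the neighbours agreeing with a clean v shows that N[v] is
-- almost the cluster of v, so s neither breaks nor merges atoms.
--
-- For (ii), the walks from v weigh deg v in total, so v has O(deg v / ε²) admissible partners, and
-- the degrees of the unclean vertices are charged to the disagreements of any clustering.

-- Local optima occur only in the analysis, so they may be found by exhaustive search; the program
-- evaluates `atom` and `adm` alone. Every local optimum joins or separates two clean vertices
-- exactly as `near` prescribes, and this is also why `atom` is transitive: the formula does not
-- show it, so transitivity is borrowed from the clusters of one local optimum.
--
-- The prices must not be uniform. With uniform prices, isolating a vertex shows only that it has as
-- many neighbours as non-neighbours in its cluster: two such halves may share almost nothing, and
-- the degree stays unbounded. With prices `m` and `m + 1`, a vertex that becomes a singleton gets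
-- its cut edges at the lower price. This pushes the half up by a fraction of order 1/m, which
-- forces common neighbours, and bounds the degree by O(m) times the cluster.
--
-- The time polynomial has to be fixed before ε. The program therefore depends on ε only through one
-- number `K`, loaded into a variable; the compiled expression and its symbolic time bound are the
-- same for all ε.

open import Defs

-- Finite sums and exchange inequalities.

module Sums where
  import Algebra.Properties.Semiring.Sum
  open import Data.Bool.Base using (Bool; true; false)
  open import Data.Fin.Base using (Fin; zero; suc)
  open import Data.Fin.Properties using (_≟_)
  open import Data.Nat.Base using (ℕ; zero; suc; _+_; _*_; _≤_; z≤n)
  open import Data.Nat.Properties hiding (_≟_)
  open import Data.Nat.Tactic.RingSolver using (solve-∀)
  open import Function.Base using (_∘_)
  open import Relation.Binary.PropositionalEquality
  open import Relation.Nullary.Decidable using (does; yes; no; dec-true; dec-false)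
  open import Relation.Nullary.Negation using (contradiction)

  module ∑ = Algebra.Properties.Semiring.Sum +-*-semiring

  -- Linear arithmetic by certificate: A ≤ B follows from L ≤ R with slack S,
  -- the identity being left to the ring solver.
  lin : ∀ {A B L R} S → L ≤ R → B + L ≡ A + R + S → A ≤ B
  lin {A} {B} {L} {R} S L≤R eq = +-cancelʳ-≤ R A B (begin
    A + R      ≤⟨ m≤m+n (A + R) S ⟩
    A + R + S  ≡⟨ eq ⟨
    B + L      ≤⟨ +-monoʳ-≤ B L≤R ⟩
    B + R      ∎)
    where open ≤-Reasoning

  ⟨_⟩ : Bool → ℕ
  ⟨ true ⟩  = 1
  ⟨ false ⟩ = 0

  ⟨b⟩≤1 : ∀ b → ⟨ b ⟩ ≤ 1
  ⟨b⟩≤1 true  = ≤-refl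
  ⟨b⟩≤1 false = z≤n

  _==_ : ∀ {n} → Fin n → Fin n → Bool
  u == v = does (u ≟ v)

  ==-refl : ∀ {n} (u : Fin n) → (u == u) ≡ true
  ==-refl u = dec-true (u ≟ u) refl

  ==-≢ : ∀ {n} {u v : Fin n} → u ≢ v → (u == v) ≡ false
  ==-≢ {u = u} {v} = dec-false (u ≟ v)

  opaque
    -- Opacity keeps sums folded through the case splits and rewrites that follow.
    sum : ∀ {n} → (Fin n → ℕ) → ℕ
    sum = ∑.sum

    sum-comm : ∀ {m n} (f : Fin m → Fin n → ℕ) →
               sum (λ i → sum (f i)) ≡ sum (λ j → sum λ i → f i j)
    sum-comm = ∑.∑-comm

    sum-suc : ∀ {n} (f : Fin (suc n) → ℕ) → sum f ≡ f zero + sum (f ∘ suc)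
    sum-suc f = refl

    sum-cong : ∀ {n} {f g : Fin n → ℕ} → (∀ i → f i ≡ g i) → sum f ≡ sum g
    sum-cong = ∑.sum-cong-≗

    sum-mono-≤ : ∀ {n} {f g : Fin n → ℕ} → (∀ i → f i ≤ g i) → sum f ≤ sum g
    sum-mono-≤ {zero}  h = z≤n
    sum-mono-≤ {suc n} h = +-mono-≤ (h zero) (sum-mono-≤ (h ∘ suc))

    sum-+ : ∀ {n} (f g : Fin n → ℕ) → sum (λ i → f i + g i) ≡ sum f + sum g
    sum-+ = ∑.∑-distrib-+

    sum-* : ∀ {n} c (f : Fin n → ℕ) → sum (λ i → c * f i) ≡ c * sum f
    sum-* c f = sym (∑.*-distribˡ-sum c f)

    sum-zero : ∀ {n} {f : Fin n → ℕ} → (∀ i → f i ≡ 0) → sum f ≡ 0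
    sum-zero {zero}  h = refl
    sum-zero {suc n} h rewrite h zero = sum-zero (h ∘ suc)

    term≤sum : ∀ {n} (f : Fin n → ℕ) i → f i ≤ sum f
    term≤sum f zero    = m≤m+n _ _
    term≤sum f (suc i) = ≤-trans (term≤sum (f ∘ suc) i) (m≤n+m _ _)

    sum-δ : ∀ {n} (v : Fin n) (g : Fin n → ℕ) → sum (λ i → ⟨ i == v ⟩ * g i) ≡ g v
    sum-δ {suc n} zero g = begin
      g zero + 0 + sum {n} (λ _ → 0)  ≡⟨ cong (g zero + 0 +_) (sum-zero {n} λ _ → refl) ⟩
      g zero + 0 + 0                  ≡⟨ +-identityʳ _ ⟩
      g zero + 0                      ≡⟨ +-identityʳ _ ⟩
      g zero                          ∎
      where open ≡-Reasoning
    sum-δ (suc v) g = sum-δ v (g ∘ suc)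

  # : ∀ {n} → (Fin n → Bool) → ℕ
  # f = sum (⟨_⟩ ∘ f)

  sum-≤-+ : ∀ {n} {f g h : Fin n → ℕ} → (∀ i → f i ≤ g i + h i) → sum f ≤ sum g + sum h
  sum-≤-+ {g = g} {h} le = ≤-trans (sum-mono-≤ le) (≤-reflexive (sum-+ g h))

  sum-+-≤-+ : ∀ {n} {e f g h : Fin n → ℕ} →
              (∀ i → e i + f i ≤ g i + h i) → sum e + sum f ≤ sum g + sum h
  sum-+-≤-+ {e = e} {f} {g} {h} le =
    subst₂ _≤_ (sum-+ e f) (sum-+ g h) (sum-mono-≤ le)

  #-mono : ∀ {n} {f g : Fin n → Bool} → (∀ i → ⟨ f i ⟩ ≤ ⟨ g i ⟩) → # f ≤ # g
  #-mono = sum-mono-≤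

  #-cong : ∀ {n} {f g : Fin n → Bool} → (∀ i → f i ≡ g i) → # f ≡ # g
  #-cong h = sum-cong (cong ⟨_⟩ ∘ h)

  true⇒1≤# : ∀ {n} (f : Fin n → Bool) {i} → f i ≡ true → 1 ≤ # f
  true⇒1≤# f {i} fi = ≤-trans (≤-reflexive (cong ⟨_⟩ (sym fi))) (term≤sum (⟨_⟩ ∘ f) i)

  #-singleton : ∀ {n} (v : Fin n) → # (_== v) ≡ 1
  #-singleton v = trans (sum-cong λ i → sym (*-identityʳ ⟨ i == v ⟩)) (sum-δ v λ _ → 1)

  two-true⇒2≤# : ∀ {n} (f : Fin n → Bool) {u v} → f u ≡ true → f v ≡ true → u ≢ v → 2 ≤ # f
  two-true⇒2≤# f {u} {v} fu fv u≢v = begin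
    1 + 1                          ≡⟨ cong₂ _+_ (#-singleton u) (#-singleton v) ⟨
    # (_== u) + # (_== v)          ≡⟨ sum-+ (λ i → ⟨ i == u ⟩) (λ i → ⟨ i == v ⟩) ⟨
    sum (λ i → ⟨ i == u ⟩ + ⟨ i == v ⟩) ≤⟨ sum-mono-≤ pointwise ⟩
    # f                            ∎
    where
    open ≤-Reasoning
    pointwise : ∀ i → ⟨ i == u ⟩ + ⟨ i == v ⟩ ≤ ⟨ f i ⟩
    pointwise i with i ≟ u | i ≟ v
    ... | yes refl | yes refl = contradiction refl u≢v
    ... | yes refl | no _     = ≤-reflexive (cong ⟨_⟩ (sym fu))
    ... | no _     | yes refl = ≤-reflexive (cong ⟨_⟩ (sym fv))
    ... | no _     | no _     = z≤n

  ∑∑ : ∀ {n} → (Fin n → Fin n → ℕ) → ℕ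
  ∑∑ f = sum λ x → sum (f x)

  ∑∑-cong : ∀ {n} {f g : Fin n → Fin n → ℕ} → (∀ x w → f x w ≡ g x w) → ∑∑ f ≡ ∑∑ g
  ∑∑-cong h = sum-cong λ x → sum-cong (h x)

  ∑∑-mono-≤ : ∀ {n} {f g : Fin n → Fin n → ℕ} → (∀ x w → f x w ≤ g x w) → ∑∑ f ≤ ∑∑ g
  ∑∑-mono-≤ h = sum-mono-≤ λ x → sum-mono-≤ (h x)

  ∑∑-+ : ∀ {n} (f g : Fin n → Fin n → ℕ) → ∑∑ (λ x w → f x w + g x w) ≡ ∑∑ f + ∑∑ g
  ∑∑-+ f g = trans (sum-cong λ x → sum-+ (f x) (g x)) (sum-+ (sum ∘ f) (sum ∘ g))

  ∑∑-* : ∀ {n} c (f : Fin n → Fin n → ℕ) → ∑∑ (λ x w → c * f x w) ≡ c * ∑∑ f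
  ∑∑-* c f = trans (sum-cong λ x → sum-* c (f x)) (sum-* c (sum ∘ f))

  ∑∑-row : ∀ {n} (v : Fin n) (g : Fin n → Fin n → ℕ) →
           ∑∑ (λ x w → ⟨ x == v ⟩ * g x w) ≡ sum (g v)
  ∑∑-row v g = trans (sum-cong λ x → sum-* ⟨ x == v ⟩ (g x)) (sum-δ v (sum ∘ g))

  ∑∑-column : ∀ {n} (v : Fin n) (g : Fin n → Fin n → ℕ) →
              ∑∑ (λ x w → ⟨ w == v ⟩ * g x w) ≡ sum (λ x → g x v)
  ∑∑-column v g = sum-cong λ x → sum-δ v (g x)

  exchange-≤ : ∀ {a b p q} → a ≤ b → b + p ≤ a + q → p ≤ q
  exchange-≤ {a} {b} {p} {q} a≤b le = +-cancelˡ-≤ a p q (≤-trans (+-monoˡ-≤ p a≤b) le)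

  -- Cells where f′ ≤ f only help f′, so a smaller total of f must come from the cross.
  cross-≤ : ∀ {n} (v : Fin n) {f f′ : Fin n → Fin n → ℕ} → f v v ≡ 0 → f′ v v ≡ 0 →
            (∀ {x w} → x ≢ v → w ≢ v → f′ x w ≤ f x w) → ∑∑ f ≤ ∑∑ f′ →
            sum (f v) + sum (λ x → f x v) ≤ sum (f′ v) + sum (λ x → f′ x v)
  cross-≤ v {f} {f′} fvv f′vv off le =
    subst₂ _≤_ (cross f) (cross f′) (exchange-≤ le
      (subst₂ _≤_ (∑∑-+ f′ (onCross f)) (∑∑-+ f (onCross f′)) (∑∑-mono-≤ pointwise)))
    where
    onCross : (Fin _ → Fin _ → ℕ) → Fin _ → Fin _ → ℕ
    onCross g x w = ⟨ x == v ⟩ * g x w + ⟨ w == v ⟩ * g x w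

    cross : ∀ g → ∑∑ (onCross g) ≡ sum (g v) + sum (λ x → g x v)
    cross g = trans (∑∑-+ (λ x w → ⟨ x == v ⟩ * g x w) (λ x w → ⟨ w == v ⟩ * g x w))
                    (cong₂ _+_ (∑∑-row v g) (∑∑-column v g))

    swap : ∀ p q → p + (q + 0 + 0) ≡ q + (p + 0 + 0)
    swap = solve-∀

    swap′ : ∀ p q → p + (q + 0) ≡ q + (p + 0)
    swap′ = solve-∀

    pointwise : ∀ x w → f′ x w + onCross f x w ≤ f x w + onCross f′ x w
    pointwise x w with x ≟ v | w ≟ v
    -- The corner lies in the row and in the column; it vanishes for both functions, so counting it
    -- twice is harmless.
    ... | yes refl | yes refl rewrite fvv | f′vv = ≤-refl
    ... | yes refl | no _     = ≤-reflexive (swap (f′ x w) (f x w))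
    ... | no _     | yes refl = ≤-reflexive (swap′ (f′ x w) (f x w))
    ... | no x≢v   | no w≢v   = +-monoˡ-≤ 0 (off x≢v w≢v)

  -- The trade of `cross-≤` for an arbitrary region: what `f′` saves off `Q` it must at least pay
  -- back inside `Q`.
  region-≤ : ∀ {n} (Q : Fin n → Fin n → Bool) {f f′ : Fin n → Fin n → ℕ} →
             (∀ x w → Q x w ≡ false → f′ x w ≤ f x w) → ∑∑ f ≤ ∑∑ f′ →
             ∑∑ (λ x w → ⟨ Q x w ⟩ * f x w) ≤ ∑∑ (λ x w → ⟨ Q x w ⟩ * f′ x w)
  region-≤ Q {f} {f′} off le = exchange-≤ le
    (subst₂ _≤_ (∑∑-+ f′ _) (∑∑-+ f _) (∑∑-mono-≤ pointwise))
    where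
    pointwise : ∀ x w → f′ x w + ⟨ Q x w ⟩ * f x w ≤ f x w + ⟨ Q x w ⟩ * f′ x w
    pointwise x w with Q x w in eq
    ... | true  = ≤-reflexive (lemma (f′ x w) (f x w))
      where
      lemma : ∀ p q → p + (q + 0) ≡ q + (p + 0)
      lemma = solve-∀
    ... | false = +-monoˡ-≤ 0 (off x w eq)

-- Boolean counting, symmetric differences, equivalences and extraction of a cluster.

module Counting where
  open Sums
  open import Data.Bool.Base using (Bool; true; false; not; T; _∧_; _∨_; _xor_)
  open import Data.Fin.Base using (Fin; zero; suc)
  open import Data.Fin.Properties using (_≟_; any?)
  open import Data.Nat.Base using (ℕ; zero; suc; _+_; _*_; _≤_; _<_; z≤n; _≤ᵇ_)
  open import Data.Nat.Properties renaming (_≟_ to _≟ℕ_)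
  open import Data.Product.Base using (∃-syntax; _×_; _,_)
  open import Data.Bool.Properties using () renaming (_≟_ to _≟ᵇ_)
  open import Data.Unit.Base using (tt)
  open import Function.Base using (_∘_)
  open import Relation.Binary.PropositionalEquality
  open import Relation.Nullary.Decidable using (Dec; yes; no; dec-true; dec-false; map′; _×-dec_; from-yes)
  open import Relation.Nullary.Negation using (contradiction)

  opaque
    le : ℕ → ℕ → Bool
    le = _≤ᵇ_

    ≤⇒le : ∀ {p q} → p ≤ q → le p q ≡ true
    ≤⇒le = dec-true (_ ≤? _)

    le⇒≤ : ∀ {p q} → le p q ≡ true → p ≤ q
    le⇒≤ {p} {q} eq = ≤ᵇ⇒≤ p q (subst T (sym eq) tt)

    >⇒not-le : ∀ {p q} → q < p → le p q ≡ false
    >⇒not-le q<p = dec-false (_ ≤? _) (<⇒≱ q<p)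

    not-le⇒> : ∀ {p q} → le p q ≡ false → q < p
    not-le⇒> eq = ≰⇒> λ p≤q → contradiction (trans (sym eq) (≤⇒le p≤q)) λ ()

  ⟨le⟩-mono : ∀ {c p q} → p ≤ q → ⟨ le c p ⟩ ≤ ⟨ le c q ⟩
  ⟨le⟩-mono {c} {p} {q} p≤q with le c p in eq
  ... | false = z≤n
  ... | true rewrite ≤⇒le (≤-trans (le⇒≤ {c} {p} eq) p≤q) = ≤-refl

  -- Pointwise inequalities between indicators are settled by deciding all truth assignments and
  -- applying `from-yes`.
  all-bool? : ∀ {P : Bool → Set} → (∀ b → Dec (P b)) → Dec (∀ b → P b)
  all-bool? P? = map′ (λ { (pt , pf) true → pt ; (pt , pf) false → pf })
                      (λ h → h true , h false) (P? true ×-dec P? false)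

  Δ : ∀ {n} → (Fin n → Bool) → (Fin n → Bool) → ℕ
  Δ f g = # λ i → f i xor g i

  Δ-triangle : ∀ {n} (f g h : Fin n → Bool) → Δ f h ≤ Δ f g + Δ g h
  Δ-triangle f g h = sum-≤-+ λ i → lemma (f i) (g i) (h i)
    where
    lemma = from-yes (all-bool? λ x → all-bool? λ y → all-bool? λ z → ⟨ x xor z ⟩ ≤? ⟨ x xor y ⟩ + ⟨ y xor z ⟩)

  Δ-sym : ∀ {n} (f g : Fin n → Bool) → Δ f g ≡ Δ g f
  Δ-sym f g = #-cong λ i → lemma (f i) (g i)
    where
    lemma = from-yes (all-bool? λ x → all-bool? λ y → x xor y ≟ᵇ y xor x)

  Δ-congʳ : ∀ {n} (f : Fin n → Bool) {g h : Fin n → Bool} → (∀ i → g i ≡ h i) → Δ f g ≡ Δ f h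
  Δ-congʳ f eq = #-cong λ i → cong (f i xor_) (eq i)

  #≤∩+Δ : ∀ {n} (f g : Fin n → Bool) → # f ≤ # (λ i → f i ∧ g i) + Δ f g
  #≤∩+Δ f g = sum-≤-+ λ i → lemma (f i) (g i)
    where
    lemma = from-yes (all-bool? λ x → all-bool? λ y → ⟨ x ⟩ ≤? ⟨ x ∧ y ⟩ + ⟨ x xor y ⟩)

  #≤#+Δ : ∀ {n} (f g : Fin n → Bool) → # f ≤ # g + Δ f g
  #≤#+Δ f g = sum-≤-+ λ i → lemma (f i) (g i)
    where
    lemma = from-yes (all-bool? λ x → all-bool? λ y → ⟨ x ⟩ ≤? ⟨ y ⟩ + ⟨ x xor y ⟩)

  #+#≡2∩+Δ : ∀ {n} (f g : Fin n → Bool) → # f + # g ≡ 2 * # (λ i → f i ∧ g i) + Δ f g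
  #+#≡2∩+Δ f g = begin
    # f + # g ≡⟨ sum-+ (⟨_⟩ ∘ f) (⟨_⟩ ∘ g) ⟨
    sum (λ i → ⟨ f i ⟩ + ⟨ g i ⟩) ≡⟨ sum-cong (λ i → lemma (f i) (g i)) ⟩
    sum (λ i → 2 * ⟨ f i ∧ g i ⟩ + ⟨ f i xor g i ⟩) ≡⟨ sum-+ _ _ ⟩
    sum (λ i → 2 * ⟨ f i ∧ g i ⟩) + Δ f g ≡⟨ cong (_+ Δ f g) (sum-* 2 _) ⟩
    2 * # (λ i → f i ∧ g i) + Δ f g ∎
    where
    open ≡-Reasoning
    lemma = from-yes (all-bool? λ x → all-bool? λ y → ⟨ x ⟩ + ⟨ y ⟩ ≟ℕ 2 * ⟨ x ∧ y ⟩ + ⟨ x xor y ⟩)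

  -- If `g x < f x` held throughout `B`, the two sums would differ by at least the one unit gained
  -- at `v`.
  pigeonhole : ∀ {n} (B : Fin n → Bool) (f g : Fin n → ℕ) {v} → B v ≡ true →
               sum (λ x → ⟨ B x ⟩ * f x) ≤ sum (λ x → ⟨ B x ⟩ * g x) →
               ∃[ x ] B x ≡ true × f x ≤ g x
  pigeonhole B f g {v} Bv le with any? (λ x → (B x ≟ᵇ true) ×-dec (f x ≤? g x))
  ... | yes found = found
  ... | no none   = contradiction strict (<⇒≱ (≤-refl {suc (sum λ x → ⟨ B x ⟩ * g x)}))
    where
    pointwise : ∀ x → ⟨ x == v ⟩ + ⟨ B x ⟩ * g x ≤ ⟨ B x ⟩ * f x
    pointwise x with B x in Bx | x ≟ v
    ... | true  | yes _   = +-monoˡ-≤ 0 (≰⇒> λ fx≤gx → none (x , Bx , fx≤gx))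
    ... | true  | no _    = +-monoˡ-≤ 0 (<⇒≤ (≰⇒> λ fx≤gx → none (x , Bx , fx≤gx)))
    ... | false | yes refl = contradiction (trans (sym Bv) Bx) λ ()
    ... | false | no _    = z≤n
    strict : suc (sum λ x → ⟨ B x ⟩ * g x) ≤ sum λ x → ⟨ B x ⟩ * g x
    strict = begin
      1 + sum (λ x → ⟨ B x ⟩ * g x)            ≡⟨ cong (_+ _) (#-singleton v) ⟨
      # (_== v) + sum (λ x → ⟨ B x ⟩ * g x)    ≡⟨ sum-+ (⟨_⟩ ∘ (_== v)) _ ⟨
      sum (λ x → ⟨ x == v ⟩ + ⟨ B x ⟩ * g x)   ≤⟨ sum-mono-≤ pointwise ⟩
      sum (λ x → ⟨ B x ⟩ * f x)                ≤⟨ le ⟩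
      sum (λ x → ⟨ B x ⟩ * g x)                ∎
      where open ≤-Reasoning

  argmax : ∀ {n} (B : Fin n → Bool) (f : Fin n → ℕ) → 1 ≤ # B →
           ∃[ x ] B x ≡ true × (∀ w → B w ≡ true → f w ≤ f x)
  argmax {zero} B f 1≤ = contradiction (subst (1 ≤_) (sum-zero {f = ⟨_⟩ ∘ B} λ ()) 1≤) λ ()
  argmax {suc n} B f 1≤ with 1 ≤? # (B ∘ suc) | B zero in B₀
  ... | no none | false = contradiction (subst (1 ≤_) (trans (sum-suc _) (cong (λ b → ⟨ b ⟩ + # (B ∘ suc)) B₀)) 1≤) none
  ... | no none | true  = zero , B₀ , λ
    { zero _ → ≤-refl ; (suc w) Bw → contradiction (true⇒1≤# (B ∘ suc) Bw) none }
  ... | yes some | b with argmax (B ∘ suc) (f ∘ suc) some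
  ...   | x , Bx , max with b | f zero ≤? f (suc x)
  ...     | false | _ = suc x , Bx , λ
    { zero B₀′ → contradiction (trans (sym B₀′) B₀) λ () ; (suc w) → max w }
  ...     | true | yes f₀≤ = suc x , Bx , λ { zero _ → f₀≤ ; (suc w) → max w }
  ...     | true | no f₀≰  = zero , B₀ , λ
    { zero _ → ≤-refl ; (suc w) Bw → ≤-trans (max w Bw) (<⇒≤ (≰⇒> f₀≰)) }

  -- Transitivity is stated as equality of rows, so that a count over a cluster can be rewritten
  -- from one member to another.
  record IsEquiv {n} (s : Fin n → Fin n → Bool) : Set where
    field
      reflexive : ∀ u → s u u ≡ true
      symmetric : ∀ u w → s u w ≡ s w u
      class     : ∀ {u v} → s u v ≡ true → ∀ w → s u w ≡ s v w

  opaque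
    extract : ∀ {n} → (Fin n → Bool) → (Fin n → Fin n → Bool) → Fin n → Fin n → Bool
    extract B s x w = (B x ∧ B w) ∨ (not (B x) ∧ not (B w) ∧ s x w)

    extract-cong : ∀ {n} {B B′ : Fin n → Bool} (s : Fin n → Fin n → Bool) →
                   (∀ x → B x ≡ B′ x) → ∀ x w → extract B s x w ≡ extract B′ s x w
    extract-cong s B≗B′ x w = cong₂ (λ b c → (b ∧ c) ∨ (not b ∧ not c ∧ s x w)) (B≗B′ x) (B≗B′ w)

    extract-inside : ∀ {n} {B : Fin n → Bool} {s : Fin n → Fin n → Bool} {x w} →
                     B x ≡ true → extract B s x w ≡ B w
    extract-inside {B = B} {w = w} Bx rewrite Bx with B w
    ... | true  = refl
    ... | false = refl

    extract-across : ∀ {n} {B : Fin n → Bool} {s : Fin n → Fin n → Bool} {x w} →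
                     B x ≡ false → B w ≡ true → extract B s x w ≡ false
    extract-across Bx Bw rewrite Bx | Bw = refl

    extract-outside : ∀ {n} {B : Fin n → Bool} {s : Fin n → Fin n → Bool} {x w} →
                      B x ≡ false → B w ≡ false → extract B s x w ≡ s x w
    extract-outside Bx Bw rewrite Bx | Bw = refl

    extract-isEquiv : ∀ {n} (B : Fin n → Bool) {s : Fin n → Fin n → Bool} →
                      IsEquiv s → IsEquiv (extract B s)
    extract-isEquiv B {s} eq = record { reflexive = re ; symmetric = sy ; class = cl }
      where
      open IsEquiv eq
      re : ∀ u → extract B s u u ≡ true
      re u with B u
      ... | true  = refl
      ... | false = reflexive u
      sy : ∀ u w → extract B s u w ≡ extract B s w u
      sy u w rewrite symmetric u w with B u | B w
      ... | true  | true  = refl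
      ... | true  | false = refl
      ... | false | true  = refl
      ... | false | false = refl
      cl : ∀ {u v} → extract B s u v ≡ true → ∀ w → extract B s u w ≡ extract B s v w
      cl {u} {v} uv w with B u | B v
      ... | true  | true  = refl
      ... | false | false rewrite class uv w = refl
      ... | true  | false = contradiction uv λ ()
      ... | false | true  = contradiction uv λ ()

-- Weighted local search and the isolation of single vertices.

module LocalSearch where
  open Sums
  open Counting
  open import Data.Bool.Base using (Bool; true; false; not; _∧_; _xor_)
  open import Data.Fin.Base using (Fin; suc)
  open import Data.Fin.Properties using (_≟_)
  open import Data.Fin.Subset using (Subset)
  open import Data.Fin.Subset.Properties using (anySubset?)
  open import Data.Nat.Base using (ℕ; suc; _+_; _*_; _≤_; _<_; z≤n)
  open import Data.Nat.Induction using (<-wellFounded)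
  open import Data.Nat.Properties renaming (_≟_ to _≟ℕ_)
  open import Data.Nat.Tactic.RingSolver using (solve-∀)
  open import Data.Product.Base using (Σ-syntax; _×_; _,_)
  open import Data.Vec.Base using (lookup; tabulate)
  open import Data.Vec.Properties using (lookup∘tabulate)
  open import Induction.WellFounded using (Acc; acc)
  open import Relation.Binary.PropositionalEquality
  open import Relation.Nullary.Decidable using (Dec; yes; no; from-yes)

  module Weighted {n} (a : Fin n → Fin n → Bool) (a-refl : ∀ u → a u u ≡ true)
                  (a-sym : ∀ u w → a u w ≡ a w u) (m : ℕ) where

    large : (Fin n → Fin n → Bool) → Fin n → Bool
    large s x = le 2 (# (s x))

    F : (Fin n → Fin n → Bool) → Fin n → Fin n → ℕ
    F s x w = ⟨ a x w ∧ not (s x w) ⟩ * (m + ⟨ large s x ⟩)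
            + ⟨ not (a x w) ∧ s x w ⟩ * suc m

    -- Up to the factor 2 for ordered pairs, disagreements cost between m and m + 1. Outgoing edges of
    -- non-singleton clusters and non-edges inside clusters are dear, so local optimality turns into
    -- strict bounds on the degrees inside a cluster.
    weight : (Fin n → Fin n → Bool) → ℕ
    weight s = ∑∑ (F s)

    F-lower : ∀ s x w → m * ⟨ a x w xor s x w ⟩ ≤ F s x w
    F-lower s x w with a x w | s x w
    ... | true  | true  = ≤-reflexive (*-zeroʳ m)
    ... | true  | false = lin ⟨ large s x ⟩ z≤n (lemma m ⟨ large s x ⟩)
      where
      lemma : ∀ m l → m + l + 0 + 0 + 0 ≡ m * 1 + 0 + l
      lemma = solve-∀
    ... | false | true  = lin 1 z≤n (lemma m)
      where
      lemma : ∀ m → 1 + m + 0 + 0 ≡ m * 1 + 0 + 1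
      lemma = solve-∀
    ... | false | false = ≤-reflexive (*-zeroʳ m)

    F-upper : ∀ s x w → F s x w ≤ suc m * ⟨ a x w xor s x w ⟩
    F-upper s x w with a x w | s x w
    ... | true  | true  = z≤n
    ... | true  | false = lin 0 (⟨b⟩≤1 (large s x)) (lemma m ⟨ large s x ⟩)
      where
      lemma : ∀ m l → (1 + m) * 1 + l ≡ m + l + 0 + 0 + 1 + 0
      lemma = solve-∀
    ... | false | true  = ≤-reflexive (lemma m)
      where
      lemma : ∀ m → 1 + m + 0 ≡ (1 + m) * 1
      lemma = solve-∀
    ... | false | false = z≤n

    F-mono : ∀ s s′ {x w} → s′ x w ≡ s x w → ⟨ large s′ x ⟩ ≤ ⟨ large s x ⟩ → F s′ x w ≤ F s x w
    F-mono s s′ {x} {w} eq l rewrite eq =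
      +-monoˡ-≤ _ (*-monoʳ-≤ ⟨ a x w ∧ not (s x w) ⟩ (+-monoʳ-≤ m l))

    F-agree : ∀ s {x w} → a x w ≡ true → s x w ≡ true → F s x w ≡ 0
    F-agree s p q rewrite p | q = refl

    F-cong : ∀ {s s′} → (∀ x w → s x w ≡ s′ x w) → ∀ x w → F s x w ≡ F s′ x w
    F-cong eq x w rewrite eq x w | #-cong (eq x) = refl

    -- Outside `B` clusters only shrink, so no price rises there.
    large-extract : ∀ B s {x} → B x ≡ false → ⟨ large (extract B s) x ⟩ ≤ ⟨ large s x ⟩
    large-extract B s {x} Bx = ⟨le⟩-mono {2} (#-mono pointwise)
      where
      pointwise : ∀ w → ⟨ extract B s x w ⟩ ≤ ⟨ s x w ⟩
      pointwise w with B w in Bw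
      ... | true  rewrite extract-across {B = B} {s} Bx Bw = z≤n
      ... | false = ≤-reflexive (cong ⟨_⟩ (extract-outside {s = s} Bx Bw))

    LocallyOptimal : (Fin n → Fin n → Bool) → Set
    LocallyOptimal s = ∀ B → weight s ≤ weight (extract B s)

    -- Each improvement lowers a natural number, so the search ends; since all subsets are tried, it
    -- ends at a clustering optimal against every `B`.
    search : ∀ s → IsEquiv s →
             Σ[ s′ ∈ (Fin n → Fin n → Bool) ] IsEquiv s′ × LocallyOptimal s′ × weight s′ ≤ weight s
    search s eq = go s eq (<-wellFounded (weight s))
      where
      go : ∀ s → IsEquiv s → Acc _<_ (weight s) →
           Σ[ s′ ∈ (Fin n → Fin n → Bool) ] IsEquiv s′ × LocallyOptimal s′ × weight s′ ≤ weight s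
      go s eq (acc rec) with anySubset? (λ (B : Subset n) → weight (extract (lookup B) s) <? weight s)
      ... | yes (B , better) with go (extract (lookup B) s) (extract-isEquiv (lookup B) eq) (rec better)
      ...   | s′ , eq′ , opt , le = s′ , eq′ , opt , ≤-trans le (<⇒≤ better)
      go s eq (acc rec) | no none = s , eq , opt , ≤-refl
        where
        opt : LocallyOptimal s
        opt B = begin
          -- A predicate agrees with the subset tabulating it only pointwise, hence the detour
          -- through `F-cong`.
          weight s                                  ≤⟨ ≮⇒≥ (λ lt → none (tabulate B , lt)) ⟩
          weight (extract (lookup (tabulate B)) s)  ≡⟨ ∑∑-cong (F-cong (extract-cong s (lookup∘tabulate B))) ⟩
          weight (extract B s)                      ∎
          where open ≤-Reasoning

    mismatch : (Fin n → Fin n → Bool) → Fin n → ℕ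
    mismatch s x = Δ (a x) (s x)

    weight-lower : ∀ s → m * sum (mismatch s) ≤ weight s
    weight-lower s = subst (_≤ weight s) (∑∑-* m _) (∑∑-mono-≤ (F-lower s))

    weight-upper : ∀ s → weight s ≤ suc m * sum (mismatch s)
    weight-upper s = subst (weight s ≤_) (∑∑-* (suc m) _) (∑∑-mono-≤ (F-upper s))

    degree : Fin n → ℕ
    degree v = # (a v)

    1≤degree : ∀ v → 1 ≤ degree v
    1≤degree v = true⇒1≤# (a v) (a-refl v)

    common : Fin n → Fin n → ℕ
    common u v = # λ w → a u w ∧ a v w

    module Local {s} (s-equiv : IsEquiv s) (s-opt : LocallyOptimal s) where
      open IsEquiv s-equiv

      s-sep : ∀ {u v w} → s u v ≡ false → s u w ≡ true → s v w ≡ false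
      s-sep {u} {v} {w} uv uw = trans (symmetric v w) (trans (sym (class uw v)) uv)

      -- For moves of a single vertex: only its row and column can become dearer. The corner costs
      -- nothing, as `v` is in its own neighbourhood and cluster.
      row-column : ∀ B v → B v ≡ true →
        (∀ {x w} → x ≢ v → w ≢ v → F (extract B s) x w ≤ F s x w) →
        sum (F s v) + sum (λ x → F s x v) ≤
        sum (F (extract B s) v) + sum (λ x → F (extract B s) x v)
      row-column B v Bv off = cross-≤ v (F-agree s (a-refl v) (reflexive v))
        (F-agree (extract B s) (a-refl v) (IsEquiv.reflexive (extract-isEquiv B s-equiv) v)) off (s-opt B)

      -- Compares `s` with the clustering in which `v` is isolated. The companion `u` certifies that
      -- `v` is not yet a singleton, so its cut edges cost `m + 1` before and `m` after.
      module Companion {u v} (uv : s v u ≡ true) (u≢v : u ≢ v) where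
        out in′ miss : ℕ
        out  = # λ w → a v w ∧ not (s v w)
        miss = # λ w → not (a v w) ∧ s v w
        in′  = # λ w → a v w ∧ s v w ∧ not (w == v)

        inside : ℕ
        inside = # λ w → a v w ∧ s v w

        private
          s′ : Fin n → Fin n → Bool
          s′ = extract (_== v) s

          large-v : large s v ≡ true
          large-v = ≤⇒le (two-true⇒2≤# (s v) uv (reflexive v) u≢v)

          s′v : ∀ w → s′ v w ≡ (w == v)
          s′v w = extract-inside {s = s} (==-refl v)

          small-v : large s′ v ≡ false
          small-v = >⇒not-le (≤-reflexive (cong suc (trans (#-cong s′v) (#-singleton v))))

          off : ∀ {x w} → x ≢ v → w ≢ v → F s′ x w ≤ F s x w
          off {x} {w} x≢v w≢v = F-mono s s′ same (large-extract (_== v) s (==-≢ x≢v))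
            where
            same : s′ x w ≡ s x w
            same = extract-outside {s = s} (==-≢ x≢v) (==-≢ w≢v)

          old-row : sum (F s v) ≡ suc m * out + suc m * miss
          old-row = trans (sum-cong pointwise)
            (trans (sum-+ _ _) (cong₂ _+_ (sum-* (suc m) _) (sum-* (suc m) _)))
            where
            pointwise : ∀ w → F s v w ≡ suc m * ⟨ a v w ∧ not (s v w) ⟩ + suc m * ⟨ not (a v w) ∧ s v w ⟩
            pointwise w rewrite large-v = lemma m ⟨ a v w ∧ not (s v w) ⟩ ⟨ not (a v w) ∧ s v w ⟩
              where
              lemma : ∀ m p q → p * (m + 1) + q * (1 + m) ≡ (1 + m) * p + (1 + m) * q
              lemma = solve-∀

          new-row : sum (F s′ v) ≤ m * out + m * in′
          new-row = subst (sum (F s′ v) ≤_) (cong₂ _+_ (sum-* m _) (sum-* m _)) (sum-≤-+ pointwise)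
            where
            pointwise : ∀ w → F s′ v w ≤ m * ⟨ a v w ∧ not (s v w) ⟩ + m * ⟨ a v w ∧ s v w ∧ not (w == v) ⟩
            pointwise w rewrite s′v w | small-v with w ≟ v
            pointwise w | yes refl rewrite a-refl v = z≤n
            pointwise w | no _ with a v w | s v w
            ... | true  | true  = ≤-reflexive (lemma m)
              where
              lemma : ∀ m → m + 0 + 0 + 0 ≡ m * 0 + m * 1
              lemma = solve-∀
            ... | true  | false = ≤-reflexive (lemma m)
              where
              lemma : ∀ m → m + 0 + 0 + 0 ≡ m * 1 + m * 0
              lemma = solve-∀
            ... | false | true  = z≤n
            ... | false | false = z≤n

          columns : sum (λ x → F s′ x v) + suc m * miss ≤ sum (λ x → F s x v) + suc m * in′
          columns = subst₂ _≤_ (cong (sum (λ x → F s′ x v) +_) (sum-* (suc m) _))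
                               (cong (sum (λ x → F s x v) +_) (sum-* (suc m) _))
                      (sum-+-≤-+ {e = λ x → F s′ x v} {g = λ x → F s x v} λ x → pointwise x (x ≟ v))
            where
            pointwise : ∀ x → Dec (x ≡ v) → F s′ x v + suc m * ⟨ not (a v x) ∧ s v x ⟩
                            ≤ F s x v + suc m * ⟨ a v x ∧ s v x ∧ not (x == v) ⟩
            pointwise x (yes refl) rewrite s′v v | ==-refl v | a-refl v = ≤-trans (≤-reflexive (*-zeroʳ m)) z≤n
            pointwise x (no x≢v) = begin
              F s′ x v + suc m * ⟨ not (a v x) ∧ s v x ⟩
                ≡⟨ cong (λ b → ⟨ a x v ∧ not b ⟩ * (m + ⟨ large s′ x ⟩) + ⟨ not (a x v) ∧ b ⟩ * suc m
                               + suc m * ⟨ not (a v x) ∧ s v x ⟩) s′xv ⟩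
              ⟨ a x v ∧ true ⟩ * (m + ⟨ large s′ x ⟩) + ⟨ not (a x v) ∧ false ⟩ * suc m
                + suc m * ⟨ not (a v x) ∧ s v x ⟩
                ≤⟨ lemma ⟩
              F s x v + suc m * ⟨ a v x ∧ s v x ∧ true ⟩
                ≡⟨ cong (λ b → F s x v + suc m * ⟨ a v x ∧ s v x ∧ not b ⟩) (==-≢ x≢v) ⟨
              F s x v + suc m * ⟨ a v x ∧ s v x ∧ not (x == v) ⟩ ∎
              where
              open ≤-Reasoning
              s′xv : s′ x v ≡ false
              s′xv = extract-across {s = s} (==-≢ x≢v) (==-refl v)
              l≤l : ⟨ large s′ x ⟩ ≤ ⟨ large s x ⟩
              l≤l = large-extract (_== v) s (==-≢ x≢v)
              lemma : ⟨ a x v ∧ true ⟩ * (m + ⟨ large s′ x ⟩) + ⟨ not (a x v) ∧ false ⟩ * suc m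
                      + suc m * ⟨ not (a v x) ∧ s v x ⟩ ≤ F s x v + suc m * ⟨ a v x ∧ s v x ∧ true ⟩
              lemma rewrite a-sym v x | symmetric v x with a x v | s x v
              ... | true  | true  = lin 0 (⟨b⟩≤1 (large s′ x)) (l₁ m ⟨ large s′ x ⟩)
                where
                l₁ : ∀ m l → (1 + m) * 1 + l ≡ m + l + 0 + 0 + (1 + m) * 0 + 1 + 0
                l₁ = solve-∀
              ... | true  | false = lin 0 l≤l (l₁ m ⟨ large s x ⟩ ⟨ large s′ x ⟩)
                where
                l₁ : ∀ m l l′ → m + l + 0 + 0 + (1 + m) * 0 + l′ ≡ m + l′ + 0 + 0 + (1 + m) * 0 + l + 0
                l₁ = solve-∀
              ... | false | true  = ≤-reflexive (l₁ m)
                where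
                l₁ : ∀ m → (1 + m) * 1 ≡ 1 + m + 0 + (1 + m) * 0
                l₁ = solve-∀
              ... | false | false = ≤-refl

          inside≡ : inside ≡ suc in′
          inside≡ = trans (sum-cong pointwise)
            (trans (sum-+ _ _) (cong (_+ in′) (#-singleton v)))
            where
            pointwise : ∀ w → ⟨ a v w ∧ s v w ⟩ ≡ ⟨ w == v ⟩ + ⟨ a v w ∧ s v w ∧ not (w == v) ⟩
            pointwise w with w ≟ v
            ... | yes refl rewrite a-refl v | reflexive v = refl
            ... | no _ with a v w | s v w
            ...   | true  | true  = refl
            ...   | true  | false = refl
            ...   | false | _     = refl

        -- Isolating `v` saves 1 on each edge already cut and `2m + 2` on each non-neighbour in the
        -- cluster. It costs at most `2m + 1` for each lost neighbour: `m` in the row, where `v` is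
        -- now a singleton, and `m + 1` in the column. The summand `2m + 1` on the left accounts for
        -- `v` itself, which `inside` counts.
        gain≤loss : out + (2 * m + 2) * miss + (2 * m + 1) ≤ (2 * m + 1) * inside
        gain≤loss rewrite inside≡ =
          lin 0 (+-mono-≤ columns (≤-trans (row-column (_== v) v (==-refl v) off)
                  (+-monoˡ-≤ (sum λ x → F s′ x v) new-row)))
            (trans (cong (λ r → (2 * m + 1) * suc in′ + (sum (λ x → F s′ x v) + suc m * miss + (r + sum (λ x → F s x v)))) old-row)
                   (lemma m out miss in′ (sum λ x → F s x v) (sum λ x → F s′ x v)))
          where
          lemma : ∀ m o q p c c′ →
            (2 * m + 1) * (1 + p) + (c′ + (1 + m) * q + ((1 + m) * o + (1 + m) * q + c)) ≡
            o + (2 * m + 2) * q + (2 * m + 1) + (c + (1 + m) * p + (m * o + m * p + c′)) + 0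
          lemma = solve-∀

        degree≡ : degree v ≡ out + inside
        degree≡ = trans (sum-cong λ w → lemma (a v w) (s v w)) (sum-+ _ _)
          where
          lemma = from-yes (all-bool? λ x → all-bool? λ y → ⟨ x ⟩ ≟ℕ ⟨ x ∧ not y ⟩ + ⟨ x ∧ y ⟩)

        cluster≡ : # (s v) ≡ inside + miss
        cluster≡ = trans (sum-cong λ w → lemma (a v w) (s v w)) (sum-+ _ _)
          where
          lemma = from-yes (all-bool? λ x → all-bool? λ y → ⟨ y ⟩ ≟ℕ ⟨ x ∧ y ⟩ + ⟨ not x ∧ y ⟩)

        -- Already `out + inside ≤ (2m + 2) * inside`; the factor is relaxed to `4m + 4` so that one
        -- constant also serves for common neighbours.
        degree≤ : degree v ≤ (4 * m + 4) * # (s v)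
        degree≤ rewrite degree≡ | cluster≡ =
          lin ((2 * m + 2) * inside + (6 * m + 6) * miss + (2 * m + 1)) gain≤loss (lemma m out inside miss)
          where
          lemma : ∀ m o p q →
            (4 * m + 4) * (p + q) + (o + (2 * m + 2) * q + (2 * m + 1)) ≡
            o + p + (2 * m + 1) * p + ((2 * m + 2) * p + (6 * m + 6) * q + (2 * m + 1))
          lemma = solve-∀

        -- The closed neighbourhood covers the fraction `(2m + 2) / (4m + 3)` of the cluster, which
        -- exceeds one half by a margin of order 1/m.
        cluster≤ : (2 * m + 2) * # (s v) ≤ (4 * m + 3) * inside
        cluster≤ rewrite cluster≡ = lin (out + (2 * m + 1)) gain≤loss (lemma m out inside miss)
          where
          lemma : ∀ m o p q →
            (4 * m + 3) * p + (o + (2 * m + 2) * q + (2 * m + 1)) ≡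
            (2 * m + 2) * (p + q) + (2 * m + 1) * p + (o + (2 * m + 1))
          lemma = solve-∀

-- The tests for atoms and links, and their agreement with local optima.

module Atoms where
  open LocalSearch
  open Sums
  open Counting
  open import Data.Bool.Base using (Bool; true; false; not; _∧_; _∨_; _xor_)
  open import Data.Fin.Base using (Fin; suc)
  open import Data.Fin.Properties using (_≟_)
  open import Data.Nat.Base using (ℕ; suc; _+_; _*_; _≤_; _<_; z≤n; s≤s; s≤s⁻¹; NonZero; >-nonZero⁻¹)
  open import Data.Nat.Properties renaming (_≟_ to _≟ℕ_)
  open import Data.Nat.Tactic.RingSolver using (solve-∀)
  open import Data.Product.Base using (∃-syntax; _×_; _,_)
  open import Data.Bool.Properties using (xor-same) renaming (_≟_ to _≟ᵇ_)
  open import Function.Base using (_∘_)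
  open import Relation.Binary.PropositionalEquality
  open import Relation.Nullary.Decidable using (Dec; yes; no; from-yes)
  open import Relation.Nullary.Negation using (contradiction)

  ∧-weaken : ∀ p q {r} → (p ∧ q ≡ true → r ≡ true) → ⟨ p ∧ q ⟩ ≤ ⟨ p ∧ r ⟩
  ∧-weaken false q     h = z≤n
  ∧-weaken true  false h = z≤n
  ∧-weaken true  true  h rewrite h refl = ≤-refl

  ∧-true₂ : ∀ b {c} → b ∧ c ≡ true → c ≡ true
  ∧-true₂ true eq = eq

  -- a u is the closed neighbourhood of u. With the constant 36, the neighbourhood of a clean vertex
  -- turns out to differ from its cluster in at most 9/36 of its degree.
  module Scheme {n} (a : Fin n → Fin n → Bool) (K : ℕ) where

    deg : Fin n → ℕ
    deg v = # (a v)

    agree : Fin n → Fin n → Bool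
    agree v u = le (36 * Δ (a v) (a u)) (deg v)

    clean : Fin n → Bool
    clean v = le (36 * # (λ u → a v u ∧ not (agree v u))) (deg v)

    -- A quarter of the degree sum is the exact divide: overlaps of clean vertices in one cluster
    -- exceed it, those across clusters do not.
    near : Fin n → Fin n → Bool
    near u v = not (le (4 * # (λ w → a u w ∧ a v w)) (deg u + deg v))

    atom : Fin n → Fin n → Bool
    atom u v = (u == v) ∨ (clean u ∧ clean v ∧ near u v)

    -- An integer test that implies walk weight at least `1 / K`: some threshold `deg x` has at
    -- least `deg x / K` common neighbours of degree at most `deg x`, each contributing at least
    -- `1 / deg x`.
    linked : Fin n → Fin n → Bool
    linked u v = le 1 (# λ x → le (deg x) (K * # (λ w → (a u w ∧ a v w) ∧ le (deg w) (deg x))))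

    adm : Fin n → Fin n → Bool
    adm u v = not (u == v) ∧ not (clean u ∧ clean v) ∧ linked u v

  opaque
    -- Bounds both cluster size over common neighbours and degree over cluster size. The two are
    -- chained in `together⇒linked`, so links use its square.
    spread : ℕ → ℕ
    spread m = 4 * m + 4

    spread≡ : ∀ m → spread m ≡ 4 * m + 4
    spread≡ m = refl

  module Analysis {n} (a : Fin n → Fin n → Bool) (a-refl : ∀ u → a u u ≡ true)
                  (a-sym : ∀ u w → a u w ≡ a w u) (m : ℕ) .{{_ : NonZero m}} where
    k : ℕ
    k = spread m

    k≡ : k ≡ 4 * m + 4
    k≡ = spread≡ m

    open Scheme a (k * k)
    open Weighted a a-refl a-sym m

    module Structure {s} (s-equiv : IsEquiv s) (s-opt : LocallyOptimal s) where
      open IsEquiv s-equiv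
      open Local s-equiv s-opt

      core : Fin n → Fin n → Fin n → Bool
      core u v w = (a u w ∧ a v w) ∧ s v w

      -- Inclusion-exclusion inside the cluster: two parts of fraction `(2m + 2) / (4m + 3)` overlap
      -- in at least `1 / (4m + 3)` of it.
      cluster≤k*core : ∀ {u v} → s v u ≡ true → u ≢ v → # (s v) ≤ k * # (core u v)
      cluster≤k*core {u} {v} vu u≢v =
        subst (λ k → C ≤ k * z) (sym k≡) (lin z (+-mono-≤ (+-mono-≤ p-bound q-bound) (*-monoʳ-≤ (4 * m + 3) p+q≤C+z)) (lemma m C p q z))
        where
        C p q z : ℕ
        C = # (s v)
        p = Companion.inside {v} {u} (trans (symmetric u v) vu) (u≢v ∘ sym)
        q = Companion.inside {u} {v} vu u≢v
        z = # (core u v)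
        p-bound : (2 * m + 2) * C ≤ (4 * m + 3) * p
        p-bound = subst (λ c → (2 * m + 2) * c ≤ (4 * m + 3) * p) (sym (#-cong (class vu)))
          (Companion.cluster≤ {v} {u} (trans (symmetric u v) vu) (u≢v ∘ sym))
        q-bound : (2 * m + 2) * C ≤ (4 * m + 3) * q
        q-bound = Companion.cluster≤ {u} {v} vu u≢v
        p+q≤C+z : p + q ≤ C + z
        p+q≤C+z = sum-+-≤-+ λ w →
          subst (λ b → ⟨ a u w ∧ b ⟩ + ⟨ a v w ∧ s v w ⟩ ≤ ⟨ s v w ⟩ + ⟨ core u v w ⟩)
                (class vu w) (lemma (a u w) (a v w) (s v w))
          where
          lemma = from-yes (all-bool? λ x → all-bool? λ y → all-bool? λ c →
            ⟨ x ∧ c ⟩ + ⟨ y ∧ c ⟩ ≤? ⟨ c ⟩ + ⟨ (x ∧ y) ∧ c ⟩)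
        lemma : ∀ m c p q z →
          (4 * m + 4) * z + ((2 * m + 2) * c + (2 * m + 2) * c + (4 * m + 3) * (p + q)) ≡
          c + ((4 * m + 3) * p + (4 * m + 3) * q + (4 * m + 3) * (c + z)) + z
        lemma = solve-∀

      -- Every member `x` has a companion in the cluster: `u` if `x` is `v`, and `v` otherwise.
      degree≤cluster : ∀ {u v x} → s v u ≡ true → u ≢ v → s v x ≡ true → deg x ≤ k * # (s v)
      degree≤cluster {u} {v} {x} vu u≢v vx = go (x ≟ v)
        where
        go : Dec (x ≡ v) → deg x ≤ k * # (s v)
        go (yes refl) = subst (λ k → deg v ≤ k * # (s v)) (sym k≡) (Companion.degree≤ {u} {v} vu u≢v)
        go (no x≢v)   = subst₂ (λ k c → deg x ≤ k * c) (sym k≡) (sym (#-cong (class vx)))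
                          (Companion.degree≤ {v} {x} (trans (symmetric x v) vx) (x≢v ∘ sym))

      -- The threshold is the largest degree in the core. The whole core then lies below it, and the
      -- core is large compared with that degree.
      together⇒linked : ∀ {u v} → s v u ≡ true → u ≢ v → linked u v ≡ true
      together⇒linked {u} {v} vu u≢v = go (argmax (core u v) deg 1≤core)
        where
        1≤core : 1 ≤ # (core u v)
        1≤core = n≢0⇒n>0 λ z≡0 → contradiction
          (≤-trans (true⇒1≤# (s v) vu) (subst (λ z → # (s v) ≤ k * z) z≡0 (cluster≤k*core vu u≢v)))
          (<⇒≱ (s≤s (≤-reflexive (*-zeroʳ k))))
        go : ∃[ x ] core u v x ≡ true × (∀ w → core u v w ≡ true → deg w ≤ deg x) → linked u v ≡ true
        go (x , ux , max) = ≤⇒le (true⇒1≤# (λ x → le (deg x) (k * k * below x)) {x} (≤⇒le deg-x≤))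
          where
          below : Fin n → ℕ
          below x = # λ w → (a u w ∧ a v w) ∧ le (deg w) (deg x)
          deg-x≤ : deg x ≤ k * k * below x
          deg-x≤ = begin
            deg x                    ≤⟨ degree≤cluster vu u≢v (∧-true₂ (a u x ∧ a v x) ux) ⟩
            k * # (s v)              ≤⟨ *-monoʳ-≤ k (cluster≤k*core vu u≢v) ⟩
            k * (k * # (core u v))   ≡⟨ *-assoc k k (# (core u v)) ⟨
            k * k * # (core u v)     ≤⟨ *-monoʳ-≤ (k * k) (#-mono λ w →
              ∧-weaken (a u w ∧ a v w) (s v w) λ eq → ≤⇒le (max w eq)) ⟩
            k * k * below x          ∎
            where open ≤-Reasoning

      -- A vertex v whose neighbourhood is close to the cluster of u lies in that cluster:
      -- otherwise moving it there would improve the clustering.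
      module Apart {u v} (4X≤deg : 4 * Δ (a v) (s u) ≤ deg v) (uv : s u v ≡ false) where
        X : ℕ
        X = Δ (a v) (s u)

        Y : ℕ
        Y = # λ w → a v w ∧ s u w

        1≤X : 1 ≤ X
        1≤X = true⇒1≤# _ {v} (cong₂ _xor_ (a-refl v) uv)

        -- If the cluster of `u` were a singleton, adding `v` would raise the price of its cut
        -- edges. But then `4X ≤ deg v ≤ 1 + X`, which contradicts `1≤X`.
        large-u : 2 ≤ # (s u)
        large-u = ≮⇒≥ λ small → <⇒≱ 1≤X (X≤0 small)
          where
          X≤0 : # (s u) < 2 → X ≤ 0
          X≤0 small = *-cancelˡ-≤ 2 (lin 0
            (+-mono-≤ (+-mono-≤ 4X≤deg (#≤#+Δ (a v) (s u))) (+-mono-≤ (s≤s⁻¹ small) 1≤X))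
            (l X (deg v) (# (s u))))
            where
            l : ∀ x d c → 2 * 0 + (4 * x + d + (c + 1)) ≡ 2 * x + (d + (c + x) + (1 + x)) + 0
            l = solve-∀

        B′ : Fin n → Bool
        B′ w = s u w ∨ (w == v)

        s″ : Fin n → Fin n → Bool
        s″ = extract B′ s

        B′v : B′ v ≡ true
        B′v rewrite uv | ==-refl v = refl

        B′≢ : ∀ {w} → w ≢ v → B′ w ≡ s u w
        B′≢ {w} w≢v rewrite ==-≢ w≢v with s u w
        ... | true  = refl
        ... | false = refl

        off′ : ∀ {x w} → x ≢ v → w ≢ v → F s″ x w ≤ F s x w
        off′ {x} {w} x≢v w≢v with s u x in ux
        ... | true  = F-mono s s″ same (subst (λ b → ⟨ large s″ x ⟩ ≤ ⟨ b ⟩) (sym large-x) (⟨b⟩≤1 (large s″ x)))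
          where
          large-x : large s x ≡ true
          large-x = ≤⇒le (subst (2 ≤_) (#-cong (class ux)) large-u)
          same : s″ x w ≡ s x w
          same = trans (extract-inside {s = s} (trans (B′≢ x≢v) ux)) (trans (B′≢ w≢v) (class ux w))
        ... | false = F-mono s s″ same (large-extract B′ s (trans (B′≢ x≢v) ux))
          where
          same : s″ x w ≡ s x w
          same with s u w in uw
          ... | true  = trans (extract-across {s = s} (trans (B′≢ x≢v) ux) (trans (B′≢ w≢v) uw)) (sym (s-sep ux uw))
          ... | false = extract-outside {s = s} (trans (B′≢ x≢v) ux) (trans (B′≢ w≢v) uw)

        old-cell : ∀ w → m * ⟨ a v w ∧ s u w ⟩ ≤ F s v w
        old-cell w = ≤-trans (*-monoʳ-≤ m cell) (F-lower s v w)
          where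
          cell : ⟨ a v w ∧ s u w ⟩ ≤ ⟨ a v w xor s v w ⟩
          cell with s u w in uw
          ... | true rewrite s-sep uv uw with a v w
          ...   | true  = ≤-refl
          ...   | false = ≤-refl
          cell | false with a v w
          ...   | true  = z≤n
          ...   | false = z≤n

        swap-cell : ∀ x → m * ⟨ a v x ∧ s u x ⟩ ≤ F s x v
        swap-cell x = ≤-trans (*-monoʳ-≤ m cell) (F-lower s x v)
          where
          cell : ⟨ a v x ∧ s u x ⟩ ≤ ⟨ a x v xor s x v ⟩
          cell rewrite a-sym v x | symmetric x v with s u x in ux
          ... | true rewrite s-sep uv ux with a x v
          ...   | true  = ≤-refl
          ...   | false = ≤-refl
          cell | false with a x v
          ...   | true  = z≤n
          ...   | false = z≤n

        s″v : ∀ {w} → w ≢ v → s″ v w ≡ s u w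
        s″v {w} w≢v = trans (extract-inside {s = s} B′v) (B′≢ w≢v)

        s″-equiv : IsEquiv s″
        s″-equiv = extract-isEquiv B′ s-equiv

        new-cell : ∀ w → Dec (w ≡ v) → F s″ v w ≤ suc m * ⟨ a v w xor s u w ⟩
        new-cell w (yes refl) =
          ≤-trans (≤-reflexive (F-agree s″ (a-refl v) (IsEquiv.reflexive s″-equiv v))) z≤n
        new-cell w (no w≢v) = ≤-trans (F-upper s″ v w)
          (≤-reflexive (cong (λ b → suc m * ⟨ a v w xor b ⟩) (s″v w≢v)))

        new-cell′ : ∀ x → Dec (x ≡ v) → F s″ x v ≤ suc m * ⟨ a v x xor s u x ⟩
        new-cell′ x (yes refl) =
          ≤-trans (≤-reflexive (F-agree s″ (a-refl v) (IsEquiv.reflexive s″-equiv v))) z≤n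
        new-cell′ x (no x≢v) = ≤-trans (F-upper s″ x v)
          (≤-reflexive (cong₂ (λ b c → suc m * ⟨ b xor c ⟩) (a-sym x v)
            (trans (IsEquiv.symmetric s″-equiv x v) (s″v x≢v))))

        -- Before the move only the cut edges from `v` into the cluster of `u` are counted, at the
        -- low price; after it all mismatches of `v` are charged at the high price. Row and column
        -- contribute alike.
        exchange : m * Y + m * Y ≤ suc m * X + suc m * X
        exchange = begin
          m * Y + m * Y ≡⟨ cong₂ _+_ (sum-* m _) (sum-* m _) ⟨
          _             ≤⟨ +-mono-≤ (sum-mono-≤ old-cell) (sum-mono-≤ swap-cell) ⟩
          sum (F s v) + sum (λ x → F s x v) ≤⟨ row-column B′ v B′v off′ ⟩
          sum (F s″ v) + sum (λ x → F s″ x v)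
            ≤⟨ +-mono-≤ (sum-mono-≤ λ w → new-cell w (w ≟ v)) (sum-mono-≤ λ x → new-cell′ x (x ≟ v)) ⟩
          _             ≡⟨ cong₂ _+_ (sum-* (suc m) _) (sum-* (suc m) _) ⟩
          suc m * X + suc m * X ∎
          where open ≤-Reasoning

        Y≤2X : Y ≤ 2 * X
        Y≤2X = *-cancelˡ-≤ m (*-cancelˡ-≤ 2
          (lin 0 (+-mono-≤ exchange (*-monoˡ-≤ (2 * X) (>-nonZero⁻¹ m))) (l m X Y)))
          where
          l : ∀ m x y → 2 * (m * (2 * x)) + (m * y + m * y + 1 * (2 * x))
            ≡ 2 * (m * y) + ((1 + m) * x + (1 + m) * x + m * (2 * x)) + 0
          l = solve-∀

        -- Now `deg v ≤ Y + X ≤ 3X`, and `3X` is at most three quarters of `deg v`.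
        deg≤0 : deg v ≤ 0
        deg≤0 = lin 0 (+-mono-≤ (*-monoʳ-≤ 3 4X≤deg)
            (*-monoʳ-≤ 4 (+-mono-≤ (#≤∩+Δ (a v) (s u)) Y≤2X))) (l (deg v) X Y)
          where
          l : ∀ d x y → 0 + (3 * (4 * x) + 4 * (d + y)) ≡ d + (3 * d + 4 * (y + x + 2 * x)) + 0
          l = solve-∀

      close⇒together : ∀ {u v} → 4 * Δ (a v) (s u) ≤ deg v → s u v ≡ true
      close⇒together {u} {v} 4X≤deg with s u v in uv
      ... | true  = refl
      ... | false = contradiction (1≤degree v) (<⇒≱ (s≤s (Apart.deg≤0 4X≤deg uv)))

      -- Extracting B = {u ∈ N[v] : u agrees with v} as a cluster costs little, so by local optimality
      -- the vertices of B have few mismatches on average.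
      module Clean {v} (clean-v : clean v ≡ true) where
        opaque
          B : Fin n → Bool
          B u = a v u ∧ agree v u

          Bv : B v ≡ true
          Bv rewrite a-refl v = ≤⇒le {36 * Δ (a v) (a v)}
            (≤-trans (≤-reflexive (cong (36 *_) (sum-zero λ w → cong ⟨_⟩ (xor-same (a v w))))) z≤n)

          B-agree : ∀ {x} → B x ≡ true → 36 * Δ (a v) (a x) ≤ deg v
          B-agree {x} Bx = le⇒≤ (∧-true₂ (a v x) Bx)

          ΔB : 36 * Δ (a v) B ≤ deg v
          ΔB = subst (λ c → 36 * c ≤ deg v) (#-cong λ u → lemma (a v u) (agree v u)) (le⇒≤ clean-v)
            where
            lemma : ∀ x y → x ∧ not y ≡ x xor (x ∧ y)
            lemma = from-yes (all-bool? λ x → all-bool? λ y → x ∧ not y ≟ᵇ x xor (x ∧ y))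

        s′ : Fin n → Fin n → Bool
        s′ = extract B s

        Q : Fin n → Fin n → Bool
        Q x w = B x ∨ B w

        off : ∀ x w → Q x w ≡ false → F s′ x w ≤ F s x w
        off x w Qxw with B x in Bx | B w in Bw
        ... | false | false = F-mono s s′ (extract-outside {s = s} Bx Bw) (large-extract B s Bx)

        old : m * sum (λ x → ⟨ B x ⟩ * mismatch s x) ≤ ∑∑ (λ x w → ⟨ Q x w ⟩ * F s x w)
        old = ≤-trans (≤-reflexive (sym (trans (∑∑-* m _) (cong (m *_) (sum-cong λ x → sum-* ⟨ B x ⟩ _)))))
                      (∑∑-mono-≤ pointwise)
          where
          pointwise : ∀ x w → m * (⟨ B x ⟩ * ⟨ a x w xor s x w ⟩) ≤ ⟨ Q x w ⟩ * F s x w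
          pointwise x w with B x
          ... | false = ≤-trans (≤-reflexive (*-zeroʳ m)) z≤n
          ... | true rewrite *-identityˡ ⟨ a x w xor s x w ⟩ | *-identityˡ (F s x w) = F-lower s x w

        -- After the extraction, rows and columns of `B` mismatch only where `a x` differs from `B`;
        -- the factor 2 pays for both directions.
        new : ∑∑ (λ x w → ⟨ Q x w ⟩ * F s′ x w) ≤ suc m * (2 * sum (λ x → ⟨ B x ⟩ * Δ (a x) B))
        new = ≤-trans (∑∑-mono-≤ pointwise) (≤-reflexive total)
          where
          g : Fin n → Fin n → ℕ
          g x w = ⟨ B x ⟩ * ⟨ a x w xor B w ⟩
          pointwise : ∀ x w → ⟨ Q x w ⟩ * F s′ x w ≤ suc m * (g x w + g w x)
          pointwise x w with B x in Bx | B w in Bw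
          ... | false | false = z≤n
          ... | true | b = begin
            F s′ x w + 0                       ≡⟨ +-identityʳ _ ⟩
            F s′ x w                           ≤⟨ F-upper s′ x w ⟩
            suc m * ⟨ a x w xor s′ x w ⟩        ≡⟨ cong (λ c → suc m * ⟨ a x w xor c ⟩) same ⟩
            suc m * ⟨ a x w xor b ⟩             ≤⟨ *-monoʳ-≤ (suc m) (≤-trans (m≤m+n _ 0) (m≤m+n _ _)) ⟩
            suc m * (⟨ a x w xor b ⟩ + 0 + ⟨ b ⟩ * ⟨ a w x xor true ⟩) ∎
            where
            open ≤-Reasoning
            same : s′ x w ≡ b
            same = trans (extract-inside {s = s} Bx) Bw
          ... | false | true = begin
            F s′ x w + 0                       ≡⟨ +-identityʳ _ ⟩
            F s′ x w                           ≤⟨ F-upper s′ x w ⟩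
            suc m * ⟨ a x w xor s′ x w ⟩        ≡⟨ cong₂ (λ b c → suc m * ⟨ b xor c ⟩) (a-sym x w) same ⟩
            suc m * ⟨ a w x xor false ⟩         ≤⟨ *-monoʳ-≤ (suc m) (m≤m+n _ 0) ⟩
            suc m * (⟨ a w x xor false ⟩ + 0)   ∎
            where
            open ≤-Reasoning
            same : s′ x w ≡ false
            same = extract-across {s = s} Bx Bw
          total : ∑∑ (λ x w → suc m * (g x w + g w x)) ≡ suc m * (2 * sum (λ x → ⟨ B x ⟩ * Δ (a x) B))
          total = trans (∑∑-* (suc m) _) (cong (suc m *_) (trans (∑∑-+ g (λ x w → g w x))
            (trans (cong (∑∑ g +_) (trans (sum-comm (λ x w → g w x)) (sym (+-identityʳ (∑∑ g)))))
                   (cong (2 *_) (sum-cong λ x → sum-* ⟨ B x ⟩ _)))))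

        -- The 8 is `2 * 2 * 2`: rows and columns, `(m + 1) / m ≤ 2`, and
        -- `36 * Δ (a x) B ≤ 2 * deg v` by the triangle inequality through `a v`.
        average : sum (λ x → ⟨ B x ⟩ * (36 * mismatch s x)) ≤ sum (λ x → ⟨ B x ⟩ * (8 * deg v))
        average = *-cancelˡ-≤ m (begin
          m * sum (λ x → ⟨ B x ⟩ * (36 * mismatch s x)) ≡⟨ cong (m *_) (pull mismatch-s) ⟩
          m * (36 * E)                        ≡⟨ lemma₁ m E ⟩
          36 * (m * E)                        ≤⟨ *-monoʳ-≤ 36 (≤-trans old (≤-trans (region-≤ Q off (s-opt B)) new)) ⟩
          36 * (suc m * (2 * D))              ≡⟨ lemma₂ m D ⟩
          (1 + m) * 2 * (36 * D)              ≡⟨ cong ((1 + m) * 2 *_) (pull _) ⟨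
          (1 + m) * 2 * sum (λ x → ⟨ B x ⟩ * (36 * Δ (a x) B)) ≤⟨ *-monoʳ-≤ ((1 + m) * 2) (sum-mono-≤ ΔB-each) ⟩
          (1 + m) * 2 * sum (λ x → ⟨ B x ⟩ * (2 * deg v)) ≤⟨ *-monoˡ-≤ _ 1+m≤2m ⟩
          (m * 4) * sum (λ x → ⟨ B x ⟩ * (2 * deg v)) ≡⟨ *-assoc m 4 _ ⟩
          m * (4 * sum (λ x → ⟨ B x ⟩ * (2 * deg v))) ≡⟨ cong (m *_) (sum-* 4 _) ⟨
          m * sum (λ x → 4 * (⟨ B x ⟩ * (2 * deg v))) ≡⟨ cong (m *_) (sum-cong λ x → lemma₃ ⟨ B x ⟩ (deg v)) ⟩
          m * sum (λ x → ⟨ B x ⟩ * (8 * deg v)) ∎)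
          where
          open ≤-Reasoning
          mismatch-s = mismatch s
          E D : ℕ
          E = sum (λ x → ⟨ B x ⟩ * mismatch s x)
          D = sum (λ x → ⟨ B x ⟩ * Δ (a x) B)
          pull : ∀ (f : Fin n → ℕ) → sum (λ x → ⟨ B x ⟩ * (36 * f x)) ≡ 36 * sum (λ x → ⟨ B x ⟩ * f x)
          pull f = trans (sum-cong λ x → l ⟨ B x ⟩ (f x)) (sum-* 36 _)
            where
            l : ∀ b f → b * (36 * f) ≡ 36 * (b * f)
            l = solve-∀
          lemma₁ : ∀ m e → m * (36 * e) ≡ 36 * (m * e)
          lemma₁ = solve-∀
          lemma₂ : ∀ m e → 36 * ((1 + m) * (2 * e)) ≡ (1 + m) * 2 * (36 * e)
          lemma₂ = solve-∀
          lemma₃ : ∀ b d → 4 * (b * (2 * d)) ≡ b * (8 * d)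
          lemma₃ = solve-∀
          1+m≤2m : (1 + m) * 2 ≤ m * 4
          1+m≤2m = lin 0 (*-monoʳ-≤ 2 (>-nonZero⁻¹ m)) (l m)
            where
            l : ∀ m → m * 4 + 2 * 1 ≡ (1 + m) * 2 + 2 * m + 0
            l = solve-∀
          ΔB-each : ∀ x → ⟨ B x ⟩ * (36 * Δ (a x) B) ≤ ⟨ B x ⟩ * (2 * deg v)
          ΔB-each x with B x in Bx
          ... | false = z≤n
          ... | true  = *-monoʳ-≤ 1 (begin
            36 * Δ (a x) B                        ≤⟨ *-monoʳ-≤ 36 (Δ-triangle (a x) (a v) B) ⟩
            36 * (Δ (a x) (a v) + Δ (a v) B)      ≡⟨ *-distribˡ-+ 36 (Δ (a x) (a v)) _ ⟩
            36 * Δ (a x) (a v) + 36 * Δ (a v) B   ≡⟨ cong (λ c → 36 * c + 36 * Δ (a v) B) (Δ-sym (a x) (a v)) ⟩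
            36 * Δ (a v) (a x) + 36 * Δ (a v) B   ≤⟨ +-mono-≤ (B-agree Bx) ΔB ⟩
            deg v + deg v                         ≡⟨ cong (deg v +_) (+-identityʳ _) ⟨
            2 * deg v                             ∎)

        central : ∃[ u ] B u ≡ true × 36 * mismatch s u ≤ 8 * deg v
        central = pigeonhole B _ _ Bv average

        -- One `deg v` for the agreement with `u` and eight for the mismatches of `u`; dividing by 9
        -- leaves the quarter that `close⇒together` asks for.
        close-center : ∃[ u ] 4 * Δ (a v) (s u) ≤ deg v
        close-center = go central
          where
          open ≤-Reasoning
          go : ∃[ u ] B u ≡ true × 36 * mismatch s u ≤ 8 * deg v → ∃[ u ] 4 * Δ (a v) (s u) ≤ deg v
          go (u , Bu , few) = u , *-cancelˡ-≤ 9 (begin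
            9 * (4 * Δ (a v) (s u))                ≡⟨ *-assoc 9 4 (Δ (a v) (s u)) ⟨
            36 * Δ (a v) (s u)                     ≤⟨ *-monoʳ-≤ 36 (Δ-triangle (a v) (a u) (s u)) ⟩
            36 * (Δ (a v) (a u) + mismatch s u)    ≡⟨ *-distribˡ-+ 36 (Δ (a v) (a u)) _ ⟩
            36 * Δ (a v) (a u) + 36 * mismatch s u ≤⟨ +-mono-≤ (B-agree Bu) few ⟩
            9 * deg v                              ∎)

        -- `close⇒together` places `v` in the cluster of the center `u`, so the row of `u` may be
        -- replaced by that of `v`.
        clean-close : 4 * mismatch s v ≤ deg v
        clean-close = go close-center
          where
          go : ∃[ u ] 4 * Δ (a v) (s u) ≤ deg v → 4 * mismatch s v ≤ deg v
          go (u , 4X≤deg) = subst (λ c → 4 * c ≤ deg v)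
            (Δ-congʳ (a v) (class (close⇒together 4X≤deg))) 4X≤deg

      -- Both neighbourhoods lie within a quarter of their degrees of one cluster, so `4D ≤ 2c + D`,
      -- that is `3D ≤ 2c`. Hence `2c + D < 4c`, strictly because degrees are positive.
      together⇒near : ∀ {u v} → clean u ≡ true → clean v ≡ true → s u v ≡ true → near u v ≡ true
      together⇒near {u} {v} cu cv uv = cong not (>⇒not-le bound)
        where
        c D : ℕ
        c = common u v
        D = Δ (a u) (a v)
        sum≡ : deg u + deg v ≡ 2 * c + D
        sum≡ = #+#≡2∩+Δ (a u) (a v)
        4D≤ : 4 * D ≤ 2 * c + D
        4D≤ = begin
          4 * D                                   ≤⟨ *-monoʳ-≤ 4 (Δ-triangle (a u) (s u) (a v)) ⟩
          4 * (mismatch s u + Δ (s u) (a v))      ≡⟨ *-distribˡ-+ 4 (mismatch s u) _ ⟩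
          4 * mismatch s u + 4 * Δ (s u) (a v)    ≡⟨ cong (λ z → 4 * mismatch s u + 4 * z)
            (trans (Δ-sym (s u) (a v)) (Δ-congʳ (a v) (class uv))) ⟩
          4 * mismatch s u + 4 * mismatch s v     ≤⟨ +-mono-≤ (Clean.clean-close cu) (Clean.clean-close cv) ⟩
          deg u + deg v                           ≡⟨ sum≡ ⟩
          2 * c + D                               ∎
          where open ≤-Reasoning
        2≤ : 2 ≤ 2 * c + D
        2≤ = subst (2 ≤_) sum≡ (+-mono-≤ (1≤degree u) (1≤degree v))
        bound : deg u + deg v < 4 * c
        bound rewrite sum≡ = *-cancelˡ-≤ 6 (lin 0 (+-mono-≤ (*-monoʳ-≤ 3 4D≤) (*-monoʳ-≤ 3 2≤)) (l c D))
          where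
          l : ∀ c d → 6 * (4 * c) + (3 * (4 * d) + 3 * 2)
            ≡ 6 * (1 + (2 * c + d)) + (3 * (2 * c + d) + 3 * (2 * c + d)) + 0
          l = solve-∀

      -- Across clusters every common neighbour is a mismatch of `u` or of `v`, and clean vertices
      -- have too few of these.
      near⇒together : ∀ {u v} → clean u ≡ true → clean v ≡ true → near u v ≡ true → s u v ≡ true
      near⇒together {u} {v} cu cv nr with s u v in uv
      ... | true  = refl
      ... | false = contradiction nr (subst (λ b → not b ≢ true) (sym (≤⇒le 4c≤)) λ ())
        where
        4c≤ : 4 * common u v ≤ deg u + deg v
        4c≤ = begin
          4 * common u v                        ≤⟨ *-monoʳ-≤ 4 (sum-≤-+ pointwise) ⟩
          4 * (mismatch s u + mismatch s v)     ≡⟨ *-distribˡ-+ 4 (mismatch s u) _ ⟩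
          4 * mismatch s u + 4 * mismatch s v   ≤⟨ +-mono-≤ (Clean.clean-close cu) (Clean.clean-close cv) ⟩
          deg u + deg v                         ∎
          where
          open ≤-Reasoning
          pointwise : ∀ w → ⟨ a u w ∧ a v w ⟩ ≤ ⟨ a u w xor s u w ⟩ + ⟨ a v w xor s v w ⟩
          pointwise w with s u w in uw
          ... | true rewrite s-sep uv uw = lemma (a u w) (a v w)
            where
            lemma = from-yes (all-bool? λ x → all-bool? λ y → ⟨ x ∧ y ⟩ ≤? ⟨ x xor true ⟩ + ⟨ y xor false ⟩)
          ... | false = lemma (a u w) (a v w) (s v w)
            where
            lemma = from-yes (all-bool? λ x → all-bool? λ y → all-bool? λ z →
              ⟨ x ∧ y ⟩ ≤? ⟨ x xor false ⟩ + ⟨ y xor z ⟩)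

-- Counting admissible pairs against the disagreements of a clustering.

module AdmissiblePairs where
  open LocalSearch
  open Atoms
  open Sums
  open Counting
  open import Data.Bool.Base using (Bool; true; false; not; _∧_; _xor_)
  open import Data.Fin.Base using (Fin; zero; suc)
  open import Data.Fin.Properties using (_≟_)
  open import Data.Nat.Base using (ℕ; zero; suc; _+_; _*_; _≤_; z≤n; >-nonZero; _!)
  open import Data.Nat.Properties renaming (_≟_ to _≟ℕ_)
  open import Data.Nat.Tactic.RingSolver using (solve-∀)
  open import Data.Product.Base using (∃-syntax; _,_; proj₁; proj₂)
  open import Data.Bool.Properties using (∧-comm; ∧-identityʳ; ∧-zeroʳ)
  open import Function.Base using (_∘_)
  open import Relation.Binary.PropositionalEquality
  open import Relation.Nullary.Decidable using (Dec; yes; no; from-yes)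
  open import Data.Nat.Divisibility using (_∣_; divides; ∣-trans; m∣m*n; m≤n⇒m!∣n!)

  #≤n : ∀ {n} (f : Fin n → Bool) → # f ≤ n
  #≤n {zero}  f = ≤-reflexive (sum-zero {f = ⟨_⟩ ∘ f} λ ())
  #≤n {suc n} f = ≤-trans (≤-reflexive (sum-suc _)) (+-mono-≤ (⟨b⟩≤1 (f zero)) (#≤n (f ∘ suc)))

  1≤#⇒∃ : ∀ {n} (f : Fin n → Bool) → 1 ≤ # f → ∃[ x ] f x ≡ true
  1≤#⇒∃ f 1≤ = let (x , fx , _) = argmax f (λ _ → 0) 1≤ in x , fx

  suc-∣-! : ∀ d → suc d ∣ suc d !
  suc-∣-! d = m∣m*n (d !)

  module Charging {n} (a : Fin n → Fin n → Bool) (a-refl : ∀ u → a u u ≡ true)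
                  (a-sym : ∀ u w → a u w ≡ a w u) (K : ℕ) where
    open Scheme a K

    linked-sym : ∀ u v → linked u v ≡ linked v u
    linked-sym u v = cong (le 1) (#-cong λ x → cong (λ c → le (deg x) (K * c))
      (#-cong λ w → cong (_∧ le (deg w) (deg x)) (∧-comm (a u w) (a v w))))

    adm-sym : ∀ u v → adm u v ≡ adm v u
    adm-sym u v = cong₂ (λ b c → not b ∧ c) (==-sym u v)
      (cong₂ (λ b c → not b ∧ c) (∧-comm (clean u) (clean v)) (linked-sym u v))
      where
      ==-sym : ∀ u v → (u == v) ≡ (v == u)
      ==-sym u v with u ≟ v
      ... | yes refl = sym (==-refl u)
      ... | no u≢v   = sym (==-≢ (u≢v ∘ sym))

    -- Double counting walks u – w – v, each weighted by 1 / deg w (scaled by n! to stay in ℕ):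
    -- a linked u receives total weight at least 1 / K, and all u together receive deg v.
    module Walks (v : Fin n) where
      M : ℕ
      M = n !

      1≤deg : ∀ w → 1 ≤ deg w
      1≤deg w = true⇒1≤# (a w) (a-refl w)

      opaque
        reciprocal : ∀ w → ∃[ q ] q * deg w ≡ M
        reciprocal w with deg w in eq | 1≤deg w
        ... | suc d | _ with ∣-trans (suc-∣-! d) (m≤n⇒m!∣n! (subst (_≤ n) eq (#≤n (a w))))
        ...   | divides q M≡ = q , sym M≡

      W : Fin n → ℕ
      W w = proj₁ (reciprocal w)

      W*deg : ∀ w → W w * deg w ≡ M
      W*deg w = proj₂ (reciprocal w)

      walk : Fin n → Fin n → ℕ
      walk u w = ⟨ a u w ∧ a v w ⟩ * W w

      -- At least `deg x / K` middle vertices lie below the threshold, each of weight at least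
      -- `M / deg x`.
      linked⇒heavy : ∀ u → linked u v ≡ true → M ≤ K * sum (walk u)
      linked⇒heavy u luv = go (1≤#⇒∃ (λ x → le (deg x) (K * # (below x))) (le⇒≤ luv))
        where
        below : Fin n → Fin n → Bool
        below x w = (a u w ∧ a v w) ∧ le (deg w) (deg x)
        go : ∃[ x ] le (deg x) (K * # (below x)) ≡ true → M ≤ K * sum (walk u)
        go (x , lx) = *-cancelˡ-≤ (deg x) {{>-nonZero (1≤deg x)}} (begin
          deg x * M                               ≤⟨ *-monoˡ-≤ M (le⇒≤ lx) ⟩
          K * # (below x) * M                     ≡⟨ *-assoc K (# (below x)) M ⟩
          K * (# (below x) * M)                   ≡⟨ cong (K *_) (*-comm (# (below x)) M) ⟩
          K * (M * # (below x))                   ≡⟨ cong (K *_) (sum-* M (⟨_⟩ ∘ below x)) ⟨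
          K * sum (λ w → M * ⟨ below x w ⟩)       ≤⟨ *-monoʳ-≤ K (sum-mono-≤ light) ⟩
          K * sum (λ w → deg x * walk u w)        ≡⟨ cong (K *_) (sum-* (deg x) (walk u)) ⟩
          K * (deg x * sum (walk u))              ≡⟨ lemma K (deg x) (sum (walk u)) ⟩
          deg x * (K * sum (walk u))              ∎)
          where
          open ≤-Reasoning
          lemma : ∀ k d s → k * (d * s) ≡ d * (k * s)
          lemma = solve-∀
          light : ∀ w → M * ⟨ below x w ⟩ ≤ deg x * walk u w
          light w with a u w ∧ a v w
          ... | false = ≤-trans (≤-reflexive (*-zeroʳ M)) z≤n
          ... | true with le (deg w) (deg x) in lw
          ...   | false = ≤-trans (≤-reflexive (*-zeroʳ M)) z≤n
          ...   | true = begin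
            M * 1            ≡⟨ *-identityʳ M ⟩
            M                ≡⟨ W*deg w ⟨
            W w * deg w      ≤⟨ *-monoʳ-≤ (W w) (le⇒≤ lw) ⟩
            W w * deg x      ≡⟨ *-comm (W w) (deg x) ⟩
            deg x * W w      ≡⟨ cong (deg x *_) (+-identityʳ (W w)) ⟨
            deg x * (W w + 0) ∎

      -- A middle vertex `w` in the neighbourhood of `v` gives `W w` to each of its `deg w`
      -- neighbours, hence `M` altogether.
      total : sum (λ u → sum (walk u)) ≡ M * deg v
      total = begin
        sum (λ u → sum (walk u))                      ≡⟨ sum-comm walk ⟩
        sum (λ w → sum λ u → walk u w)                ≡⟨ sum-cong column ⟩
        sum (λ w → M * ⟨ a v w ⟩)                     ≡⟨ sum-* M _ ⟩
        M * deg v                                     ∎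
        where
        open ≡-Reasoning
        column : ∀ w → sum (λ u → walk u w) ≡ M * ⟨ a v w ⟩
        column w = begin
          sum (λ u → ⟨ a u w ∧ a v w ⟩ * W w)          ≡⟨ sum-cong (λ u →
            trans (cong (λ b → ⟨ b ∧ a v w ⟩ * W w) (a-sym u w)) (split (a w u) (a v w) (W w))) ⟩
          sum (λ u → ⟨ a v w ⟩ * W w * ⟨ a w u ⟩)      ≡⟨ sum-* (⟨ a v w ⟩ * W w) _ ⟩
          ⟨ a v w ⟩ * W w * deg w                      ≡⟨ *-assoc ⟨ a v w ⟩ (W w) (deg w) ⟩
          ⟨ a v w ⟩ * (W w * deg w)                    ≡⟨ cong (⟨ a v w ⟩ *_) (W*deg w) ⟩
          ⟨ a v w ⟩ * M                                ≡⟨ *-comm ⟨ a v w ⟩ M ⟩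
          M * ⟨ a v w ⟩                                ∎
          where
          split : ∀ b c x → ⟨ b ∧ c ⟩ * x ≡ ⟨ c ⟩ * x * ⟨ b ⟩
          split true  true  x = sym (*-identityʳ (x + 0))
          split true  false x = refl
          split false true  x = sym (*-zeroʳ (x + 0))
          split false false x = refl

      linked-count : # (λ u → linked u v) ≤ K * deg v
      linked-count = *-cancelˡ-≤ M {{>-nonZero (1≤n! n)}} (begin
        M * # (λ u → linked u v)                ≡⟨ sum-* M _ ⟨
        sum (λ u → M * ⟨ linked u v ⟩)          ≤⟨ sum-mono-≤ heavy ⟩
        sum (λ u → K * sum (walk u))            ≡⟨ sum-* K _ ⟩
        K * sum (λ u → sum (walk u))            ≡⟨ cong (K *_) total ⟩
        K * (M * deg v)                         ≡⟨ lemma K M (deg v) ⟩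
        M * (K * deg v)                         ∎)
        where
        open ≤-Reasoning
        lemma : ∀ k d s → k * (d * s) ≡ d * (k * s)
        lemma = solve-∀
        heavy : ∀ u → M * ⟨ linked u v ⟩ ≤ K * sum (walk u)
        heavy u = go (linked u v) refl
          where
          go : ∀ b → linked u v ≡ b → M * ⟨ b ⟩ ≤ K * sum (walk u)
          go true  luv = ≤-trans (≤-reflexive (*-identityʳ M)) (linked⇒heavy u luv)
          go false _   = ≤-trans (≤-reflexive (*-zeroʳ M)) z≤n

    module Errors {s : Fin n → Fin n → Bool} (s-equiv : IsEquiv s) where
      open IsEquiv s-equiv

      err : Fin n → ℕ
      err u = Δ (a u) (s u)

      -- The errors of a bad vertex are a constant fraction of its cluster, so they can pay for
      -- every vertex in it.
      bad : Fin n → Bool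
      bad u = le (# (s u)) (144 * err u)

      witnesses : Fin n → ℕ
      witnesses v = # λ u → s v u ∧ bad u

      -- Here `144 = 4 * 36`. Disagreement gives `144 * (err v + err u) > 4 * deg v`; as `v` has few
      -- errors, `144 * err u > 3 * deg v`. The common cluster has at most `deg v + err v` vertices,
      -- which is less.
      disagree⇒bad : ∀ {v u} → 144 * err v ≤ deg v → s v u ≡ true → agree v u ≡ false → bad u ≡ true
      disagree⇒bad {v} {u} few vu dis = ≤⇒le
        (lin (4 + 287 * err v)
          (+-mono-≤ (+-mono-≤ cluster≤ (*-monoʳ-≤ 4 (not-le⇒> dis)))
                    (+-mono-≤ (*-monoʳ-≤ 144 Δ≤) (*-monoʳ-≤ 3 few)))
          (lemma (# (s u)) (deg v) (err v) (err u) (Δ (a v) (a u))))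
        where
        lemma : ∀ c d e f x →
          144 * f + (c + 4 * (1 + d) + (144 * x + 3 * (144 * e))) ≡
          c + (d + e + 4 * (36 * x) + (144 * (e + f) + 3 * d)) + (4 + 287 * e)
        lemma = solve-∀
        cluster≤ : # (s u) ≤ deg v + err v
        cluster≤ = begin
          # (s u)                   ≡⟨ #-cong (class vu) ⟨
          # (s v)                   ≤⟨ #≤#+Δ (s v) (a v) ⟩
          deg v + Δ (s v) (a v)     ≡⟨ cong (deg v +_) (Δ-sym (s v) (a v)) ⟩
          deg v + err v             ∎
          where open ≤-Reasoning
        Δ≤ : Δ (a v) (a u) ≤ err v + err u
        Δ≤ = begin
          Δ (a v) (a u)             ≤⟨ Δ-triangle (a v) (s v) (a u) ⟩
          err v + Δ (s v) (a u)     ≡⟨ cong (err v +_) (trans (Δ-sym (s v) (a u)) (Δ-congʳ (a u) (class vu))) ⟩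
          err v + err u             ∎
          where open ≤-Reasoning

      -- Either the errors at `v` pay directly, or more than `deg v / 36` neighbours disagree: those
      -- outside the cluster are errors of `v`, those inside are bad.
      unclean-charge : ∀ v → clean v ≡ false → deg v ≤ 144 * err v + 36 * witnesses v
      unclean-charge v unclean = go (deg v ≤? 144 * err v)
        where
        go : Dec (deg v ≤ 144 * err v) → deg v ≤ 144 * err v + 36 * witnesses v
        go (yes few) = ≤-trans few (m≤m+n _ _)
        go (no many) = lin (1 + 108 * err v)
          (+-mono-≤ (not-le⇒> unclean) (*-monoʳ-≤ 36 (sum-≤-+ pointwise)))
          (lemma (deg v) (err v) (witnesses v) (# (λ u → a v u ∧ not (agree v u))))
          where
          lemma : ∀ d e w c → 144 * e + 36 * w + (1 + d + 36 * c) ≡ d + (36 * c + 36 * (w + e)) + (1 + 108 * e)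
          lemma = solve-∀
          pointwise : ∀ u → ⟨ a v u ∧ not (agree v u) ⟩ ≤ ⟨ s v u ∧ bad u ⟩ + ⟨ a v u xor s v u ⟩
          pointwise u = cases (a v u) (s v u) (agree v u) (bad u) (disagree⇒bad (≰⇒≥ many))
            where
            cases : ∀ p q r b → (q ≡ true → r ≡ false → b ≡ true) →
                    ⟨ p ∧ not r ⟩ ≤ ⟨ q ∧ b ⟩ + ⟨ p xor q ⟩
            cases false q     r     b h = z≤n
            cases true  false true  b h = z≤n
            cases true  false false b h = ≤-refl
            cases true  true  true  b h = z≤n
            cases true  true  false b h rewrite h refl refl = ≤-refl

      -- Counted from the other side: a bad `u` is a witness exactly for the members of its cluster,
      -- whose number its errors bound.
      witnesses-total : sum witnesses ≤ 144 * sum err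
      witnesses-total = begin
        sum witnesses                                  ≡⟨ sum-comm (λ v u → ⟨ s v u ∧ bad u ⟩) ⟩
        sum (λ u → # λ v → s v u ∧ bad u)              ≤⟨ sum-mono-≤ column ⟩
        sum (λ u → 144 * err u)                        ≡⟨ sum-* 144 err ⟩
        144 * sum err                                  ∎
        where
        open ≤-Reasoning
        column : ∀ u → # (λ v → s v u ∧ bad u) ≤ 144 * err u
        column u = go (bad u) refl
          where
          go : ∀ b → bad u ≡ b → # (λ v → s v u ∧ b) ≤ 144 * err u
          go true  isBad = ≤-trans (≤-reflexive (#-cong λ v → trans (∧-identityʳ (s v u)) (symmetric v u)))
                                   (le⇒≤ isBad)
          go false _     = ≤-trans (≤-reflexive (sum-zero λ v → cong ⟨_⟩ (∧-zeroʳ (s v u)))) z≤n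

      unclean-total : sum (λ v → ⟨ not (clean v) ⟩ * deg v) ≤ 5328 * sum err
      unclean-total = begin
        sum (λ v → ⟨ not (clean v) ⟩ * deg v)              ≤⟨ sum-≤-+ each ⟩
        sum (λ v → 144 * err v) + sum (λ v → 36 * witnesses v) ≡⟨ cong₂ _+_ (sum-* 144 err) (sum-* 36 witnesses) ⟩
        144 * sum err + 36 * sum witnesses                 ≤⟨ +-monoʳ-≤ (144 * sum err) (*-monoʳ-≤ 36 witnesses-total) ⟩
        144 * sum err + 36 * (144 * sum err)               ≡⟨ lemma (sum err) ⟩
        5328 * sum err                                     ∎
        where
        open ≤-Reasoning
        lemma : ∀ e → 144 * e + 36 * (144 * e) ≡ 5328 * e
        lemma = solve-∀
        each : ∀ v → ⟨ not (clean v) ⟩ * deg v ≤ 144 * err v + 36 * witnesses v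
        each v = go (clean v) refl
          where
          go : ∀ b → clean v ≡ b → ⟨ not b ⟩ * deg v ≤ 144 * err v + 36 * witnesses v
          go true  _       = z≤n
          go false unclean = ≤-trans (≤-reflexive (*-identityˡ (deg v))) (unclean-charge v unclean)

      -- Each admissible pair is charged to an unclean endpoint, and `v` has at most `K * deg v`
      -- linked partners. The factor 2 covers the choice of endpoint.
      adm-total : ∑∑ (λ u v → ⟨ adm u v ⟩) ≤ 2 * (K * (5328 * sum err))
      adm-total = begin
        ∑∑ (λ u v → ⟨ adm u v ⟩)             ≤⟨ ∑∑-mono-≤ split ⟩
        ∑∑ (λ u v → half u v + half v u)     ≡⟨ ∑∑-+ half (λ u v → half v u) ⟩
        ∑∑ half + ∑∑ (λ u v → half v u)      ≡⟨ cong (∑∑ half +_) (sum-comm (λ u v → half v u)) ⟩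
        ∑∑ half + ∑∑ half                    ≡⟨ cong (∑∑ half +_) (+-identityʳ (∑∑ half)) ⟨
        2 * ∑∑ half                          ≡⟨ cong (2 *_) (sum-comm half) ⟩
        2 * sum (λ v → sum λ u → half u v)   ≤⟨ *-monoʳ-≤ 2 (sum-mono-≤ column) ⟩
        2 * sum (λ v → K * (⟨ not (clean v) ⟩ * deg v)) ≡⟨ cong (2 *_) (sum-* K _) ⟩
        2 * (K * sum (λ v → ⟨ not (clean v) ⟩ * deg v)) ≤⟨ *-monoʳ-≤ 2 (*-monoʳ-≤ K unclean-total) ⟩
        2 * (K * (5328 * sum err))           ∎
        where
        open ≤-Reasoning
        half : Fin n → Fin n → ℕ
        half u v = ⟨ not (clean v) ⟩ * ⟨ linked u v ⟩
        split : ∀ u v → ⟨ adm u v ⟩ ≤ half u v + half v u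
        split u v rewrite linked-sym v u = cases (u == v) (clean u) (clean v) (linked u v)
          where
          cases : ∀ e p q l → ⟨ not e ∧ not (p ∧ q) ∧ l ⟩ ≤ ⟨ not q ⟩ * ⟨ l ⟩ + ⟨ not p ⟩ * ⟨ l ⟩
          cases = from-yes (all-bool? λ e → all-bool? λ p → all-bool? λ q → all-bool? λ l →
            ⟨ not e ∧ not (p ∧ q) ∧ l ⟩ ≤? ⟨ not q ⟩ * ⟨ l ⟩ + ⟨ not p ⟩ * ⟨ l ⟩)
        column : ∀ v → sum (λ u → half u v) ≤ K * (⟨ not (clean v) ⟩ * deg v)
        column v = begin
          sum (λ u → half u v)                       ≡⟨ sum-* ⟨ not (clean v) ⟩ _ ⟩
          ⟨ not (clean v) ⟩ * # (λ u → linked u v)   ≤⟨ *-monoʳ-≤ ⟨ not (clean v) ⟩ (Walks.linked-count v) ⟩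
          ⟨ not (clean v) ⟩ * (K * deg v)            ≡⟨ swap ⟨ not (clean v) ⟩ K (deg v) ⟩
          K * (⟨ not (clean v) ⟩ * deg v)            ∎
          where
          swap : ∀ b k d → b * (k * d) ≡ k * (b * d)
          swap = solve-∀

-- A compiler from arithmetic expressions to WHILE, with time bounds.

module While where
  open import Data.Fin.Base using (Fin; zero; suc)
  open import Data.List.Base using ([]; _∷_; length)
  open import Data.Nat.Base using (ℕ; zero; suc; _+_; _*_; _∸_; _≤_; _<_; z≤n; s≤s; >-nonZero) renaming (_^_ to _^ℕ_)
  open import Data.Nat.Properties
  open import Data.Nat.Tactic.RingSolver using (solve-∀)
  open import Data.Product.Base using (∃-syntax; _×_; _,_)
  open import Data.Vec.Base using (Vec; []; _∷_; lookup)
  open import Function.Base using (_∘_)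
  open import Relation.Binary.PropositionalEquality
  open import Relation.Nullary.Decidable using (yes; no)
  open import Relation.Nullary.Negation using (contradiction)

  unary : ℕ → Tree
  unary zero    = nil
  unary (suc k) = nil ∙ unary k

  unaryExp : ℕ → Exp
  unaryExp zero    = nil
  unaryExp (suc k) = cons nil (unaryExp k)

  eval-unaryExp : ∀ k σ → eval (unaryExp k) σ ≡ unary k
  eval-unaryExp zero    σ = refl
  eval-unaryExp (suc k) σ = cong (nil ∙_) (eval-unaryExp k σ)

  expTime-unaryExp : ∀ k → expTime (unaryExp k) ≡ 1 + 2 * k
  expTime-unaryExp zero    = refl
  expTime-unaryExp (suc k) = trans (cong (2 +_) (expTime-unaryExp k)) (lemma k)
    where
    lemma : ∀ k → 2 + (1 + 2 * k) ≡ 1 + 2 * (1 + k)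
    lemma = solve-∀

  ≡-update : ∀ σ x d → (σ [ x ↦ d ]) x ≡ d
  ≡-update σ x d with x ≟ x
  ... | yes _  = refl
  ... | no x≢x = contradiction refl x≢x

  ≢-update : ∀ σ {x y} d → y ≢ x → (σ [ x ↦ d ]) y ≡ σ y
  ≢-update σ {x} {y} d y≢x with y ≟ x
  ... | yes y≡x = contradiction y≡x y≢x
  ... | no _    = refl

  -- A total-correctness triple with a time budget, so that running times compose together with
  -- postconditions.
  Run : Cmd → Store → ℕ → (Store → Set) → Set
  Run c σ B P = ∃[ t ] ∃[ τ ] ⟨ c , σ ⟩⇓[ t ] τ × t ≤ B × P τ

  run-weaken : ∀ {c σ B B′ P Q} → B ≤ B′ → (∀ {τ} → P τ → Q τ) → Run c σ B P → Run c σ B′ Q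
  run-weaken B≤ P⇒Q (t , τ , step , t≤ , p) = t , τ , step , ≤-trans t≤ B≤ , P⇒Q p

  infixr 4 _then_

  _then_ : ∀ {c₁ c₂ σ B₁ B₂ P Q} → Run c₁ σ B₁ P → (∀ {τ} → P τ → Run c₂ τ B₂ Q) →
           Run (c₁ ⨾ c₂) σ (1 + B₁ + B₂) Q
  (t₁ , σ′ , step₁ , t₁≤ , p) then k with k p
  ... | t₂ , τ , step₂ , t₂≤ , q =
    1 + t₁ + t₂ , τ , seq step₁ step₂ , s≤s (+-mono-≤ t₁≤ t₂≤) , q

  run-assign : ∀ {x e σ P} → P (σ [ x ↦ eval e σ ]) → Run (x := e) σ (1 + expTime e) P
  run-assign p = _ , _ , assign , ≤-refl , p

  -- The invariant is indexed by the number of rounds left, which makes termination structural.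
  run-while : ∀ {e body B} (P : ℕ → Store → Set) →
              (∀ {σ} → P 0 σ → eval e σ ≡ nil) →
              (∀ {c σ} → P (suc c) σ → eval e σ ≢ nil) →
              (∀ {c σ} → P (suc c) σ → Run body σ B (P c)) →
              ∀ {σ} c → P c σ → Run (while e loop body) σ (1 + expTime e + c * (1 + expTime e + B)) (P 0)
  run-while P halt go step zero p =
    _ , _ , stop (halt p) , ≤-reflexive (sym (+-identityʳ _)) , p
  run-while {e} {body} {B} P halt go step {σ} (suc c) p with step p
  ... | t₁ , σ′ , step₁ , t₁≤ , p′ with run-while P halt go step c p′
  ...   | t₂ , τ , step₂ , t₂≤ , q =
    _ , τ , again (go p) step₁ step₂ , bound , q
    where
    open ≤-Reasoning
    lemma : ∀ e b c → 1 + e + b + (1 + e + c) ≡ 1 + e + (1 + e + b + c)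
    lemma = solve-∀
    bound : 1 + expTime e + t₁ + t₂ ≤ 1 + expTime e + suc c * (1 + expTime e + B)
    bound = begin
      1 + expTime e + t₁ + t₂ ≤⟨ +-mono-≤ (+-monoʳ-≤ (1 + expTime e) t₁≤) t₂≤ ⟩
      1 + expTime e + B + (1 + expTime e + c * (1 + expTime e + B)) ≡⟨ lemma (expTime e) B _ ⟩
      1 + expTime e + (1 + expTime e + B + c * (1 + expTime e + B)) ∎

  -- As `right nil` is `nil`, this is truncated subtraction on unary numbers; on lists it serves for
  -- indexing.
  drop : ℕ → Tree → Tree
  drop zero    t = t
  drop (suc k) t = drop k (right t)

  drop-unary : ∀ k p → drop k (unary p) ≡ unary (p ∸ k)
  drop-unary zero    p       = refl
  drop-unary (suc k) zero    = trans (drop-unary k zero) (cong unary (0∸n≡0 k))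
  drop-unary (suc k) (suc p) = drop-unary k p

  unary-suc≢nil : ∀ {k} → unary (suc k) ≢ nil
  unary-suc≢nil ()

  Off : Var → Var → Store → Store → Set
  Off r q σ τ = ∀ y → y ≢ r → y ≢ q → τ y ≡ σ y

  counted : (Var → Exp) → Var → Var → Cmd
  counted f r q = while var q loop (r := f r ⨾ q := tl (var q))

  run-counted : ∀ (f : Var → Exp) (g : Tree → Tree) r q {σ} c → r ≢ q →
                (∀ τ → eval (f r) τ ≡ g (τ r)) → (h : ℕ → Tree → Tree) →
                (∀ t → h 0 t ≡ t) → (∀ k t → h (suc k) t ≡ h k (g t)) → σ q ≡ unary c →
                Run (counted f r q) σ (2 + c * (7 + expTime (f r)))
                    (λ τ → τ r ≡ h c (σ r) × Off r q σ τ)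
  run-counted f g r q {σ} c r≢q f≗g h h-zero h-suc σq =
    run-weaken (≤-reflexive (cong (λ b → 2 + c * b) (lemma (expTime (f r)))))
      (λ { (_ , hr , off) → trans (sym (h-zero _)) hr , off })
      (run-while Inv (λ (τq , _) → τq) (λ (τq , _) τq≡nil → unary-suc≢nil (trans (sym τq) τq≡nil))
        (λ {k} → body {k}) c (σq , refl , λ _ _ _ → refl))
    where
    lemma : ∀ e → 2 + (1 + (1 + e) + 3) ≡ 7 + e
    lemma = solve-∀
    Inv : ℕ → Store → Set
    Inv k τ = τ q ≡ unary k × h k (τ r) ≡ h c (σ r) × Off r q σ τ
    body : ∀ {k τ} → Inv (suc k) τ → Run (r := f r ⨾ q := tl (var q)) τ (1 + (1 + expTime (f r)) + 3) (Inv k)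
    body {k} {τ} (τq , hr , off) = run-assign {P = _≡ τ [ r ↦ eval (f r) τ ]} refl then λ { refl → run-assign
      ( trans (≡-update _ q _) (cong right (trans (≢-update τ _ (r≢q ∘ sym)) τq))
      , trans (cong (h k) (trans (≢-update _ _ r≢q) (trans (≡-update τ r _) (f≗g τ)))) (trans (sym (h-suc k (τ r))) hr)
      , λ y y≢r y≢q → trans (≢-update _ _ y≢q) (trans (≢-update τ _ y≢r) (off y y≢r y≢q))) }

  grow : ℕ → Tree → Tree
  grow zero    t = t
  grow (suc k) t = grow k (nil ∙ t)

  grow-unary : ∀ k p → grow k (unary p) ≡ unary (p + k)
  grow-unary zero    p = cong unary (sym (+-identityʳ p))
  grow-unary (suc k) p = trans (grow-unary k (suc p)) (cong unary (sym (+-suc p k)))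

  dropLoop addLoop : Var → Var → Cmd
  dropLoop = counted (λ r → tl (var r))
  addLoop  = counted (λ r → cons nil (var r))

  run-drop : ∀ r q {σ} c → r ≢ q → σ q ≡ unary c →
             Run (dropLoop r q) σ (2 + c * 9) (λ τ → τ r ≡ drop c (σ r) × Off r q σ τ)
  run-drop r q c r≢q =
    run-counted (λ r → tl (var r)) right r q c r≢q (λ _ → refl) drop (λ _ → refl) (λ _ _ → refl)

  run-add : ∀ r q {σ} c → r ≢ q → σ q ≡ unary c →
            Run (addLoop r q) σ (2 + c * 10) (λ τ → τ r ≡ grow c (σ r) × Off r q σ τ)
  run-add r q c r≢q =
    run-counted (λ r → cons nil (var r)) (nil ∙_) r q c r≢q (λ _ → refl) grow (λ _ → refl) (λ _ _ → refl)

  data Bound : Set where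
    con       : ℕ → Bound
    arg       : Bound
    _⊞_ _⊠_   : Bound → Bound → Bound

  infixl 6 _⊞_
  infixl 7 _⊠_

  at : Bound → ℕ → ℕ
  at (con k) z = k
  at arg     z = z
  at (b ⊞ c) z = at b z + at c z
  at (b ⊠ c) z = at b z * at c z

  -- A bound is absorbed into a single power of its argument: a constant `k` through `k ≤ 2 ^ k`,
  -- and a sum through one extra factor, both requiring an argument of at least 2.
  exponent : Bound → ℕ
  exponent (con k) = k
  exponent arg     = 1
  exponent (b ⊞ c) = 1 + (exponent b + exponent c)
  exponent (b ⊠ c) = exponent b + exponent c

  k≤2^k : ∀ k → k ≤ 2 ^ℕ k
  k≤2^k zero    = z≤n
  k≤2^k (suc k) = begin
    1 + k           ≤⟨ +-mono-≤ (m^n>0 2 k) (k≤2^k k) ⟩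
    2 ^ℕ k + 2 ^ℕ k   ≡⟨ cong (2 ^ℕ k +_) (+-identityʳ _) ⟨
    2 ^ℕ suc k       ∎
    where open ≤-Reasoning

  at≤^ : ∀ b {z} → 2 ≤ z → at b z ≤ z ^ℕ exponent b
  at≤^ (con k) 2≤z = ≤-trans (k≤2^k k) (^-monoˡ-≤ k 2≤z)
  at≤^ arg {z} 2≤z = ≤-reflexive (sym (*-identityʳ z))
  at≤^ (b ⊞ c) {z} 2≤z = begin
    at b z + at c z                  ≤⟨ +-mono-≤ (at≤^ b 2≤z) (at≤^ c 2≤z) ⟩
    z ^ℕ i + z ^ℕ j                    ≤⟨ +-mono-≤ (^-monoʳ-≤ z (m≤m+n i j)) (^-monoʳ-≤ z (m≤n+m j i)) ⟩
    z ^ℕ (i + j) + z ^ℕ (i + j)        ≡⟨ cong (z ^ℕ (i + j) +_) (+-identityʳ _) ⟨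
    2 * z ^ℕ (i + j)                  ≤⟨ *-monoˡ-≤ (z ^ℕ (i + j)) 2≤z ⟩
    z ^ℕ (1 + (i + j))                ∎
    where
    open ≤-Reasoning
    i = exponent b
    j = exponent c
    instance _ = >-nonZero (≤-trans (s≤s z≤n) 2≤z)
  at≤^ (b ⊠ c) {z} 2≤z = ≤-trans (*-mono-≤ (at≤^ b 2≤z) (at≤^ c 2≤z))
    (≤-reflexive (sym (^-distribˡ-+-* z (exponent b) (exponent c))))

  -- Arithmetic with access to a 0/1 matrix; variables are de Bruijn indices, and
  -- sumOver i e sums e over all values below that of variable i.
  data Expr : ℕ → Set where
    idx     : ∀ {s} → Fin s → Expr s
    lit     : ∀ {s} → ℕ → Expr s
    adj     : ∀ {s} → Fin s → Fin s → Expr s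
    _⊕_ _⊖_ : ∀ {s} → Expr s → Expr s → Expr s
    sumOver : ∀ {s} → Fin s → Expr (suc s) → Expr s

  sumTo : ℕ → (ℕ → ℕ) → ℕ
  sumTo zero    f = 0
  sumTo (suc c) f = f c + sumTo c f

  sumTo-≤ : ∀ c {f b} → (∀ i → i < c → f i ≤ b) → sumTo c f ≤ c * b
  sumTo-≤ zero    h = z≤n
  sumTo-≤ (suc c) h = +-mono-≤ (h c ≤-refl) (sumTo-≤ c λ i i<c → h i (m≤n⇒m≤1+n i<c))

  module _ (entry : ℕ → ℕ → ℕ) where
    val : ∀ {s} → Expr s → Vec ℕ s → ℕ
    val (idx i)       ρ = lookup ρ i
    val (lit k)       ρ = k
    val (adj i j)     ρ = entry (lookup ρ i) (lookup ρ j)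
    val (e ⊕ f)       ρ = val e ρ + val f ρ
    val (e ⊖ f)       ρ = val e ρ ∸ val f ρ
    val (sumOver i e) ρ = sumTo (lookup ρ i) λ c → val e (c ∷ ρ)

  -- tab i o lists the values of o over all values below that of variable i.
  data Out : ℕ → Set where
    cell : ∀ {s} → Expr s → Out s
    tab  : ∀ {s} → Fin s → Out (suc s) → Out s
    pair : ∀ {s} → Out s → Out s → Out s

  -- The index counts down while values are consed in front, so the list comes out in increasing
  -- order.
  listTo : ℕ → (ℕ → Tree) → Tree → Tree
  listTo zero    f t = t
  listTo (suc c) f t = listTo c f (f c ∙ t)

  module _ (entry : ℕ → ℕ → ℕ) where
    outVal : ∀ {s} → Out s → Vec ℕ s → Tree
    outVal (cell e)   ρ = unary (val entry e ρ)
    outVal (tab i o)  ρ = listTo (lookup ρ i) (λ c → outVal o (c ∷ ρ)) nil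
    outVal (pair o q) ρ = outVal o ρ ∙ outVal q ρ

  -- Calling convention: the result goes to variable `r`, variables above `r` are scratch, and those
  -- below `r` are preserved, among them the input in variable 0.
  compile : ∀ {s} → Expr s → Vec Var s → Var → Cmd
  compile (idx i) γ r = r := var (lookup γ i)
  compile (lit k) γ r = r := unaryExp k
  compile (adj i j) γ r =
    r := var 0 ⨾ suc r := var (lookup γ i) ⨾ dropLoop r (suc r) ⨾ r := hd (var r) ⨾
    suc r := var (lookup γ j) ⨾ dropLoop r (suc r) ⨾ r := hd (var r)
  compile (e ⊕ f) γ r = compile e γ r ⨾ compile f γ (suc r) ⨾ addLoop r (suc r)
  compile (e ⊖ f) γ r = compile e γ r ⨾ compile f γ (suc r) ⨾ dropLoop r (suc r)
  compile (sumOver i e) γ r =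
    r := nil ⨾ suc r := var (lookup γ i) ⨾
    while var (suc r) loop
      -- The counter is decremented before the body, so it doubles as the bound variable and runs
      -- down to 0.
      (suc r := tl (var (suc r)) ⨾ compile e (suc r ∷ γ) (2 + r) ⨾ addLoop r (2 + r))

  compileOut : ∀ {s} → Out s → Vec Var s → Var → Cmd
  compileOut (cell e) γ r = compile e γ r
  compileOut (tab i o) γ r =
    r := nil ⨾ suc r := var (lookup γ i) ⨾
    while var (suc r) loop
      (suc r := tl (var (suc r)) ⨾ compileOut o (suc r ∷ γ) (2 + r) ⨾ r := cons (var (2 + r)) (var r))
  compileOut (pair o q) γ r =
    compileOut o γ r ⨾ compileOut q γ (suc r) ⨾ r := cons (var r) (var (suc r))

  -- Numbers are unary and loops consume them cell by cell, so the size of values enters the running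
  -- time.
  valBound : ∀ {s} → Expr s → Bound
  valBound (idx i)       = arg
  valBound (lit k)       = con k
  valBound (adj i j)     = con 1
  valBound (e ⊕ f)       = valBound e ⊞ valBound f
  valBound (e ⊖ f)       = valBound e
  valBound (sumOver i e) = arg ⊠ valBound e

  time : ∀ {s} → Expr s → Bound
  time (idx i)       = con 2
  time (lit k)       = con (2 + 2 * k)
  time (adj i j)     = con 22 ⊞ arg ⊠ con 18
  time (e ⊕ f)       = con 1 ⊞ time e ⊞ (con 1 ⊞ time f ⊞ (con 2 ⊞ valBound f ⊠ con 10))
  time (e ⊖ f)       = con 1 ⊞ time e ⊞ (con 1 ⊞ time f ⊞ (con 2 ⊞ valBound f ⊠ con 9))
  time (sumOver i e) =
    con 8 ⊞ arg ⊠ (con 2 ⊞ (con 4 ⊞ (con 1 ⊞ time e ⊞ (con 2 ⊞ valBound e ⊠ con 10))))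

  outTime : ∀ {s} → Out s → Bound
  outTime (cell e)   = time e
  outTime (tab i o)  = con 8 ⊞ arg ⊠ (con 2 ⊞ (con 4 ⊞ (con 1 ⊞ outTime o ⊞ con 4)))
  outTime (pair o q) = con 1 ⊞ outTime o ⊞ (con 1 ⊞ outTime q ⊞ con 4)

  Small : ∀ {s} → Vec ℕ s → ℕ → Set
  Small ρ z = ∀ i → lookup ρ i ≤ z

  Small-∷ : ∀ {s} {ρ : Vec ℕ s} {z c} → c ≤ z → Small ρ z → Small (c ∷ ρ) z
  Small-∷ c≤z small zero    = c≤z
  Small-∷ c≤z small (suc i) = small i

  record Holds {s} (M : Tree) (γ : Vec Var s) (ρ : Vec ℕ s) (r : Var) (σ : Store) : Set where
    field
      matrix : σ 0 ≡ M
      0<r    : 0 < r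
      below  : ∀ i → lookup γ i < r
      stored : ∀ i → σ (lookup γ i) ≡ unary (lookup ρ i)

  _≈[_]_ : Store → Var → Store → Set
  τ ≈[ r ] σ = ∀ y → y < r → τ y ≡ σ y

  Holds-≈ : ∀ {s M r σ τ} {γ : Vec Var s} {ρ} → τ ≈[ r ] σ → Holds M γ ρ r σ → Holds M γ ρ r τ
  Holds-≈ τ≈σ h = record
    { matrix = trans (τ≈σ _ 0<r) matrix
    ; 0<r    = 0<r
    ; below  = below
    ; stored = λ i → trans (τ≈σ _ (below i)) (stored i)
    } where open Holds h

  Holds-≤ : ∀ {s M r r′ σ} {γ : Vec Var s} {ρ} → r ≤ r′ → Holds M γ ρ r σ → Holds M γ ρ r′ σ
  Holds-≤ r≤r′ h = record
    { matrix = matrix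
    ; 0<r    = ≤-trans 0<r r≤r′
    ; below  = λ i → ≤-trans (below i) r≤r′
    ; stored = stored
    } where open Holds h

  Holds-∷ : ∀ {s M r σ c} {γ : Vec Var s} {ρ} → σ r ≡ unary c → Holds M γ ρ r σ →
            Holds M (r ∷ γ) (c ∷ ρ) (suc r) σ
  Holds-∷ {r = r} σr h = record
    { matrix = matrix
    ; 0<r    = s≤s z≤n
    ; below  = λ { zero → ≤-refl ; (suc i) → m≤n⇒m≤1+n (below i) }
    ; stored = λ { zero → σr ; (suc i) → stored i }
    } where open Holds h

  run-set : ∀ {x e σ} → Run (x := e) σ (1 + expTime e)
            (λ τ → τ x ≡ eval e σ × (∀ y → y ≢ x → τ y ≡ σ y))
  run-set {x} {e} {σ} = run-assign (≡-update σ x (eval e σ) , λ y → ≢-update σ (eval e σ))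

  ≈-trans : ∀ {r σ τ υ} → υ ≈[ r ] τ → τ ≈[ r ] σ → υ ≈[ r ] σ
  ≈-trans p q y y<r = trans (p y y<r) (q y y<r)

  ≈-≤ : ∀ {r r′ σ τ} → r ≤ r′ → τ ≈[ r′ ] σ → τ ≈[ r ] σ
  ≈-≤ r≤r′ p y y<r = p y (≤-trans y<r r≤r′)

  set⇒≈ : ∀ {x r σ τ} → r ≤ x → (∀ y → y ≢ x → τ y ≡ σ y) → τ ≈[ r ] σ
  set⇒≈ r≤x p y y<r = p y (<⇒≢ (≤-trans y<r r≤x))

  off⇒≈ : ∀ {p q r σ τ} → r ≤ p → r ≤ q → Off p q σ τ → τ ≈[ r ] σ
  off⇒≈ r≤p r≤q off y y<r = off y (<⇒≢ (≤-trans y<r r≤p)) (<⇒≢ (≤-trans y<r r≤q))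

  r≢1+r : ∀ {r} → r ≢ suc r
  r≢1+r = <⇒≢ ≤-refl

  module Correct (M : Tree) (entry : ℕ → ℕ → ℕ) (entry≤1 : ∀ i j → entry i j ≤ 1)
                 (entry≡ : ∀ i j → left (drop j (left (drop i M))) ≡ unary (entry i j)) where

    val≤ : ∀ {s} (e : Expr s) {ρ z} → Small ρ z → val entry e ρ ≤ at (valBound e) z
    val≤ (idx i)       small = small i
    val≤ (lit k)       small = ≤-refl
    val≤ (adj i j)     small = entry≤1 _ _
    val≤ (e ⊕ f)       small = +-mono-≤ (val≤ e small) (val≤ f small)
    val≤ (e ⊖ f) {ρ}   small = ≤-trans (m∸n≤m (val entry e ρ) (val entry f ρ)) (val≤ e small)
    val≤ (sumOver i e) {ρ} {z} small = ≤-trans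
      (sumTo-≤ (lookup ρ i) λ c c<b → val≤ e (Small-∷ (≤-trans (<⇒≤ c<b) (small i)) small))
      (*-monoˡ-≤ (at (valBound e) z) (small i))

    Result : Var → ℕ → Store → Store → Set
    Result r v σ τ = τ r ≡ unary v × τ ≈[ r ] σ

    run-compile : ∀ {s} (e : Expr s) {γ ρ r σ z} → Holds M γ ρ r σ → Small ρ z →
                  Run (compile e γ r) σ (at (time e) z) (Result r (val entry e ρ) σ)
    run-binary : ∀ {s} (e f : Expr s) {γ ρ r σ z v} {loop : Var → Var → Cmd} {b : ℕ}
                 {h : ℕ → Tree → Tree} → Holds M γ ρ r σ → Small ρ z →
                 (∀ {τ} c → τ (suc r) ≡ unary c → Run (loop r (suc r)) τ (2 + c * b)
                   (λ υ → υ r ≡ h c (τ r) × Off r (suc r) τ υ)) →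
                 h (val entry f ρ) (unary (val entry e ρ)) ≡ unary v →
                 Run (compile e γ r ⨾ compile f γ (suc r) ⨾ loop r (suc r)) σ
                     (1 + at (time e) z + (1 + at (time f) z + (2 + at (valBound f) z * b)))
                     (Result r v σ)

    run-binary e f {γ} {ρ} {r} {σ} {b = b} {h} holds small run-loop hv =
      run-compile e holds small then λ {τ₁} (τ₁r , τ₁≈) →
      run-compile f (Holds-≤ (n≤1+n r) (Holds-≈ τ₁≈ holds)) small then λ {τ₂} (τ₂r , τ₂≈) →
      run-weaken (+-monoʳ-≤ 2 (*-monoˡ-≤ b (val≤ f small)))
        (λ (υr , off) → trans υr (trans (cong (h (val entry f ρ)) (trans (τ₂≈ r ≤-refl) τ₁r)) hv)
                      , ≈-trans (off⇒≈ ≤-refl (n≤1+n r) off) (≈-trans (≈-≤ (n≤1+n r) τ₂≈) τ₁≈))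
        (run-loop (val entry f ρ) τ₂r)

    run-compile (idx i) {r = r} holds small =
      run-weaken ≤-refl (λ (τr , same) → trans τr (Holds.stored holds i) , set⇒≈ ≤-refl same) run-set
    run-compile (lit k) {σ = σ} holds small =
      run-weaken (≤-reflexive (cong suc (expTime-unaryExp k)))
        (λ (τr , same) → trans τr (eval-unaryExp k σ) , set⇒≈ ≤-refl same) run-set
    run-compile (adj i j) {γ} {ρ} {r} {σ} {z} holds small = run-weaken bound (λ p → p) (
      run-set then λ {σ₁} (σ₁r , same₁) →
      run-set then λ {σ₂} (σ₂q , same₂) →
      run-drop r (suc r) ρi r≢1+r
        (trans σ₂q (trans (set⇒≈ ≤-refl same₁ _ (below i)) (stored i))) then λ {σ₃} (σ₃r , off₃) →
      run-set then λ {σ₄} (σ₄r , same₄) →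
      run-set then λ {σ₅} (σ₅q , same₅) →
      let σ₄≈σ : σ₄ ≈[ r ] σ
          σ₄≈σ = ≈-trans (set⇒≈ ≤-refl same₄) (≈-trans (off⇒≈ ≤-refl (n≤1+n r) off₃)
                   (≈-trans (set⇒≈ (n≤1+n r) same₂) (set⇒≈ ≤-refl same₁)))
      in run-drop r (suc r) ρj r≢1+r
        (trans σ₅q (trans (σ₄≈σ _ (below j)) (stored j))) then λ {σ₆} (σ₆r , off₆) →
      run-weaken ≤-refl (λ (τr , same₇) →
          (begin
            _                                     ≡⟨ τr ⟩
            left (σ₆ r)                           ≡⟨ cong left σ₆r ⟩
            left (drop ρj (σ₅ r))                  ≡⟨ cong (λ t → left (drop ρj t)) (same₅ r r≢1+r) ⟩
            left (drop ρj (σ₄ r))                  ≡⟨ cong (λ t → left (drop ρj t)) σ₄r ⟩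
            left (drop ρj (left (σ₃ r)))           ≡⟨ cong (λ t → left (drop ρj (left t))) σ₃r ⟩
            left (drop ρj (left (drop ρi (σ₂ r))))  ≡⟨ cong (λ t → left (drop ρj (left (drop ρi t))))
                                                       (trans (same₂ r r≢1+r) (trans σ₁r matrix)) ⟩
            left (drop ρj (left (drop ρi M)))       ≡⟨ entry≡ ρi ρj ⟩
            unary (entry ρi ρj)                     ∎)
        , ≈-trans (set⇒≈ ≤-refl same₇) (≈-trans (off⇒≈ ≤-refl (n≤1+n r) off₆)
            (≈-trans (set⇒≈ (n≤1+n r) same₅) σ₄≈σ))) run-set)
      where
      open Holds holds
      open ≡-Reasoning
      ρi ρj : ℕ
      ρi = lookup ρ i
      ρj = lookup ρ j
      lemma : ∀ i j → 3 + (3 + (1 + (2 + i * 9) + (4 + (3 + (1 + (2 + j * 9) + 3))))) ≡ 22 + (i + j) * 9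
      lemma = solve-∀
      lemma′ : ∀ z → 22 + (z + z) * 9 ≡ 22 + z * 18
      lemma′ = solve-∀
      bound : 3 + (3 + (1 + (2 + ρi * 9) + (4 + (3 + (1 + (2 + ρj * 9) + 3))))) ≤ 22 + z * 18
      bound = ≤-trans (≤-reflexive (lemma ρi ρj))
        (≤-trans (+-monoʳ-≤ 22 (*-monoˡ-≤ 9 (+-mono-≤ (small i) (small j)))) (≤-reflexive (lemma′ z)))
    run-compile (e ⊕ f) {ρ = ρ} {r} holds small =
      run-binary e f {loop = addLoop} {h = grow} holds small (λ c → run-add r (suc r) c r≢1+r)
        (grow-unary (val entry f ρ) (val entry e ρ))
    run-compile (e ⊖ f) {ρ = ρ} {r} holds small =
      run-binary e f {loop = dropLoop} {h = drop} holds small (λ c → run-drop r (suc r) c r≢1+r)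
        (drop-unary (val entry f ρ) (val entry e ρ))
    run-compile (sumOver i e) {γ} {ρ} {r} {σ} {z} holds small =
      run-weaken (+-monoʳ-≤ 8 (*-monoˡ-≤ _ (small i))) (λ p → p) (
      run-set then λ {σ₁} (σ₁r , same₁) →
      run-set then λ {σ₂} (σ₂q , same₂) →
      run-weaken ≤-refl
        (λ (_ , _ , a , τr , a≡ , ≈σ) → trans τr (cong unary (trans (sym (+-identityʳ a)) a≡)) , ≈σ)
        (run-while Inv (λ (_ , τq , _) → τq)
          (λ (_ , τq , _) q≡nil → unary-suc≢nil (trans (sym τq) q≡nil))
          (λ {c} → body {c}) (lookup ρ i)
          ( ≤-refl
          , trans σ₂q (trans (set⇒≈ ≤-refl same₁ _ (below i)) (stored i))
          , 0 , trans (same₂ r r≢1+r) σ₁r , refl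
          , ≈-trans (set⇒≈ (n≤1+n r) same₂) (set⇒≈ ≤-refl same₁))))
      where
      open Holds holds
      f : ℕ → ℕ
      f c = val entry e (c ∷ ρ)
      -- The accumulator `a` holds the part of the sum over the indices from `c` upward.
      Inv : ℕ → Store → Set
      Inv c τ = c ≤ lookup ρ i × τ (suc r) ≡ unary c ×
        ∃[ a ] τ r ≡ unary a × a + sumTo c f ≡ sumTo (lookup ρ i) f × τ ≈[ r ] σ
      body : ∀ {c τ} → Inv (suc c) τ → Run _ τ _ (Inv c)
      body {c} {τ} (c<b , τq , a , τr , a≡ , τ≈) =
        run-set then λ {τ₁} (τ₁q , same₁) →
        let τ₁≈ : τ₁ ≈[ suc r ] τ
            τ₁≈ = set⇒≈ ≤-refl same₁
            τ₁q′ : τ₁ (suc r) ≡ unary c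
            τ₁q′ = trans τ₁q (cong right τq)
            small′ : Small (c ∷ ρ) z
            small′ = Small-∷ (≤-trans (<⇒≤ c<b) (small i)) small
        in run-compile e (Holds-∷ τ₁q′ (Holds-≤ (n≤1+n r)
             (Holds-≈ (≈-trans (≈-≤ (n≤1+n r) τ₁≈) τ≈) holds))) small′ then λ {τ₂} (τ₂v , τ₂≈) →
        run-weaken (+-monoʳ-≤ 2 (*-monoˡ-≤ 10 (val≤ e small′)))
          (λ (υr , off) →
              <⇒≤ c<b
            , trans (off (suc r) (r≢1+r ∘ sym) r≢1+r) (trans (τ₂≈ (suc r) ≤-refl) τ₁q′)
            , a + f c
            , trans υr (trans (cong (grow (f c)) (trans (τ₂≈ r (n≤1+n (suc r))) (trans (τ₁≈ r ≤-refl) τr)))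
                              (grow-unary (f c) a))
            , trans (+-assoc a (f c) _) a≡
            , ≈-trans (off⇒≈ ≤-refl (≤-trans (n≤1+n r) (n≤1+n (suc r))) off)
                (≈-trans (≈-≤ (≤-trans (n≤1+n r) (n≤1+n (suc r))) τ₂≈) (≈-trans (≈-≤ (n≤1+n r) τ₁≈) τ≈)))
          (run-add r (2 + r) (f c) (<⇒≢ (n≤1+n (suc r))) τ₂v)

    run-compileOut : ∀ {s} (o : Out s) {γ ρ r σ z} → Holds M γ ρ r σ → Small ρ z →
      Run (compileOut o γ r) σ (at (outTime o) z) (λ τ → τ r ≡ outVal entry o ρ × τ ≈[ r ] σ)
    run-compileOut (cell e) holds small = run-compile e holds small
    run-compileOut (pair o q) {r = r} holds small =
      run-compileOut o holds small then λ {τ₁} (τ₁r , τ₁≈) →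
      run-compileOut q (Holds-≤ (n≤1+n r) (Holds-≈ τ₁≈ holds)) small then λ {τ₂} (τ₂q , τ₂≈) →
      run-weaken ≤-refl
        (λ (υr , same) → trans υr (cong₂ _∙_ (trans (τ₂≈ r ≤-refl) τ₁r) τ₂q)
                       , ≈-trans (set⇒≈ ≤-refl same) (≈-trans (≈-≤ (n≤1+n r) τ₂≈) τ₁≈))
        run-set
    run-compileOut (tab i o) {γ} {ρ} {r} {σ} {z} holds small =
      run-weaken (+-monoʳ-≤ 8 (*-monoˡ-≤ _ (small i))) (λ p → p) (
      run-set then λ {σ₁} (σ₁r , same₁) →
      run-set then λ {σ₂} (σ₂q , same₂) →
      run-weaken ≤-refl (λ (_ , _ , τr , ≈σ) → τr , ≈σ)
        (run-while Inv (λ (_ , τq , _) → τq)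
          (λ (_ , τq , _) q≡nil → unary-suc≢nil (trans (sym τq) q≡nil))
          (λ {c} → body {c}) (lookup ρ i)
          ( ≤-refl
          , trans σ₂q (trans (set⇒≈ ≤-refl same₁ _ (below i)) (stored i))
          , cong (listTo (lookup ρ i) f) (trans (same₂ r r≢1+r) σ₁r)
          , ≈-trans (set⇒≈ (n≤1+n r) same₂) (set⇒≈ ≤-refl same₁))))
      where
      open Holds holds
      f : ℕ → Tree
      f c = outVal entry o (c ∷ ρ)
      Inv : ℕ → Store → Set
      Inv c τ = c ≤ lookup ρ i × τ (suc r) ≡ unary c ×
        listTo c f (τ r) ≡ listTo (lookup ρ i) f nil × τ ≈[ r ] σ
      body : ∀ {c τ} → Inv (suc c) τ → Run _ τ _ (Inv c)
      body {c} {τ} (c<b , τq , τr , τ≈) =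
        run-set then λ {τ₁} (τ₁q , same₁) →
        let τ₁≈ : τ₁ ≈[ suc r ] τ
            τ₁≈ = set⇒≈ ≤-refl same₁
            τ₁q′ : τ₁ (suc r) ≡ unary c
            τ₁q′ = trans τ₁q (cong right τq)
            small′ : Small (c ∷ ρ) z
            small′ = Small-∷ (≤-trans (<⇒≤ c<b) (small i)) small
        in run-compileOut o (Holds-∷ τ₁q′ (Holds-≤ (n≤1+n r)
             (Holds-≈ (≈-trans (≈-≤ (n≤1+n r) τ₁≈) τ≈) holds))) small′ then λ {τ₂} (τ₂v , τ₂≈) →
        run-weaken ≤-refl
          (λ (υr , same) →
              <⇒≤ c<b
            , trans (same (suc r) (r≢1+r ∘ sym)) (trans (τ₂≈ (suc r) ≤-refl) τ₁q′)
            , trans (cong (listTo c f) (trans υr (cong₂ _∙_ τ₂v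
                (trans (τ₂≈ r (n≤1+n (suc r))) (τ₁≈ r ≤-refl))))) τr
            , ≈-trans (set⇒≈ ≤-refl same)
                (≈-trans (≈-≤ (≤-trans (n≤1+n r) (n≤1+n (suc r))) τ₂≈) (≈-trans (≈-≤ (n≤1+n r) τ₁≈) τ≈)))
          run-set

  -- Variable 0 of the compiled expression is the number of rows of the input, variable 1 is K.
  program : Out 2 → ℕ → Cmd
  program o K =
    1 := nil ⨾ 2 := var 0 ⨾
    (while var 2 loop (1 := cons nil (var 1) ⨾ 2 := tl (var 2))) ⨾
    2 := unaryExp K ⨾ compileOut o (1 ∷ 2 ∷ []) 3 ⨾ 0 := var 3

  programTime : Out 2 → Bound
  programTime o = con 13 ⊞ arg ⊠ con 10 ⊞ (con 2 ⊞ arg ⊠ con 2) ⊞ outTime o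

  run-length : ∀ xs {σ} → σ 2 ≡ encodeList xs → σ 1 ≡ nil →
    Run (while var 2 loop (1 := cons nil (var 1) ⨾ 2 := tl (var 2))) σ (2 + length xs * 10)
        (λ τ → τ 1 ≡ unary (length xs) × τ 0 ≡ σ 0)
  run-length xs {σ} σ2 σ1 =
    run-weaken ≤-refl (λ (_ , _ , _ , a , τ1 , a≡ , τ0) → trans τ1 (cong unary (trans (sym (+-identityʳ a)) a≡)) , τ0)
      (run-while Inv (λ { ([] , refl , τ2 , _) → τ2 })
        (λ { (_ ∷ _ , _ , τ2 , _) τ2≡nil → contradiction (trans (sym τ2) τ2≡nil) λ () })
        body (length xs) (xs , refl , σ2 , 0 , σ1 , refl , refl))
    where
    Inv : ℕ → Store → Set
    Inv c τ = ∃[ ys ] length ys ≡ c × τ 2 ≡ encodeList ys ×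
      ∃[ a ] τ 1 ≡ unary a × a + c ≡ length xs × τ 0 ≡ σ 0
    body : ∀ {c τ} → Inv (suc c) τ → Run _ τ _ (Inv c)
    body {c} (y ∷ ys , refl , τ2 , a , τ1 , a≡ , τ0) =
      run-set then λ (υ1 , same₁) →
      run-weaken ≤-refl
        (λ (ω2 , same₂) → ys , refl , trans ω2 (cong right (trans (same₁ 2 λ ()) τ2))
          , suc a , trans (same₂ 1 λ ()) (trans υ1 (cong (nil ∙_) τ1)) , trans (sym (+-suc a c)) a≡
          , trans (same₂ 0 λ ()) (trans (same₁ 0 λ ()) τ0))
        run-set

  run-program : ∀ o K xs (entry : ℕ → ℕ → ℕ) → (∀ i j → entry i j ≤ 1) →
    (∀ i j → left (drop j (left (drop i (encodeList xs)))) ≡ unary (entry i j)) →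
    Run (program o K) (initial (encodeList xs)) (at (programTime o) (length xs + K + 2))
        (λ τ → τ 0 ≡ outVal entry o (length xs ∷ K ∷ []))
  run-program o K xs entry entry≤1 entry≡ = run-weaken bound (λ p → p) (
    run-set then λ {σ₁} (σ₁1 , same₁) →
    run-set then λ {σ₂} (σ₂2 , same₂) →
    run-length xs (trans σ₂2 (same₁ 0 λ ())) (trans (same₂ 1 λ ()) σ₁1) then λ {σ₃} (σ₃1 , σ₃0) →
    run-set then λ {σ₄} (σ₄2 , same₄) →
    Correct.run-compileOut M entry entry≤1 entry≡ o {γ = 1 ∷ 2 ∷ []} {ρ = length xs ∷ K ∷ []}
      (record
        { matrix = trans (same₄ 0 λ ()) (trans σ₃0 (trans (same₂ 0 λ ()) (same₁ 0 λ ())))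
        ; 0<r    = s≤s z≤n
        ; below  = λ { zero → s≤s (s≤s z≤n) ; (suc zero) → s≤s (s≤s (s≤s z≤n)) }
        ; stored = λ { zero → trans (same₄ 1 λ ()) σ₃1 ; (suc zero) → trans σ₄2 (eval-unaryExp K σ₃) }
        })
      (λ { zero → n≤z ; (suc zero) → K≤z }) then λ {σ₅} (σ₅3 , _) →
    run-weaken ≤-refl (λ (τ0 , _) → trans τ0 σ₅3) run-set)
    where
    M = encodeList xs
    n = length xs
    -- The 2 makes the argument large enough for `at≤^`.
    z = n + K + 2
    T = at (outTime o) z
    n≤z : n ≤ z
    n≤z = ≤-trans (m≤m+n n K) (m≤m+n _ 2)
    K≤z : K ≤ z
    K≤z = ≤-trans (m≤n+m K n) (m≤m+n _ 2)
    lemma : ∀ a b t → 3 + (3 + (1 + (2 + a) + (1 + (1 + (1 + b)) + (1 + t + 2)))) ≡ 13 + a + (2 + b) + t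
    lemma = solve-∀
    open ≤-Reasoning
    bound : 3 + (3 + (1 + (2 + n * 10) + (1 + (1 + expTime (unaryExp K)) + (1 + T + 2))))
            ≤ 13 + z * 10 + (2 + z * 2) + T
    bound = begin
      3 + (3 + (1 + (2 + n * 10) + (1 + (1 + expTime (unaryExp K)) + (1 + T + 2))))
        ≡⟨ cong (λ k → 3 + (3 + (1 + (2 + n * 10) + (1 + (1 + k) + (1 + T + 2))))) (expTime-unaryExp K) ⟩
      3 + (3 + (1 + (2 + n * 10) + (1 + (1 + (1 + 2 * K)) + (1 + T + 2))))
        ≡⟨ lemma (n * 10) (2 * K) T ⟩
      13 + n * 10 + (2 + 2 * K) + T
        ≤⟨ +-monoˡ-≤ T (+-mono-≤ (+-monoʳ-≤ 13 (*-monoˡ-≤ 10 n≤z))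
             (+-monoʳ-≤ 2 (≤-trans (≤-reflexive (*-comm 2 K)) (*-monoˡ-≤ 2 K≤z)))) ⟩
      13 + z * 10 + (2 + z * 2) + T ∎

-- The tests as compiled expressions, and their values on an encoded matrix.

module Implementation where
  open Sums
  open Counting
  open Atoms
  open While
  open import Data.Bool.Base using (Bool; true; false; not; _∧_; _∨_; _xor_)
  open import Data.Fin.Base using (Fin; zero; suc; toℕ)
  open import Data.Fin.Properties using (toℕ-injective) renaming (_≟_ to _≟ᶠ_)
  open import Data.List.Base using (List; []; _∷_; length; tabulate)
  open import Data.List.Properties using (length-tabulate)
  open import Data.Nat.Base using (ℕ; zero; suc; _+_; _*_; _∸_; _≤_; z≤n)
  open import Data.Nat.Properties
  open import Data.Vec.Base using (Vec; []; _∷_; lookup)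
  open import Function.Base using (_∘_)
  open import Relation.Binary.PropositionalEquality
  open import Relation.Nullary.Decidable using (yes; no)
  open import Relation.Nullary.Negation using (contradiction)

  notE : ∀ {s} → Expr s → Expr s
  notE e = lit 1 ⊖ e

  -- On 0/1 values 1 ∸ (1 ∸ (p + q)) is the disjunction.
  andE orE leE xorE : ∀ {s} → Expr s → Expr s → Expr s
  andE e f = notE (notE e ⊕ notE f)
  orE  e f = notE (notE (e ⊕ f))
  leE  e f = notE (e ⊖ f)
  xorE e f = (e ⊖ f) ⊕ (f ⊖ e)

  times : ∀ {s} → ℕ → Expr s → Expr s
  times zero    e = lit 0
  times (suc k) e = e ⊕ times k e

  eqE clE : ∀ {s} → Fin s → Fin s → Expr s
  eqE i j = notE (xorE (idx i) (idx j))
  clE i j = orE (adj i j) (eqE i j)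

  degE : ∀ {s} → Fin s → Fin s → Expr s
  degE N u = sumOver N (clE (suc u) zero)

  agreeE nearE atomE : ∀ {s} → Fin s → Fin s → Fin s → Expr s
  cleanE : ∀ {s} → Fin s → Fin s → Expr s
  agreeE N v u = leE (times 36 (sumOver N (xorE (clE (suc v) zero) (clE (suc u) zero)))) (degE N v)
  cleanE N v = leE (times 36 (sumOver N (andE (clE (suc v) zero) (notE (agreeE (suc N) (suc v) zero))))) (degE N v)
  nearE N u v = notE (leE (times 4 (sumOver N (andE (clE (suc u) zero) (clE (suc v) zero)))) (degE N u ⊕ degE N v))
  atomE N u v = orE (eqE u v) (andE (cleanE N u) (andE (cleanE N v) (nearE N u v)))

  -- `Expr` has no product, so multiplication by the variable `K` is a sum of `K` equal terms. The
  -- three innermost variables are the middle vertex, the index of that sum, and the threshold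
  -- vertex.
  walkE : ∀ {s} → Fin s → Fin s → Fin s → Expr (suc (suc (suc s)))
  walkE N u v = andE (andE (clE (suc (suc (suc u))) zero) (clE (suc (suc (suc v))) zero))
    (leE (degE (suc (suc (suc N))) zero) (degE (suc (suc (suc N))) (suc (suc zero))))

  linkedE admE : ∀ {s} → Fin s → Fin s → Fin s → Fin s → Expr s
  linkedE N K u v = leE (lit 1)
    (sumOver N (leE (degE (suc N) zero) (sumOver (suc K) (sumOver (suc (suc N)) (walkE N u v)))))
  admE N K u v = andE (notE (eqE u v)) (andE (notE (andE (cleanE N u) (cleanE N v))) (linkedE N K u v))

  scheme : Out 2
  scheme = pair (matrix (atomE (suc (suc zero)) (suc zero) zero))
                (matrix (admE (suc (suc zero)) (suc (suc (suc zero))) (suc zero) zero))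
    where
    matrix : Expr 4 → Out 2
    matrix e = tab zero (tab (suc zero) (cell e))

  -- `sumTo` peels off the top index, sums over `Fin` the bottom one.
  sumTo-front : ∀ c f → sumTo (suc c) f ≡ f 0 + sumTo c (f ∘ suc)
  sumTo-front zero    f = refl
  sumTo-front (suc c) f = begin
    f (suc c) + sumTo (suc c) f                 ≡⟨ cong (f (suc c) +_) (sumTo-front c f) ⟩
    f (suc c) + (f 0 + sumTo c (f ∘ suc))       ≡⟨ +-assoc (f (suc c)) (f 0) _ ⟨
    f (suc c) + f 0 + sumTo c (f ∘ suc)         ≡⟨ cong (_+ sumTo c (f ∘ suc)) (+-comm (f (suc c)) (f 0)) ⟩
    f 0 + f (suc c) + sumTo c (f ∘ suc)         ≡⟨ +-assoc (f 0) (f (suc c)) _ ⟩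
    f 0 + (f (suc c) + sumTo c (f ∘ suc))       ∎
    where open ≡-Reasoning

  sumTo≡sum : ∀ {n} {f : ℕ → ℕ} {g : Fin n → ℕ} → (∀ u → f (toℕ u) ≡ g u) → sumTo n f ≡ sum g
  sumTo≡sum {zero} {g = g} h = sym (sum-zero {f = g} λ ())
  sumTo≡sum {suc n} {f} {g} h =
    trans (sumTo-front n f) (trans (cong₂ _+_ (h zero) (sumTo≡sum (h ∘ suc))) (sym (sum-suc g)))

  sumTo-const : ∀ c {f x} → (∀ i → f i ≡ x) → sumTo c f ≡ c * x
  sumTo-const zero    h = refl
  sumTo-const (suc c) h = cong₂ _+_ (h c) (sumTo-const c h)

  listTo-front : ∀ c f t → listTo (suc c) f t ≡ f 0 ∙ listTo c (f ∘ suc) t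
  listTo-front zero    f t = refl
  listTo-front (suc c) f t = listTo-front c f (f (suc c) ∙ t)

  listTo≡tabulate : ∀ {n} {f : ℕ → Tree} {g : Fin n → Tree} → (∀ u → f (toℕ u) ≡ g u) →
                    listTo n f nil ≡ encodeList (tabulate g)
  listTo≡tabulate {zero}  h = refl
  listTo≡tabulate {suc n} {f} h =
    trans (listTo-front n f nil) (cong₂ _∙_ (h zero) (listTo≡tabulate (h ∘ suc)))

  le-val : ∀ p q → 1 ∸ (p ∸ q) ≡ ⟨ le p q ⟩
  le-val p q with le p q in eq
  ... | true  rewrite m≤n⇒m∸n≡0 (le⇒≤ {p} {q} eq) = refl
  ... | false with p ∸ q | m<n⇒0<n∸m (not-le⇒> {p} {q} eq)
  ...   | suc d | _ = 0∸n≡0 d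

  val-not : ∀ {p b} → p ≡ ⟨ b ⟩ → 1 ∸ p ≡ ⟨ not b ⟩
  val-not {b = true}  refl = refl
  val-not {b = false} refl = refl

  val-and : ∀ {p q b c} → p ≡ ⟨ b ⟩ → q ≡ ⟨ c ⟩ → 1 ∸ ((1 ∸ p) + (1 ∸ q)) ≡ ⟨ b ∧ c ⟩
  val-and {b = true}  {true}  refl refl = refl
  val-and {b = true}  {false} refl refl = refl
  val-and {b = false} {true}  refl refl = refl
  val-and {b = false} {false} refl refl = refl

  val-or : ∀ {p q b c} → p ≡ ⟨ b ⟩ → q ≡ ⟨ c ⟩ → 1 ∸ (1 ∸ (p + q)) ≡ ⟨ b ∨ c ⟩
  val-or {b = true}  {true}  refl refl = refl
  val-or {b = true}  {false} refl refl = refl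
  val-or {b = false} {true}  refl refl = refl
  val-or {b = false} {false} refl refl = refl

  val-xor : ∀ {p q b c} → p ≡ ⟨ b ⟩ → q ≡ ⟨ c ⟩ → (p ∸ q) + (q ∸ p) ≡ ⟨ b xor c ⟩
  val-xor {b = true}  {true}  refl refl = refl
  val-xor {b = true}  {false} refl refl = refl
  val-xor {b = false} {true}  refl refl = refl
  val-xor {b = false} {false} refl refl = refl

  val-le : ∀ {p q p′ q′} → p ≡ p′ → q ≡ q′ → 1 ∸ (p ∸ q) ≡ ⟨ le p′ q′ ⟩
  val-le {p} {q} refl refl = le-val p q

  val-eq : ∀ {n} {p q} {u v : Fin n} → p ≡ toℕ u → q ≡ toℕ v → 1 ∸ ((p ∸ q) + (q ∸ p)) ≡ ⟨ u == v ⟩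
  val-eq {u = u} {v} refl refl with u ≟ᶠ v
  ... | yes refl = cong (λ d → 1 ∸ (d + d)) (n∸n≡0 (toℕ u))
  ... | no u≢v with toℕ u ∸ toℕ v in uv | toℕ v ∸ toℕ u in vu
  ...   | zero  | zero  = contradiction (toℕ-injective (≤-antisym (m∸n≡0⇒m≤n uv) (m∸n≡0⇒m≤n vu))) u≢v
  ...   | zero  | suc d = 0∸n≡0 d
  ...   | suc d | e     = 0∸n≡0 (d + e)

  module Semantics {n} (A : Fin n → Fin n → Bool) (K : ℕ) (entry : ℕ → ℕ → ℕ)
                   (entry≡ : ∀ u v → entry (toℕ u) (toℕ v) ≡ ⟨ A u v ⟩) where

    a : Fin n → Fin n → Bool
    a u v = A u v ∨ (u == v)

    open Scheme a K

    private
      V : ∀ {s} → Expr s → Vec ℕ s → ℕ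
      V = val entry

    val-times : ∀ {s} (ρ : Vec ℕ s) k (e : Expr s) {x} → V e ρ ≡ x → V (times k e) ρ ≡ k * x
    val-times ρ zero    e eq = refl
    val-times ρ (suc k) e eq = cong₂ _+_ eq (val-times ρ k e eq)

    val-cl : ∀ {s} (ρ : Vec ℕ s) i j {u v} → lookup ρ i ≡ toℕ u → lookup ρ j ≡ toℕ v →
             V (clE i j) ρ ≡ ⟨ a u v ⟩
    val-cl ρ i j {u} {v} p q = val-or (trans (cong₂ entry p q) (entry≡ u v)) (val-eq p q)

    val-sum : ∀ {s} (ρ : Vec ℕ s) N e {g : Fin n → ℕ} → lookup ρ N ≡ n →
              (∀ w → V e (toℕ w ∷ ρ) ≡ g w) → V (sumOver N e) ρ ≡ sum g
    val-sum ρ N e N≡ h = trans (cong (λ k → sumTo k (λ c → V e (c ∷ ρ))) N≡) (sumTo≡sum h)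

    module _ {s} (ρ : Vec ℕ s) (N : Fin s) (N≡ : lookup ρ N ≡ n) where
      val-deg : ∀ i {u} → lookup ρ i ≡ toℕ u → V (degE N i) ρ ≡ deg u
      val-deg i p = val-sum ρ N (clE (suc i) zero) N≡ λ w → val-cl (toℕ w ∷ ρ) (suc i) zero p refl

      val-agree : ∀ i j {v u} → lookup ρ i ≡ toℕ v → lookup ρ j ≡ toℕ u → V (agreeE N i j) ρ ≡ ⟨ agree v u ⟩
      val-agree i j p q = val-le (val-times ρ 36 (sumOver N (xorE (clE (suc i) zero) (clE (suc j) zero)))
        (val-sum ρ N (xorE (clE (suc i) zero) (clE (suc j) zero)) N≡ λ w →
          val-xor (val-cl (toℕ w ∷ ρ) (suc i) zero p refl) (val-cl (toℕ w ∷ ρ) (suc j) zero q refl)))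
        (val-deg i p)

    module _ {s} (ρ : Vec ℕ s) (N : Fin s) (N≡ : lookup ρ N ≡ n) where
      val-clean : ∀ i {v} → lookup ρ i ≡ toℕ v → V (cleanE N i) ρ ≡ ⟨ clean v ⟩
      val-clean i p = val-le (val-times ρ 36 (sumOver N disagree) (val-sum ρ N disagree N≡ λ w →
        val-and (val-cl (toℕ w ∷ ρ) (suc i) zero p refl)
                (val-not (val-agree (toℕ w ∷ ρ) (suc N) N≡ (suc i) zero p refl)))) (val-deg ρ N N≡ i p)
        where
        disagree : Expr (suc s)
        disagree = andE (clE (suc i) zero) (notE (agreeE (suc N) (suc i) zero))

      val-near : ∀ i j {u v} → lookup ρ i ≡ toℕ u → lookup ρ j ≡ toℕ v → V (nearE N i j) ρ ≡ ⟨ near u v ⟩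
      val-near i j p q = val-not (val-le (val-times ρ 4 (sumOver N both) (val-sum ρ N both N≡ λ w →
        val-and (val-cl (toℕ w ∷ ρ) (suc i) zero p refl) (val-cl (toℕ w ∷ ρ) (suc j) zero q refl)))
        (cong₂ _+_ (val-deg ρ N N≡ i p) (val-deg ρ N N≡ j q)))
        where
        both : Expr (suc s)
        both = andE (clE (suc i) zero) (clE (suc j) zero)

      val-atom : ∀ i j {u v} → lookup ρ i ≡ toℕ u → lookup ρ j ≡ toℕ v → V (atomE N i j) ρ ≡ ⟨ atom u v ⟩
      val-atom i j p q = val-or (val-eq p q) (val-and (val-clean i p) (val-and (val-clean j q) (val-near i j p q)))

      val-linked : ∀ k i j {u v} → lookup ρ k ≡ K → lookup ρ i ≡ toℕ u → lookup ρ j ≡ toℕ v →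
                   V (linkedE N k i j) ρ ≡ ⟨ linked u v ⟩
      val-linked k i j {u} {v} K≡ p q = val-le refl (val-sum ρ N reach N≡ λ x →
        val-le (val-deg (toℕ x ∷ ρ) (suc N) N≡ zero refl)
          (trans (sumTo-const (lookup ρ k) λ c → val-sum (c ∷ toℕ x ∷ ρ) (suc (suc N)) (walkE N i j) N≡ (walk c x))
                 (cong (_* below x) K≡)))
        where
        reach : Expr (suc s)
        reach = leE (degE (suc N) zero) (sumOver (suc k) (sumOver (suc (suc N)) (walkE N i j)))
        below : Fin n → ℕ
        below x = # λ w → (a u w ∧ a v w) ∧ le (deg w) (deg x)
        walk : ∀ c x w → V (walkE N i j) (toℕ w ∷ c ∷ toℕ x ∷ ρ) ≡ ⟨ (a u w ∧ a v w) ∧ le (deg w) (deg x) ⟩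
        walk c x w = val-and (val-and (val-cl ρ′ (suc (suc (suc i))) zero p refl)
                                      (val-cl ρ′ (suc (suc (suc j))) zero q refl))
                             (val-le (val-deg ρ′ (suc (suc (suc N))) N≡ zero refl)
                                     (val-deg ρ′ (suc (suc (suc N))) N≡ (suc (suc zero)) refl))
          where
          ρ′ : Vec ℕ (suc (suc (suc s)))
          ρ′ = toℕ w ∷ c ∷ toℕ x ∷ ρ

      val-adm : ∀ k i j {u v} → lookup ρ k ≡ K → lookup ρ i ≡ toℕ u → lookup ρ j ≡ toℕ v →
                V (admE N k i j) ρ ≡ ⟨ adm u v ⟩
      val-adm k i j K≡ p q = val-and (val-not (val-eq p q))
        (val-and (val-not (val-and (val-clean i p) (val-clean j q))) (val-linked k i j K≡ p q))

    boolMatrix : (Fin n → Fin n → Bool) → Tree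
    boolMatrix f = encodeList (tabulate λ u → encodeList (tabulate λ v → encodeBool (f u v)))

    unary⟨⟩ : ∀ b → unary ⟨ b ⟩ ≡ encodeBool b
    unary⟨⟩ true  = refl
    unary⟨⟩ false = refl

    outVal-scheme : outVal entry scheme (n ∷ K ∷ []) ≡ boolMatrix atom ∙ boolMatrix adm
    outVal-scheme = cong₂ _∙_
      (listTo≡tabulate λ u → listTo≡tabulate λ v →
        trans (cong unary (val-atom (toℕ v ∷ toℕ u ∷ n ∷ K ∷ []) (suc (suc zero)) refl (suc zero) zero refl refl))
              (unary⟨⟩ (atom u v)))
      (listTo≡tabulate λ u → listTo≡tabulate λ v →
        trans (cong unary (val-adm (toℕ v ∷ toℕ u ∷ n ∷ K ∷ []) (suc (suc zero)) refl
                            (suc (suc (suc zero))) (suc zero) zero refl refl refl))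
              (unary⟨⟩ (adm u v)))

  bit : Tree → ℕ
  bit nil     = 0
  bit (_ ∙ _) = 1

  bit≤1 : ∀ t → bit t ≤ 1
  bit≤1 nil     = z≤n
  bit≤1 (_ ∙ _) = ≤-refl

  left-drop-nil : ∀ i → left (drop i nil) ≡ nil
  left-drop-nil zero    = refl
  left-drop-nil (suc i) = left-drop-nil i

  left-drop-tabulate : ∀ {n} (f : Fin n → Tree) u → left (drop (toℕ u) (encodeList (tabulate f))) ≡ f u
  left-drop-tabulate f zero    = refl
  left-drop-tabulate f (suc u) = left-drop-tabulate (f ∘ suc) u

  -- Covers indices beyond the list as well, where `nil` is read; matrix lookups are thus bits
  -- without any range condition.
  left-drop-all : ∀ {n} (P : Tree → Set) (f : Fin n → Tree) → P nil → (∀ u → P (f u)) →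
                  ∀ i → P (left (drop i (encodeList (tabulate f))))
  left-drop-all {zero}  P f Pnil Pf i       = subst P (sym (left-drop-nil i)) Pnil
  left-drop-all {suc n} P f Pnil Pf zero    = Pf zero
  left-drop-all {suc n} P f Pnil Pf (suc i) = left-drop-all P (f ∘ suc) Pnil (Pf ∘ suc) i

  bit-encodeBool : ∀ b → bit (encodeBool b) ≡ ⟨ b ⟩
  bit-encodeBool true  = refl
  bit-encodeBool false = refl

  program-correct : ∀ {n} (A : Fin n → Fin n → Bool) (K : ℕ) →
    let M = encodeList (tabulate λ u → encodeList (tabulate λ v → encodeBool (A u v)))
        a = λ u v → A u v ∨ (u == v) in
    Run (program scheme K) (initial M) (at (programTime scheme) (n + K + 2))
        (λ τ → τ 0 ≡ encodeList (tabulate λ u → encodeList (tabulate λ v → encodeBool (Scheme.atom a K u v)))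
                   ∙ encodeList (tabulate λ u → encodeList (tabulate λ v → encodeBool (Scheme.adm a K u v))))
  program-correct {n} A K = run-weaken
    (≤-reflexive (cong (λ k → at (programTime scheme) (k + K + 2)) length≡))
    (λ τ0 → trans τ0 (trans (cong (λ k → outVal entry scheme (k ∷ K ∷ [])) length≡)
                            (Semantics.outVal-scheme A K entry entry≡)))
    (run-program scheme K rows entry (λ i j → bit≤1 (left (drop j (left (drop i M))))) isBit)
    where
    row : Fin n → Tree
    row u = encodeList (tabulate λ v → encodeBool (A u v))
    rows : List Tree
    rows = tabulate row
    M : Tree
    M = encodeList rows
    length≡ : length rows ≡ n
    length≡ = length-tabulate row
    entry : ℕ → ℕ → ℕ
    entry i j = bit (left (drop j (left (drop i M))))
    entry≡ : ∀ u v → entry (toℕ u) (toℕ v) ≡ ⟨ A u v ⟩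
    entry≡ u v = trans (cong (λ t → bit (left (drop (toℕ v) t))) (left-drop-tabulate row u))
      (trans (cong bit (left-drop-tabulate (λ v → encodeBool (A u v)) v)) (bit-encodeBool (A u v)))
    IsBit : Tree → Set
    IsBit t = t ≡ unary (bit t)
    isBit : ∀ i j → IsBit (left (drop j (left (drop i M))))
    isBit i j = left-drop-all (λ t → ∀ j → IsBit (left (drop j t))) row
      (λ j → subst IsBit (sym (left-drop-nil j)) refl)
      (λ u → left-drop-all IsBit (λ v → encodeBool (A u v)) refl λ v → encodeBool-bit (A u v)) i j
      where
      encodeBool-bit : ∀ b → IsBit (encodeBool b)
      encodeBool-bit true  = refl
      encodeBool-bit false = refl

-- From an instance to its preclustering and good clusterings.

module Graphs where
  open Sums
  open Counting
  open LocalSearch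
  open Atoms
  open AdmissiblePairs
  open import Data.Bool.Base using (Bool; true; false; not; _∧_; _∨_; _xor_)
  open import Data.Bool.Properties using (∧-zeroʳ; ∨-zeroʳ) renaming (_≟_ to _≟ᵇ_)
  open import Data.Fin.Base using (Fin; zero; suc)
  open import Data.Fin.Properties using (<-cmp) renaming (_≟_ to _≟ᶠ_; _<?_ to _<ᶠ?_)
  open import Data.List.Base using (List; []; _∷_; _++_; length; filter; map; tabulate; allFin; cartesianProduct)
  open import Data.List.Properties using (tabulate-cong)
  open import Data.Nat.Base using (ℕ; zero; suc; _+_; _*_; _≤_; NonZero)
  open import Data.Nat.Properties hiding (<-cmp)
  open import Data.Nat.Tactic.RingSolver using (solve-∀)
  open import Data.Product.Base using (Σ-syntax; ∃-syntax; _×_; _,_; proj₁; proj₂)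
  open import Data.Empty using (⊥)
  open import Data.Sum.Base using (_⊎_; inj₁; inj₂)
  open import Function.Base using (_∘_; id)
  open import Function.Bundles using (mk⇔)
  open import Relation.Binary.Core using (Rel)
  open import Relation.Binary.Definitions using (Decidable; tri<; tri≈; tri>)
  open import Relation.Binary.PropositionalEquality hiding (isDecEquivalence)
  import Relation.Binary.Structures
  open import Relation.Nullary.Decidable using (Dec; does; yes; no; does-⇔; dec-true; dec-false; from-yes)
  open import Relation.Nullary.Negation using (¬_; contradiction)
  open import Level using (0ℓ)

  total : ∀ {X : Set} → List X → (X → ℕ) → ℕ
  total []       f = 0
  total (x ∷ xs) f = f x + total xs f

  total-++ : ∀ {X : Set} (xs ys : List X) f → total (xs ++ ys) f ≡ total xs f + total ys f
  total-++ []       ys f = refl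
  total-++ (x ∷ xs) ys f = trans (cong (f x +_) (total-++ xs ys f)) (sym (+-assoc (f x) _ _))

  total-map : ∀ {X Y : Set} (g : X → Y) xs f → total (map g xs) f ≡ total xs (f ∘ g)
  total-map g []       f = refl
  total-map g (x ∷ xs) f = cong (f (g x) +_) (total-map g xs f)

  total-tabulate : ∀ {X : Set} {n} (g : Fin n → X) f → total (tabulate g) f ≡ sum (f ∘ g)
  total-tabulate {n = zero}  g f = sym (sum-zero {f = f ∘ g} λ ())
  total-tabulate {n = suc n} g f = trans (cong (f (g zero) +_) (total-tabulate (g ∘ suc) f)) (sym (sum-suc (f ∘ g)))

  total-product : ∀ {X Y : Set} (xs : List X) (ys : List Y) f →
                  total (cartesianProduct xs ys) f ≡ total xs λ x → total ys λ y → f (x , y)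
  total-product []       ys f = refl
  total-product (x ∷ xs) ys f = trans (total-++ (map (x ,_) ys) _ f)
    (cong₂ _+_ (total-map (x ,_) ys f) (total-product xs ys f))

  length-filter² : ∀ {X : Set} {P Q : X → Set} (P? : ∀ x → Dec (P x)) (Q? : ∀ x → Dec (Q x)) xs →
                   length (filter Q? (filter P? xs)) ≡ total xs λ x → ⟨ does (P? x) ∧ does (Q? x) ⟩
  length-filter² P? Q? [] = refl
  length-filter² P? Q? (x ∷ xs) with does (P? x)
  ... | false = length-filter² P? Q? xs
  ... | true with does (Q? x)
  ...   | false = length-filter² P? Q? xs
  ...   | true  = cong suc (length-filter² P? Q? xs)

  module _ {n} {R : Rel (Fin n) 0ℓ} (R? : Decidable R) where
    private
      r : Fin n → Fin n → Bool
      r u v = does (R? u v)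

    countPairs≡ : countPairs R? ≡ ∑∑ λ u v → ⟨ does (u <ᶠ? v) ∧ r u v ⟩
    countPairs≡ = begin
      countPairs R?
        ≡⟨ length-filter² (λ (u , v) → u <ᶠ? v) (λ (u , v) → R? u v) (cartesianProduct (allFin n) (allFin n)) ⟩
      total (cartesianProduct (allFin n) (allFin n)) f
        ≡⟨ total-product (allFin n) (allFin n) f ⟩
      total (allFin n) (λ u → total (allFin n) λ v → f (u , v))
        ≡⟨ total-tabulate id _ ⟩
      sum (λ u → total (allFin n) λ v → f (u , v))
        ≡⟨ sum-cong (λ u → total-tabulate id λ v → f (u , v)) ⟩
      ∑∑ (λ u v → f (u , v)) ∎
      where
      open ≡-Reasoning
      f : Fin n × Fin n → ℕ
      f (u , v) = ⟨ does (u <ᶠ? v) ∧ r u v ⟩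

    -- The analysis sums over ordered pairs, while sizes and costs count each pair once.
    2*countPairs≡ : (∀ u v → r u v ≡ r v u) → (∀ u → r u u ≡ false) →
                    2 * countPairs R? ≡ ∑∑ λ u v → ⟨ r u v ⟩
    2*countPairs≡ r-sym r-irrefl = begin
      2 * countPairs R?                        ≡⟨ cong (2 *_) countPairs≡ ⟩
      ∑∑ f + (∑∑ f + 0)                        ≡⟨ cong (∑∑ f +_) (trans (+-identityʳ (∑∑ f)) (sum-comm f)) ⟩
      ∑∑ f + ∑∑ (λ u v → f v u)                ≡⟨ ∑∑-+ f (λ u v → f v u) ⟨
      ∑∑ (λ u v → f u v + f v u)               ≡⟨ ∑∑-cong merge ⟩
      ∑∑ (λ u v → ⟨ r u v ⟩)                   ∎
      where
      open ≡-Reasoning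
      f : Fin n → Fin n → ℕ
      f u v = ⟨ does (u <ᶠ? v) ∧ r u v ⟩
      merge : ∀ u v → f u v + f v u ≡ ⟨ r u v ⟩
      merge u v with <-cmp u v
      ... | tri< u<v _ v≮u rewrite dec-true (u <ᶠ? v) u<v | dec-false (v <ᶠ? u) v≮u = +-identityʳ _
      ... | tri> u≮v _ v<u rewrite dec-false (u <ᶠ? v) u≮v | dec-true (v <ᶠ? u) v<u = cong ⟨_⟩ (r-sym v u)
      ... | tri≈ u≮v refl _ rewrite dec-false (u <ᶠ? u) u≮v | r-irrefl u = refl

  ∨-split : ∀ b {c} → b ∨ c ≡ true → b ≡ true ⊎ c ≡ true
  ∨-split true  _  = inj₁ refl
  ∨-split false eq = inj₂ eq

  ∧-split : ∀ b {c} → b ∧ c ≡ true → b ≡ true × c ≡ true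
  ∧-split true eq = refl , eq

  does-true : ∀ {P : Set} (P? : Dec P) → does P? ≡ true → P
  does-true (yes p) _ = p

  partition⇒equiv : ∀ {n} (C : Partition n) → IsEquiv λ u v → does (Partition.same? C u v)
  partition⇒equiv C = record
    { reflexive = λ u → dec-true (same? u u) S.refl
    ; symmetric = λ u w → does-⇔ (mk⇔ S.sym S.sym) (same? u w) (same? w u)
    ; class     = λ {u} {v} uv w → let Suv = does-true (same? u v) uv in
        does-⇔ (mk⇔ (S.trans (S.sym Suv)) (S.trans Suv)) (same? u w) (same? v w)
    }
    where
    open Partition C
    module S = Relation.Binary.Structures.IsDecEquivalence isDecEquivalence

  equiv⇒partition : ∀ {n} {s : Fin n → Fin n → Bool} → IsEquiv s → Partition n
  equiv⇒partition {s = s} eq = record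
    { Same = λ u v → s u v ≡ true
    ; isDecEquivalence = record
      { isEquivalence = record
        { refl  = λ {u} → reflexive u
        ; sym   = λ {u} {v} uv → trans (symmetric v u) uv
        ; trans = λ {u} {v} {w} uv vw → trans (class uv w) vw
        }
      ; _≟_ = λ u v → s u v ≟ᵇ true
      }
    }
    where open IsEquiv eq

  does-≟true : ∀ b → does (b ≟ᵇ true) ≡ b
  does-≟true true  = refl
  does-≟true false = refl

  module Graph {n} (I : Instance n) where
    open Instance I

    plus : Fin n → Fin n → Bool
    plus u v = does (plus? u v)

    a : Fin n → Fin n → Bool
    a u v = plus u v ∨ (u == v)

    plus-sym : ∀ u v → plus u v ≡ plus v u
    plus-sym u v = does-⇔ (mk⇔ (PairSet.sym E⁺) (PairSet.sym E⁺)) (plus? u v) (plus? v u)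

    plus-irrefl : ∀ u → plus u u ≡ false
    plus-irrefl u = dec-false (plus? u u) (PairSet.irrefl E⁺ refl)

    ==-sym : ∀ (u v : Fin n) → (u == v) ≡ (v == u)
    ==-sym u v = does-⇔ (mk⇔ sym sym) (u ≟ᶠ v) (v ≟ᶠ u)

    a-refl : ∀ u → a u u ≡ true
    a-refl u rewrite plus-irrefl u = ==-refl u

    a-sym : ∀ u v → a u v ≡ a v u
    a-sym u v = cong₂ _∨_ (plus-sym u v) (==-sym u v)

    -- With closed neighbourhoods the diagonal never disagrees, so the xor counts precisely the
    -- disagreements, in both orders.
    2*cost≡ : ∀ (C : Partition n) → 2 * cost I C ≡ ∑∑ λ u v → ⟨ a u v xor does (Partition.same? C u v) ⟩
    2*cost≡ C = begin
      2 * cost I C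
        ≡⟨ *-distribˡ-+ 2 (countPairs λ u v → plus? u v ×-dec ¬? (same? u v)) _ ⟩
      _
        ≡⟨ cong₂ _+_
             (2*countPairs≡ _ (λ u v → cong₂ (λ b c → b ∧ not c) (plus-sym u v) (symmetric u v))
                              (λ u → cong (_∧ not (s u u)) (plus-irrefl u)))
             (2*countPairs≡ _ (λ u v → cong₂ _∧_ (cong₂ (λ b c → not b ∧ not c) (==-sym u v) (plus-sym u v)) (symmetric u v))
                              (λ u → cong (λ b → (not b ∧ not (plus u u)) ∧ s u u) (==-refl u))) ⟩
      ∑∑ (λ u v → ⟨ plus u v ∧ not (s u v) ⟩) + ∑∑ (λ u v → ⟨ (not (u == v) ∧ not (plus u v)) ∧ s u v ⟩)
        ≡⟨ ∑∑-+ (λ u v → ⟨ plus u v ∧ not (s u v) ⟩) _ ⟨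
      ∑∑ (λ u v → ⟨ plus u v ∧ not (s u v) ⟩ + ⟨ (not (u == v) ∧ not (plus u v)) ∧ s u v ⟩)
        ≡⟨ ∑∑-cong merge ⟩
      ∑∑ (λ u v → ⟨ a u v xor s u v ⟩) ∎
      where
      open ≡-Reasoning
      open import Relation.Nullary.Decidable using (¬?; _×-dec_)
      open Partition C
      s : Fin n → Fin n → Bool
      s u v = does (same? u v)
      open IsEquiv (partition⇒equiv C)
      merge : ∀ u v → ⟨ plus u v ∧ not (s u v) ⟩ + ⟨ (not (u == v) ∧ not (plus u v)) ∧ s u v ⟩ ≡ ⟨ a u v xor s u v ⟩
      merge u v = go (u ≟ᶠ v)
        where
        cases : ∀ p q → ⟨ p ∧ not q ⟩ + ⟨ (not false ∧ not p) ∧ q ⟩ ≡ ⟨ (p ∨ false) xor q ⟩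
        cases = from-yes (all-bool? λ p → all-bool? λ q →
          ⟨ p ∧ not q ⟩ + ⟨ (not false ∧ not p) ∧ q ⟩ ≟ ⟨ (p ∨ false) xor q ⟩)
        go : Dec (u ≡ v) → ⟨ plus u v ∧ not (s u v) ⟩ + ⟨ (not (u == v) ∧ not (plus u v)) ∧ s u v ⟩ ≡ ⟨ a u v xor s u v ⟩
        go (yes refl) rewrite plus-irrefl u | ==-refl u | reflexive u = refl
        go (no u≢v) rewrite ==-≢ u≢v = cases (plus u v) (s u v)

    module Precluster (m : ℕ) .{{_ : NonZero m}} where
      open Analysis a a-refl a-sym m public
      open Scheme a (k * k) public
      open Weighted a a-refl a-sym m public
      open Charging a a-refl a-sym (k * k) using (adm-sym; module Errors)

      Optimum : (Fin n → Fin n → Bool) → Set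
      Optimum s = IsEquiv s × LocallyOptimal s

      AtomShape : (Fin n → Fin n → Bool) → Fin n → Fin n → Set
      AtomShape s u v = u ≡ v ⊎ (clean u ≡ true × clean v ≡ true × s u v ≡ true)

      atom⇒shape : ∀ {s} → Optimum s → ∀ {u v} → atom u v ≡ true → AtomShape s u v
      atom⇒shape {s} (eq , opt) {u} {v} uv = go (∨-split (u == v) uv)
        where
        go : (u == v) ≡ true ⊎ clean u ∧ clean v ∧ near u v ≡ true → AtomShape s u v
        go (inj₁ e) = inj₁ (does-true (u ≟ᶠ v) e)
        go (inj₂ h) = let (cu , h′) = ∧-split (clean u) h
                          (cv , nr) = ∧-split (clean v) h′
                      in inj₂ (cu , cv , Structure.near⇒together eq opt cu cv nr)

      shape⇒atom : ∀ {s} → Optimum s → ∀ {u v} → AtomShape s u v → atom u v ≡ true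
      shape⇒atom _ {u} (inj₁ refl) = cong (_∨ (clean u ∧ clean u ∧ near u u)) (==-refl u)
      shape⇒atom (eq , opt) {u} {v} (inj₂ (cu , cv , uv)) =
        trans (cong ((u == v) ∨_) (cong₂ _∧_ cu (cong₂ _∧_ cv (Structure.together⇒near eq opt cu cv uv))))
              (∨-zeroʳ (u == v))

      -- The single cluster is merely a starting point; the optimum reached from it supplies the
      -- transitivity of `atoms`.
      someOptimum : ∃[ s ] Optimum s
      someOptimum = let (s , eq , opt , _) = search (λ _ _ → true) trivial in s , eq , opt
        where
        trivial : IsEquiv {n} λ _ _ → true
        trivial = record { reflexive = λ _ → refl ; symmetric = λ _ _ → refl ; class = λ _ _ → refl }

      atoms : Partition n
      atoms = go someOptimum
        where
        go : ∃[ s ] Optimum s → Partition n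
        go (s , o@(eq , _)) = record
          { Same = λ u v → atom u v ≡ true
          ; isDecEquivalence = record
            { isEquivalence = record
              { refl  = λ {u} → shape⇒atom o {u} (inj₁ refl)
              ; sym   = λ {u} {v} uv → shape⇒atom o {v} {u} (shape-sym (atom⇒shape o {u} {v} uv))
              ; trans = λ {u} {v} {w} uv vw →
                  shape⇒atom o {u} {w} (shape-trans (atom⇒shape o {u} {v} uv) (atom⇒shape o {v} {w} vw))
              }
            ; _≟_ = λ u v → atom u v ≟ᵇ true
            }
          }
          where
          open IsEquiv eq
          shape-sym : ∀ {u v} → AtomShape s u v → AtomShape s v u
          shape-sym (inj₁ u≡v) = inj₁ (sym u≡v)
          shape-sym {u} {v} (inj₂ (cu , cv , uv)) = inj₂ (cv , cu , trans (symmetric v u) uv)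
          shape-trans : ∀ {u v w} → AtomShape s u v → AtomShape s v w → AtomShape s u w
          shape-trans (inj₁ refl) vw = vw
          shape-trans (inj₂ uv) (inj₁ refl) = inj₂ uv
          shape-trans {w = w} (inj₂ (cu , _ , uv)) (inj₂ (_ , cw , vw)) = inj₂ (cu , cw , trans (class uv w) vw)

      admissible : PairSet n
      admissible = record
        { Edge   = λ u v → adm u v ≡ true
        ; edge?  = λ u v → adm u v ≟ᵇ true
        ; sym    = λ {u} {v} uv → trans (adm-sym v u) uv
        ; irrefl = λ { {u} refl uu → contradiction (trans (sym uu) (adm-irrefl u)) λ () }
        }
        where
        adm-irrefl : ∀ u → adm u u ≡ false
        adm-irrefl u = cong (λ b → not b ∧ not (clean u ∧ clean u) ∧ linked u u) (==-refl u)

      adm⇒not-atom : ∀ {u v} → adm u v ≡ true → atom u v ≢ true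
      adm⇒not-atom {u} {v} uv-adm uv-atom =
        go (atom⇒shape {proj₁ someOptimum} (proj₂ someOptimum) {u} {v} uv-atom)
        where
        go : ¬ AtomShape (proj₁ someOptimum) u v
        go (inj₁ u≡v) = PairSet.irrefl admissible u≡v uv-adm
        go (inj₂ (cu , cv , _)) = contradiction (trans (sym uv-adm) not-adm) λ ()
          where
          not-adm : adm u v ≡ false
          not-adm = trans (cong₂ (λ b c → not (u == v) ∧ not (b ∧ c) ∧ linked u v) cu cv)
                          (∧-zeroʳ (not (u == v)))

      preclustered : Preclustered n
      preclustered = record
        { K                    = atoms
        ; Eadm                 = admissible
        ; admissible⇒different = λ {u} {v} → adm⇒not-atom {u} {v}
        }

      optimum-good : ∀ {s} (o : Optimum s) → Good preclustered (equiv⇒partition (proj₁ o))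
      optimum-good {s} o@(eq , opt) =
        (λ {u} {v} (u≢v , uv) → atomic u≢v (atom⇒shape o {u} {v} uv)) ,
        λ {u} {v} (u≢v , not-atomic , not-adm) uv → non-admissible u≢v not-atomic not-adm uv
        where
        open IsEquiv eq
        atomic : ∀ {u v} → u ≢ v → AtomShape s u v → s u v ≡ true
        atomic u≢v (inj₁ u≡v)          = contradiction u≡v u≢v
        atomic u≢v (inj₂ (_ , _ , uv)) = uv
        -- Two cluster mates that are both clean are near and form an atom; if one is unclean, they
        -- are linked and hence admissible.
        non-admissible : ∀ {u v} → u ≢ v → ¬ (u ≢ v × atom u v ≡ true) → adm u v ≢ true → s u v ≢ true
        non-admissible {u} {v} u≢v not-atomic not-adm uv = go (clean u) (clean v) refl refl
          where
          link : not (clean u ∧ clean v) ≡ true → adm u v ≡ true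
          link not-clean = cong₂ (λ b c → not b ∧ c) (==-≢ u≢v) (cong₂ _∧_ not-clean
            (Structure.together⇒linked eq opt (trans (symmetric v u) uv) u≢v))
          go : ∀ b c → clean u ≡ b → clean v ≡ c → ⊥
          go true  true  cu cv = not-atomic (u≢v , shape⇒atom o {u} {v} (inj₂ (cu , cv , uv)))
          go true  false cu cv = not-adm (link (cong₂ (λ b c → not (b ∧ c)) cu cv))
          go false c     cu cv = not-adm (link (cong (λ b → not (b ∧ clean v)) cu))

      mismatch≡2*cost : ∀ (C : Partition n) →
        sum (mismatch λ u v → does (Partition.same? C u v)) ≡ 2 * cost I C
      mismatch≡2*cost C = sym (2*cost≡ C)

      -- `weight` lies between `m` and `m + 1` times the mismatches, and the search from `C` never
      -- raises it.
      near-optimal : ∀ (C : Partition n) →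
        Σ[ C′ ∈ Partition n ] Good preclustered C′ × m * cost I C′ ≤ suc m * cost I C
      near-optimal C = go (search s₀ (partition⇒equiv C))
        where
        s₀ : Fin n → Fin n → Bool
        s₀ u v = does (Partition.same? C u v)
        go : Σ[ s ∈ (Fin n → Fin n → Bool) ] IsEquiv s × LocallyOptimal s × weight s ≤ weight s₀ →
             Σ[ C′ ∈ Partition n ] Good preclustered C′ × m * cost I C′ ≤ suc m * cost I C
        go (s , eq , opt , le) = C′ , optimum-good (eq , opt) , *-cancelˡ-≤ 2 (begin
          2 * (m * cost I C′)                   ≡⟨ swap m (cost I C′) ⟩
          m * (2 * cost I C′)                   ≡⟨ cong (m *_) (mismatch≡2*cost C′) ⟨
          m * sum (mismatch λ u v → does (Partition.same? C′ u v))
            ≡⟨ cong (m *_) (sum-cong λ u → Δ-congʳ (a u) λ v → does-≟true (s u v)) ⟩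
          m * sum (mismatch s)                  ≤⟨ weight-lower s ⟩
          weight s                              ≤⟨ le ⟩
          weight s₀                             ≤⟨ weight-upper s₀ ⟩
          suc m * sum (mismatch s₀)             ≡⟨ cong (suc m *_) (mismatch≡2*cost C) ⟩
          suc m * (2 * cost I C)                ≡⟨ swap (suc m) (cost I C) ⟨
          2 * (suc m * cost I C)                ∎)
          where
          open ≤-Reasoning
          C′ : Partition n
          C′ = equiv⇒partition eq
          swap : ∀ m c → 2 * (m * c) ≡ m * (2 * c)
          swap = solve-∀

      size-admissible : ∀ (C : Partition n) → size admissible ≤ k * k * (10656 * cost I C)
      size-admissible C = *-cancelˡ-≤ 2 (begin
        2 * size admissible
          ≡⟨ 2*countPairs≡ (λ u v → adm u v ≟ᵇ true)
               (λ u v → trans (does-≟true (adm u v)) (trans (adm-sym u v) (sym (does-≟true (adm v u)))))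
               (λ u → dec-false (adm u u ≟ᵇ true) (PairSet.irrefl admissible {u} refl)) ⟩
        ∑∑ (λ u v → ⟨ does (adm u v ≟ᵇ true) ⟩)
          ≡⟨ ∑∑-cong (λ u v → cong ⟨_⟩ (does-≟true (adm u v))) ⟩
        ∑∑ (λ u v → ⟨ adm u v ⟩)
          ≤⟨ Errors.adm-total (partition⇒equiv C) ⟩
        2 * (k * k * (5328 * sum (mismatch λ u v → does (Partition.same? C u v))))
          ≡⟨ cong (λ e → 2 * (k * k * (5328 * e))) (mismatch≡2*cost C) ⟩
        2 * (k * k * (5328 * (2 * cost I C)))
          ≡⟨ cong (λ e → 2 * (k * k * e)) (*-assoc 5328 2 (cost I C)) ⟨
        2 * (k * k * (10656 * cost I C)) ∎)
        where open ≤-Reasoning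

      encode-preclustered :
        encodeList (tabulate λ u → encodeList (tabulate λ v → encodeBool (atom u v))) ∙
        encodeList (tabulate λ u → encodeList (tabulate λ v → encodeBool (adm u v))) ≡
        encodePreclustered preclustered
      encode-preclustered = cong₂ _∙_ (matrix atom) (matrix adm)
        where
        matrix : ∀ f → encodeList (tabulate λ u → encodeList (tabulate λ v → encodeBool (f u v))) ≡
                       encodeMatrix (λ u v → f u v ≟ᵇ true)
        matrix f = cong encodeList (tabulate-cong λ u → cong encodeList (tabulate-cong λ v →
          cong encodeBool (sym (does-≟true (f u v)))))

-- Rational bounds and assembly of the theorem.

open Sums
open Counting
open Atoms
open While
open Implementation
open Graphs
open import Data.Empty using (⊥-elim-irr)
open import Data.Integer.Base as ℤ using (+_; +[1+_])
open import Data.Integer.Properties using (pos-*; drop‿+≤+)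
open import Data.List.Base using ([]; _∷_)
open import Data.Nat.Base as ℕ using (ℕ; zero; suc; NonZero) renaming (_^_ to _^ℕ_)
open import Data.Nat.DivMod using (m/n*n≤m; m%n<n; m≡m%n+[m/n]*n)
import Data.Nat.Properties as ℕ
open import Data.Nat.Tactic.RingSolver using (solve-∀)
open import Data.Product.Base using (Σ-syntax; _×_; _,_)
open import Data.Sum.Base using (inj₁; inj₂)
open import Data.Rational.Base using (ℚ; mkℚ; 0ℚ; 1ℚ; Positive; NonNegative; _+_; _*_; _≤_; toℚᵘ)
open import Data.Rational.Properties
open import Data.Rational.Solver using (module +-*-Solver)
import Data.Rational.Unnormalised.Base as ℚᵘ
import Data.Rational.Unnormalised.Properties as ℚᵘ
open import Relation.Binary.PropositionalEquality using (_≡_; refl; sym; trans; cong; cong₂; subst; subst₂)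
open +-*-Solver using (solve; _:+_; _:*_; con) renaming (_:=_ to _⊜_)

toℚᵘ-fromℕ : ∀ n → toℚᵘ (fromℕ n) ℚᵘ.≃ ℚᵘ.mkℚᵘ (+ n) 0
toℚᵘ-fromℕ n = toℚᵘ-fromℚᵘ (ℚᵘ.mkℚᵘ (+ n) 0)

fromℕ-+ : ∀ a b → fromℕ (a ℕ.+ b) ≡ fromℕ a + fromℕ b
fromℕ-+ a b = toℚᵘ-injective (begin-equality
  toℚᵘ (fromℕ (a ℕ.+ b))                    ≃⟨ toℚᵘ-fromℕ (a ℕ.+ b) ⟩
  ℚᵘ.mkℚᵘ (+ (a ℕ.+ b)) 0                   ≃⟨ ℚᵘ.*≡* (cong (ℤ._* + 1) (sym (cong₂ ℤ._+_ (ℤ.*-identityʳ (+ a)) (ℤ.*-identityʳ (+ b))))) ⟩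
  ℚᵘ.mkℚᵘ (+ a) 0 ℚᵘ.+ ℚᵘ.mkℚᵘ (+ b) 0      ≃⟨ ℚᵘ.+-cong (toℚᵘ-fromℕ a) (toℚᵘ-fromℕ b) ⟨
  toℚᵘ (fromℕ a) ℚᵘ.+ toℚᵘ (fromℕ b)        ≃⟨ toℚᵘ-homo-+ (fromℕ a) (fromℕ b) ⟨
  toℚᵘ (fromℕ a + fromℕ b)                  ∎)
  where
  open ℚᵘ.≤-Reasoning
  import Data.Integer.Properties as ℤ

fromℕ-* : ∀ a b → fromℕ (a ℕ.* b) ≡ fromℕ a * fromℕ b
fromℕ-* a b = toℚᵘ-injective (begin-equality
  toℚᵘ (fromℕ (a ℕ.* b))                    ≃⟨ toℚᵘ-fromℕ (a ℕ.* b) ⟩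
  ℚᵘ.mkℚᵘ (+ (a ℕ.* b)) 0                   ≃⟨ ℚᵘ.*≡* (cong (ℤ._* + 1) (pos-* a b)) ⟩
  ℚᵘ.mkℚᵘ (+ a) 0 ℚᵘ.* ℚᵘ.mkℚᵘ (+ b) 0      ≃⟨ ℚᵘ.*-cong (toℚᵘ-fromℕ a) (toℚᵘ-fromℕ b) ⟨
  toℚᵘ (fromℕ a) ℚᵘ.* toℚᵘ (fromℕ b)        ≃⟨ toℚᵘ-homo-* (fromℕ a) (fromℕ b) ⟨
  toℚᵘ (fromℕ a * fromℕ b)                  ∎)
  where open ℚᵘ.≤-Reasoning

fromℕ-nonNeg : ∀ n → NonNegative (fromℕ n)
fromℕ-nonNeg n = normalize-nonNeg n 1

fromℕ-pos : ∀ n .{{_ : NonZero n}} → Positive (fromℕ n)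
fromℕ-pos n = normalize-pos n 1

fromℕ-mono-≤ : ∀ {a b} → a ℕ.≤ b → fromℕ a ≤ fromℕ b
fromℕ-mono-≤ {a} {b} a≤b = begin
  fromℕ a                         ≡⟨ +-identityʳ (fromℕ a) ⟨
  fromℕ a + 0ℚ                    ≤⟨ +-monoʳ-≤ (fromℕ a) (nonNegative⁻¹ (fromℕ (b ℕ.∸ a)) {{fromℕ-nonNeg (b ℕ.∸ a)}}) ⟩
  fromℕ a + fromℕ (b ℕ.∸ a)       ≡⟨ fromℕ-+ a (b ℕ.∸ a) ⟨
  fromℕ (a ℕ.+ (b ℕ.∸ a))         ≡⟨ cong fromℕ (ℕ.m+[n∸m]≡n a≤b) ⟩
  fromℕ b                         ∎
  where open ≤-Reasoning

fromℕ-^ : ∀ n j → fromℕ (n ^ℕ j) ≡ fromℕ n ^ j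
fromℕ-^ n zero    = refl
fromℕ-^ n (suc j) = trans (fromℕ-* n (n ^ℕ j)) (cong (fromℕ n *_) (fromℕ-^ n j))

^-pos : ∀ y {{_ : Positive y}} j → Positive (y ^ j)
^-pos y zero    = fromℕ-pos 1
^-pos y (suc j) = pos*pos⇒pos y (y ^ j) {{^-pos y j}}

power-bound : ∀ m y {{_ : Positive y}} → fromℕ m ≤ fromℕ 2 * y →
              ∀ j → fromℕ (m ^ℕ j) ≤ fromℕ (2 ^ℕ j) * y ^ j
power-bound m y m≤2y zero    = ≤-refl
power-bound m y m≤2y (suc j) = begin
  fromℕ (m ℕ.* m ^ℕ j)                            ≡⟨ fromℕ-* m (m ^ℕ j) ⟩
  fromℕ m * fromℕ (m ^ℕ j)                        ≤⟨ *-monoˡ-≤-nonNeg (fromℕ m) {{fromℕ-nonNeg m}} (power-bound m y m≤2y j) ⟩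
  fromℕ m * (fromℕ (2 ^ℕ j) * y ^ j)              ≤⟨ *-monoʳ-≤-nonNeg (fromℕ (2 ^ℕ j) * y ^ j) {{nonNeg}} m≤2y ⟩
  fromℕ 2 * y * (fromℕ (2 ^ℕ j) * y ^ j)          ≡⟨ solve 4 (λ a y b z → a :* y :* (b :* z) ⊜ a :* b :* (y :* z)) refl (fromℕ 2) y (fromℕ (2 ^ℕ j)) (y ^ j) ⟩
  fromℕ 2 * fromℕ (2 ^ℕ j) * (y * y ^ j)          ≡⟨ cong (_* (y * y ^ j)) (fromℕ-* 2 (2 ^ℕ j)) ⟨
  fromℕ (2 ^ℕ suc j) * (y * y ^ j)                ∎
  where
  open ≤-Reasoning
  nonNeg : NonNegative (fromℕ (2 ^ℕ j) * y ^ j)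
  nonNeg = nonNeg*nonNeg⇒nonNeg (fromℕ (2 ^ℕ j)) {{fromℕ-nonNeg (2 ^ℕ j)}} (y ^ j) {{pos⇒nonNeg (y ^ j) {{^-pos y j}}}}

-- For `ε = p / q` the choice is `m = 1 + q div p`, the next integer above `1 / ε`. Since `p ≤ q`,
-- the added 1 at most doubles `1 / ε`.
reciprocal-ℕ : ∀ ε .{{_ : Positive ε}} → ε ≤ 1ℚ →
               Σ[ m ∈ ℕ ] NonZero m × 1ℚ ≤ fromℕ m * ε × fromℕ m ≤ fromℕ 2 * ε ⁻¹
reciprocal-ℕ ε@(mkℚ +[1+ p-1 ] q-1 c) ε≤1 = m , _ , lower , upper
  where
  p q m : ℕ
  p = suc p-1
  q = suc q-1
  m = suc (q ℕ./ p)
  p≤q : p ℕ.≤ q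
  p≤q = subst₂ ℕ._≤_ (ℕ.*-identityʳ p) (ℕ.+-identityʳ q) (drop‿+≤+ (drop-*≤* ε≤1))
  qε≡p : fromℕ q * ε ≡ fromℕ p
  qε≡p = toℚᵘ-injective (begin-equality
    toℚᵘ (fromℕ q * ε)                            ≃⟨ toℚᵘ-homo-* (fromℕ q) ε ⟩
    toℚᵘ (fromℕ q) ℚᵘ.* toℚᵘ ε                    ≃⟨ ℚᵘ.*-congʳ (toℚᵘ-fromℕ q) ⟩
    ℚᵘ.mkℚᵘ (+ q) 0 ℚᵘ.* ℚᵘ.mkℚᵘ (+ p) q-1        ≃⟨ ℚᵘ.*≡* (cong +_ (lemma q-1 p-1)) ⟩
    ℚᵘ.mkℚᵘ (+ p) 0                               ≃⟨ toℚᵘ-fromℕ p ⟨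
    toℚᵘ (fromℕ p)                                ∎)
    where
    open ℚᵘ.≤-Reasoning
    lemma : ∀ q p → (1 ℕ.+ q) ℕ.* (1 ℕ.+ p) ℕ.* 1 ≡ (1 ℕ.+ p) ℕ.* (1 ℕ.* (1 ℕ.+ q))
    lemma = solve-∀
  q≤mp : q ℕ.≤ m ℕ.* p
  q≤mp = ℕ.≤-trans (ℕ.≤-reflexive (m≡m%n+[m/n]*n q p)) (ℕ.+-monoˡ-≤ (q ℕ./ p ℕ.* p) (ℕ.<⇒≤ (m%n<n q p)))
  mp≤2q : m ℕ.* p ℕ.≤ 2 ℕ.* q
  mp≤2q = ℕ.+-mono-≤ p≤q (ℕ.≤-trans (m/n*n≤m q p) (ℕ.≤-reflexive (sym (ℕ.+-identityʳ q))))
  open ≤-Reasoning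
  lower : 1ℚ ≤ fromℕ m * ε
  lower = *-cancelˡ-≤-pos (fromℕ q) {{fromℕ-pos q}} (begin
    fromℕ q * 1ℚ            ≡⟨ *-identityʳ (fromℕ q) ⟩
    fromℕ q                 ≤⟨ fromℕ-mono-≤ q≤mp ⟩
    fromℕ (m ℕ.* p)         ≡⟨ fromℕ-* m p ⟩
    fromℕ m * fromℕ p       ≡⟨ cong (fromℕ m *_) qε≡p ⟨
    fromℕ m * (fromℕ q * ε) ≡⟨ solve 3 (λ m q e → m :* (q :* e) ⊜ q :* (m :* e)) refl (fromℕ m) (fromℕ q) ε ⟩
    fromℕ q * (fromℕ m * ε) ∎)
  upper : fromℕ m ≤ fromℕ 2 * ε ⁻¹
  upper = *-cancelˡ-≤-pos (fromℕ p) {{fromℕ-pos p}} (begin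
    fromℕ p * fromℕ m                ≡⟨ *-comm (fromℕ p) (fromℕ m) ⟩
    fromℕ m * fromℕ p                ≡⟨ fromℕ-* m p ⟨
    fromℕ (m ℕ.* p)                  ≤⟨ fromℕ-mono-≤ mp≤2q ⟩
    fromℕ (2 ℕ.* q)                  ≡⟨ fromℕ-* 2 q ⟩
    fromℕ 2 * fromℕ q                ≡⟨ cong (λ x → fromℕ 2 * x) (*-identityʳ (fromℕ q)) ⟨
    fromℕ 2 * (fromℕ q * 1ℚ)         ≡⟨ cong (λ x → fromℕ 2 * (fromℕ q * x)) (*-inverseʳ ε {{pos⇒nonZero ε}}) ⟨
    fromℕ 2 * (fromℕ q * (ε * ε ⁻¹)) ≡⟨ solve 4 (λ t q e i → t :* (q :* (e :* i)) ⊜ q :* e :* (t :* i)) refl (fromℕ 2) (fromℕ q) ε (ε ⁻¹) ⟩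
    fromℕ q * ε * (fromℕ 2 * ε ⁻¹)   ≡⟨ cong (_* (fromℕ 2 * ε ⁻¹)) qε≡p ⟩
    fromℕ p * (fromℕ 2 * ε ⁻¹)       ∎)
reciprocal-ℕ (mkℚ (+ zero) _ _) {{pos}} _ = ⊥-elim-irr (ℤ.Positive.pos pos)
reciprocal-ℕ (mkℚ ℤ.-[1+ _ ] _ _) {{pos}} _ = ⊥-elim-irr (ℤ.Positive.pos pos)

opaque
  -- Opaque, so that the large exponent and the powers built on it are never evaluated.
  timeBound : Bound
  timeBound = programTime scheme

  preclustering : ℕ → Cmd
  preclustering m = program scheme (spread m ℕ.* spread m)

  preclustering-run : ∀ {n} (I : Instance n) (m : ℕ) .{{_ : NonZero m}} →
    Run (preclustering m) (initial (encodeInstance I)) (at timeBound (n ℕ.+ spread m ℕ.* spread m ℕ.+ 2))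
        (λ τ → τ 0 ≡ encodePreclustered (Graph.Precluster.preclustered I m))
  preclustering-run I m = run-weaken ℕ.≤-refl
    (λ τ0 → trans τ0 (Graph.Precluster.encode-preclustered I m))
    (program-correct (Graph.plus I) (spread m ℕ.* spread m))

*-^-distrib : ∀ j x y → (x ℕ.* y) ^ℕ j ≡ x ^ℕ j ℕ.* y ^ℕ j
*-^-distrib zero    x y = refl
*-^-distrib (suc j) x y = trans (cong (x ℕ.* y ℕ.*_) (*-^-distrib j x y)) (lemma x y (x ^ℕ j) (y ^ℕ j))
  where
  lemma : ∀ x y z w → x ℕ.* y ℕ.* (z ℕ.* w) ≡ x ℕ.* z ℕ.* (y ℕ.* w)
  lemma = solve-∀

-- The sum is at most twice the larger summand.
+-^-≤ : ∀ x y j → (x ℕ.+ y) ^ℕ j ℕ.≤ 2 ^ℕ j ℕ.* x ^ℕ j ℕ.+ 2 ^ℕ j ℕ.* y ^ℕ j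
+-^-≤ x y j with ℕ.≤-total x y
... | inj₁ x≤y = begin
  (x ℕ.+ y) ^ℕ j              ≤⟨ ℕ.^-monoˡ-≤ j (ℕ.+-mono-≤ x≤y (ℕ.≤-reflexive (sym (ℕ.+-identityʳ y)))) ⟩
  (2 ℕ.* y) ^ℕ j              ≡⟨ *-^-distrib j 2 y ⟩
  2 ^ℕ j ℕ.* y ^ℕ j           ≤⟨ ℕ.m≤n+m _ _ ⟩
  _                           ∎
  where open ℕ.≤-Reasoning
... | inj₂ y≤x = begin
  (x ℕ.+ y) ^ℕ j              ≤⟨ ℕ.^-monoˡ-≤ j (ℕ.+-monoʳ-≤ x (ℕ.≤-trans y≤x (ℕ.≤-reflexive (sym (ℕ.+-identityʳ x))))) ⟩
  (2 ℕ.* x) ^ℕ j              ≡⟨ *-^-distrib j 2 x ⟩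
  2 ^ℕ j ℕ.* x ^ℕ j           ≤⟨ ℕ.m≤m+n _ _ ⟩
  _                           ∎
  where open ℕ.≤-Reasoning

spread²≤ : ∀ m .{{_ : NonZero m}} → spread m ℕ.* spread m ℕ.≤ 64 ℕ.* m ^ℕ 2
spread²≤ m = begin
  spread m ℕ.* spread m       ≤⟨ ℕ.*-mono-≤ spread≤ spread≤ ⟩
  8 ℕ.* m ℕ.* (8 ℕ.* m)       ≡⟨ lemma m ⟩
  64 ℕ.* m ^ℕ 2               ∎
  where
  open ℕ.≤-Reasoning
  lemma : ∀ m → 8 ℕ.* m ℕ.* (8 ℕ.* m) ≡ 64 ℕ.* (m ℕ.* (m ℕ.* 1))
  lemma = solve-∀
  lemma′ : ∀ m → 8 ℕ.* m ℕ.+ 4 ℕ.* 1 ≡ 4 ℕ.* m ℕ.+ 4 ℕ.+ 4 ℕ.* m ℕ.+ 0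
  lemma′ = solve-∀
  spread≤ : spread m ℕ.≤ 8 ℕ.* m
  spread≤ = subst (ℕ._≤ 8 ℕ.* m) (sym (spread≡ m)) (lin 0 (ℕ.*-monoʳ-≤ 4 (ℕ.>-nonZero⁻¹ m)) (lemma′ m))

-- Here `66 = 64 + 2`, with the additive 2 absorbed by `1 ≤ m ^ 2`.
argument≤ : ∀ n m .{{_ : NonZero m}} → n ℕ.+ spread m ℕ.* spread m ℕ.+ 2 ℕ.≤ n ℕ.+ 66 ℕ.* m ^ℕ 2
argument≤ n m = begin
  n ℕ.+ spread m ℕ.* spread m ℕ.+ 2         ≤⟨ ℕ.+-mono-≤ (ℕ.+-monoʳ-≤ n (spread²≤ m)) (ℕ.*-monoʳ-≤ 2 (ℕ.m^n>0 m 2)) ⟩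
  n ℕ.+ 64 ℕ.* m ^ℕ 2 ℕ.+ 2 ℕ.* m ^ℕ 2       ≡⟨ lemma n (m ^ℕ 2) ⟩
  n ℕ.+ 66 ℕ.* m ^ℕ 2                       ∎
  where
  open ℕ.≤-Reasoning
  lemma : ∀ n x → n ℕ.+ 64 ℕ.* x ℕ.+ 2 ℕ.* x ≡ n ℕ.+ 66 ℕ.* x
  lemma = solve-∀

-- The power `(n + 66 m²)^J` is split by `+-^-≤`, and `m ≤ 2 / ε` turns `m^(2J)` into `2^(2J)` times
-- a power of `1 / ε`.
timePolynomial : Polynomial
timePolynomial =
  (2 ^ℕ J , J , 0) ∷ (2 ^ℕ J ℕ.* 66 ^ℕ J ℕ.* 2 ^ℕ (2 ℕ.* J) , 0 , 2 ℕ.* J) ∷ []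
  where J = exponent timeBound

timePolynomial-bound : ∀ n m y .{{_ : NonZero m}} {{_ : Positive y}} → fromℕ m ≤ fromℕ 2 * y →
  fromℕ (at timeBound (n ℕ.+ spread m ℕ.* spread m ℕ.+ 2)) ≤ ⟦ timePolynomial ⟧ (fromℕ n) y
timePolynomial-bound n m y m≤2y = begin
  fromℕ (at timeBound (n ℕ.+ spread m ℕ.* spread m ℕ.+ 2))
    ≤⟨ fromℕ-mono-≤ natural ⟩
  fromℕ (A ℕ.* n ^ℕ J ℕ.+ B ℕ.* m ^ℕ (2 ℕ.* J))
    ≡⟨ fromℕ-+ (A ℕ.* n ^ℕ J) _ ⟩
  fromℕ (A ℕ.* n ^ℕ J) + fromℕ (B ℕ.* m ^ℕ (2 ℕ.* J))
    ≡⟨ cong₂ _+_ (trans (fromℕ-* A (n ^ℕ J)) (cong (fromℕ A *_) (fromℕ-^ n J))) (fromℕ-* B _) ⟩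
  fromℕ A * fromℕ n ^ J + fromℕ B * fromℕ (m ^ℕ (2 ℕ.* J))
    ≤⟨ +-monoʳ-≤ (fromℕ A * fromℕ n ^ J) (*-monoˡ-≤-nonNeg (fromℕ B) {{fromℕ-nonNeg B}} (power-bound m y m≤2y (2 ℕ.* J))) ⟩
  fromℕ A * fromℕ n ^ J + fromℕ B * (fromℕ D * y ^ (2 ℕ.* J))
    ≡⟨ solve 5 (λ a x b d z → a :* x :+ b :* (d :* z) ⊜ a :* x :* con 1ℚ :+ (b :* d :* con 1ℚ :* z :+ con 0ℚ)) refl
         (fromℕ A) (fromℕ n ^ J) (fromℕ B) (fromℕ D) (y ^ (2 ℕ.* J)) ⟩
  fromℕ A * fromℕ n ^ J * 1ℚ + (fromℕ B * fromℕ D * 1ℚ * y ^ (2 ℕ.* J) + 0ℚ)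
    ≡⟨ cong (λ c → fromℕ A * fromℕ n ^ J * 1ℚ + (c * 1ℚ * y ^ (2 ℕ.* J) + 0ℚ)) (fromℕ-* B D) ⟨
  ⟦ timePolynomial ⟧ (fromℕ n) y ∎
  where
  J A B D : ℕ
  J = exponent timeBound
  A = 2 ^ℕ J
  B = 2 ^ℕ J ℕ.* 66 ^ℕ J
  D = 2 ^ℕ (2 ℕ.* J)
  natural : at timeBound (n ℕ.+ spread m ℕ.* spread m ℕ.+ 2) ℕ.≤ A ℕ.* n ^ℕ J ℕ.+ B ℕ.* m ^ℕ (2 ℕ.* J)
  natural = begin
    at timeBound (n ℕ.+ spread m ℕ.* spread m ℕ.+ 2)  ≤⟨ at≤^ timeBound (ℕ.m≤n+m 2 _) ⟩
    (n ℕ.+ spread m ℕ.* spread m ℕ.+ 2) ^ℕ J                     ≤⟨ ℕ.^-monoˡ-≤ J (argument≤ n m) ⟩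
    (n ℕ.+ 66 ℕ.* m ^ℕ 2) ^ℕ J                                   ≤⟨ +-^-≤ n (66 ℕ.* m ^ℕ 2) J ⟩
    A ℕ.* n ^ℕ J ℕ.+ A ℕ.* (66 ℕ.* m ^ℕ 2) ^ℕ J                  ≡⟨ cong (λ x → A ℕ.* n ^ℕ J ℕ.+ A ℕ.* x)
      (trans (*-^-distrib J 66 (m ^ℕ 2)) (cong (66 ^ℕ J ℕ.*_) (ℕ.^-*-assoc m 2 J))) ⟩
    A ℕ.* n ^ℕ J ℕ.+ A ℕ.* (66 ^ℕ J ℕ.* m ^ℕ (2 ℕ.* J))          ≡⟨ cong (A ℕ.* n ^ℕ J ℕ.+_) (ℕ.*-assoc A (66 ^ℕ J) _) ⟨
    A ℕ.* n ^ℕ J ℕ.+ B ℕ.* m ^ℕ (2 ℕ.* J)                        ∎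
    where open ℕ.≤-Reasoning
  open ≤-Reasoning

cost-bound : ∀ m c′ c ε .{{_ : NonZero m}} → 1ℚ ≤ fromℕ m * ε → m ℕ.* c′ ℕ.≤ suc m ℕ.* c →
             fromℕ c′ ≤ (1ℚ + ε) * fromℕ c
cost-bound m c′ c ε 1≤mε le = *-cancelˡ-≤-pos (fromℕ m) {{fromℕ-pos m}} (begin
  fromℕ m * fromℕ c′                       ≡⟨ fromℕ-* m c′ ⟨
  fromℕ (m ℕ.* c′)                         ≤⟨ fromℕ-mono-≤ le ⟩
  fromℕ (suc m ℕ.* c)                      ≡⟨ fromℕ-* (suc m) c ⟩
  fromℕ (suc m) * fromℕ c                  ≡⟨ cong (_* fromℕ c) (fromℕ-+ 1 m) ⟩
  (1ℚ + fromℕ m) * fromℕ c                 ≤⟨ *-monoʳ-≤-nonNeg (fromℕ c) {{fromℕ-nonNeg c}} (+-monoˡ-≤ (fromℕ m) 1≤mε) ⟩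
  (fromℕ m * ε + fromℕ m) * fromℕ c        ≡⟨ solve 3 (λ m e c → (m :* e :+ m) :* c ⊜ m :* ((con 1ℚ :+ e) :* c)) refl (fromℕ m) ε (fromℕ c) ⟩
  fromℕ m * ((1ℚ + ε) * fromℕ c)           ∎)
  where open ≤-Reasoning

-- `681984 = 64 * 10656` combines `spread²≤` with `size-admissible`; the 4 comes from squaring
-- `m ≤ 2 / ε`.
sizeConstant : ℚ
sizeConstant = fromℕ 681984 * fromℕ 4

sizeConstant-pos : Positive sizeConstant
sizeConstant-pos = pos*pos⇒pos (fromℕ 681984) {{fromℕ-pos 681984}} (fromℕ 4) {{fromℕ-pos 4}}

size-bound : ∀ m y c x .{{_ : NonZero m}} {{_ : Positive y}} → fromℕ m ≤ fromℕ 2 * y →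
             x ℕ.≤ spread m ℕ.* spread m ℕ.* (10656 ℕ.* c) →
             fromℕ x ≤ sizeConstant * y ^ 2 * fromℕ c
size-bound m y c x m≤2y le = begin
  fromℕ x                                              ≤⟨ fromℕ-mono-≤ natural ⟩
  fromℕ (681984 ℕ.* m ^ℕ 2 ℕ.* c)                      ≡⟨ fromℕ-* (681984 ℕ.* m ^ℕ 2) c ⟩
  fromℕ (681984 ℕ.* m ^ℕ 2) * fromℕ c                  ≡⟨ cong (_* fromℕ c) (fromℕ-* 681984 (m ^ℕ 2)) ⟩
  fromℕ 681984 * fromℕ (m ^ℕ 2) * fromℕ c              ≤⟨ *-monoʳ-≤-nonNeg (fromℕ c) {{fromℕ-nonNeg c}}
    (*-monoˡ-≤-nonNeg (fromℕ 681984) {{fromℕ-nonNeg 681984}} (power-bound m y m≤2y 2)) ⟩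
  fromℕ 681984 * (fromℕ 4 * y ^ 2) * fromℕ c           ≡⟨ cong (_* fromℕ c) (*-assoc (fromℕ 681984) (fromℕ 4) (y ^ 2)) ⟨
  sizeConstant * y ^ 2 * fromℕ c                       ∎
  where
  natural : x ℕ.≤ 681984 ℕ.* m ^ℕ 2 ℕ.* c
  natural = ℕ.≤-trans le (ℕ.≤-trans (ℕ.*-monoˡ-≤ (10656 ℕ.* c) (spread²≤ m)) (ℕ.≤-reflexive (lemma (m ^ℕ 2) c)))
    where
    lemma : ∀ x c → 64 ℕ.* x ℕ.* (10656 ℕ.* c) ≡ 681984 ℕ.* x ℕ.* c
    lemma = solve-∀
  open ≤-Reasoning

theorem6 : Σ[ c ∈ ℚ ] Positive c ×
    (Σ[ ε₀ ∈ ℚ ] Positive ε₀ ×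
    (Σ[ p ∈ Polynomial ]
    ((ε : ℚ) .{{_ : Positive ε}} → ε ≤ ε₀ →
    Σ[ alg ∈ Cmd ]
    (∀ (n : ℕ) (I : Instance n) →
    Σ[ P ∈ Preclustered n ] Σ[ t ∈ ℕ ]
    (Computes alg (encodeInstance I) t (encodePreclustered P)
    × fromℕ t ≤ ⟦ p ⟧ (fromℕ n) (ε ⁻¹)
    × (∀ (opt : ℕ) → IsOpt I opt →
    (Σ[ C ∈ Clustering n ]
    (Good P C × fromℕ (cost I C) ≤ (1ℚ + ε) * fromℕ opt))
    × fromℕ (size (Preclustered.Eadm P)) ≤ c * (ε ⁻¹) ^ 2 * fromℕ opt))))))
theorem6 = sizeConstant , sizeConstant-pos , 1ℚ , _ , timePolynomial , λ ε ε≤1 →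
  let (m , m≢0 , 1≤mε , m≤2/ε) = reciprocal-ℕ ε ε≤1
      instance _ = m≢0
      instance _ = 1/pos⇒pos ε
  in preclustering m , λ n I →
    let open Graph I
        open Precluster m
        (t , τ , run , t≤ , τ0) = preclustering-run I m
    in preclustered , t , (τ , run , τ0)
     , ≤-trans (fromℕ-mono-≤ t≤) (timePolynomial-bound n m (ε ⁻¹) m≤2/ε)
     -- The optimum enters as the cost of a clustering `C`: the local search starts from `C`, and
     -- the disagreements of `C` pay for the admissible pairs.
     , λ { opt ((C , refl) , _) →
             (let (C′ , good , le) = near-optimal C in C′ , good , cost-bound m (cost I C′) (cost I C) ε 1≤mε le)
           , size-bound m (ε ⁻¹) (cost I C) (size admissible) m≤2/ε (size-admissible C) }
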